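{- Let $p>2$ be a prime and let $d\le e$ be positive integers. Then the automorphism group $G$ of a regular dessin with underlying graph $K_{p^d,p^e}$ is isomorphic to one of the following groups: (i) $\mathbf M_1(d,e,f)=\langle a,b\mid a^{p^e}=b^{p^d}=1,\ b^{ -1}ab=a^{1+p^f}\rangle$ where either $1\le d\le f\le e\le d+f$, or $1\le f<d\le e\le d+f$; (ii) $\mathbf M_2(d,e,f)=\langle a,b\mid a^{p^d}=b^{p^e}=1,\ b^{ -1}ab=a^{1+p^f}\rangle$ where $1\le f<d<e$; (iii) $\mathbf M_3(d,e,h,f)=\langle a,b\mid a^{p^h}=1,\ b^{p^{d+e-h}}=a^{p^d},\ b^{ -1}ab=a^{1+p^f}\rangle$ where $h-d\le f<d<h<e$. Moreover, the groups listed (across all families and all admissible parameter values) are pairwise non-isomorphic.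
   Context: A dessin is a $2$-cell embedding of a connected bipartite graph with vertices properly coloured black and white into an orientable closed surface; its automorphisms are edge permutations preserving the graph structure and vertex colours and extending to orientation-preserving self-homeomorphisms of the surface; it is regular if the automorphism group acts transitively on edges. -}

module Defs where

open import Level using (0ℓ)
open import Data.Nat using (ℕ; zero; suc; _+_; _∸_; _^_; _≤_; _<_)
open import Data.Fin using (Fin)
open import Data.Product using (Σ; ∃; _×_; _,_; proj₁; proj₂)
open import Data.Sum using (_⊎_)
open import Function using (_∘_)
open import Function.Bundles using (_⇔_)
open import Function.Definitions using (Bijective)
open import Relation.Binary.PropositionalEquality
open import Relation.Binary.Structures using (IsEquivalence)
open import Algebra.Bundles using (Group)
open import Algebra.Structures using (IsGroup)
open import Algebra.Morphism.Structures using (module GroupMorphisms)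

record Perm (N : ℕ) : Set where
  field
    to       : Fin N → Fin N
    from     : Fin N → Fin N
    to-from  : ∀ i → to (from i) ≡ i
    from-to  : ∀ i → from (to i) ≡ i
open Perm public

iter : {A : Set} → (A → A) → ℕ → A → A
iter f zero    a = a
iter f (suc k) a = f (iter f k a)

-- Dessins (combinatorial encoding): edges Fin N, x = rotation of edges
-- around black vertices, y = rotation of edges around white vertices.

data Reach {N : ℕ} (x y : Perm N) : Fin N → Fin N → Set where
  here   : ∀ {i} → Reach x y i i
  step-x : ∀ {i j} → Reach x y i j → Reach x y i (to x j)
  step-y : ∀ {i j} → Reach x y i j → Reach x y i (to y j)
  step-x⁻ : ∀ {i j} → Reach x y i j → Reach x y i (from x j)
  step-y⁻ : ∀ {i j} → Reach x y i j → Reach x y i (from y j)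

record Dessin (N : ℕ) : Set where
  field
    x y       : Perm N
    connected : ∀ i j → Reach x y i j
open Dessin public

record Aut {N : ℕ} (D : Dessin N) : Set where
  field
    σ      : Perm N
    comm-x : ∀ i → to σ (to (x D) i) ≡ to (x D) (to σ i)
    comm-y : ∀ i → to σ (to (y D) i) ≡ to (y D) (to σ i)
open Aut public

Regular : ∀ {N} → Dessin N → Set
Regular D = ∀ i j → Σ (Aut D) λ g → to (σ g) i ≡ j

-- two edges lie in the same cycle of π (i.e. are incident with the same vertex)
SameOrbit : ∀ {N} → Perm N → Fin N → Fin N → Set
SameOrbit π i j = ∃ λ k → iter (to π) k i ≡ j

-- the underlying bipartite graph is K_{m,n} with m black and n white vertices:
-- edges correspond bijectively to pairs (black vertex, white vertex)
UnderlyingK : ∀ {N} → Dessin N → ℕ → ℕ → Set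
UnderlyingK {N} D m n =
  Σ (Fin N → Fin m × Fin n) λ φ →
    Bijective _≡_ _≡_ φ
    × (∀ i j → (proj₁ (φ i) ≡ proj₁ (φ j)) ⇔ SameOrbit (x D) i j)
    × (∀ i j → (proj₂ (φ i) ≡ proj₂ (φ j)) ⇔ SameOrbit (y D) i j)

private
  inj : ∀ {N} (π : Perm N) {i j} → to π i ≡ to π j → i ≡ j
  inj π {i} {j} e = trans (sym (from-to π i)) (trans (cong (from π) e) (from-to π j))

module _ {N : ℕ} (D : Dessin N) where
  private
    _≈A_ : Aut D → Aut D → Set
    g ≈A h = ∀ i → to (σ g) i ≡ to (σ h) i

    compP : Perm N → Perm N → Perm N
    compP f g = record
      { to = to f ∘ to g ; from = from g ∘ from f
      ; to-from = λ i → trans (cong (to f) (to-from g (from f i))) (to-from f i)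
      ; from-to = λ i → trans (cong (from g) (from-to f (to g i))) (from-to g i) }

    invP : Perm N → Perm N
    invP f = record { to = from f ; from = to f ; to-from = from-to f ; from-to = to-from f }

    idP : Perm N
    idP = record { to = λ i → i ; from = λ i → i ; to-from = λ _ → refl ; from-to = λ _ → refl }

    _∙A_ : Aut D → Aut D → Aut D
    g ∙A h = record
      { σ = compP (σ g) (σ h)
      ; comm-x = λ i → trans (cong (to (σ g)) (comm-x h i)) (comm-x g (to (σ h) i))
      ; comm-y = λ i → trans (cong (to (σ g)) (comm-y h i)) (comm-y g (to (σ h) i)) }

    εA : Aut D
    εA = record { σ = idP ; comm-x = λ _ → refl ; comm-y = λ _ → refl }

    invComm : (π s : Perm N) → (∀ i → to s (to π i) ≡ to π (to s i))
            → ∀ i → from s (to π i) ≡ to π (from s i)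
    invComm π s c i = inj s (trans (to-from s (to π i))
                        (sym (trans (c (from s i)) (cong (to π) (to-from s i)))))

    _⁻¹A : Aut D → Aut D
    g ⁻¹A = record
      { σ = invP (σ g)
      ; comm-x = invComm (x D) (σ g) (comm-x g)
      ; comm-y = invComm (y D) (σ g) (comm-y g) }

    isGrp : IsGroup _≈A_ _∙A_ εA _⁻¹A
    isGrp = record
      { isMonoid = record
        { isSemigroup = record
          { isMagma = record
            { isEquivalence = record
              { refl = λ _ → refl
              ; sym = λ p i → sym (p i)
              ; trans = λ p q i → trans (p i) (q i) }
            ; ∙-cong = λ {g} {g'} {h} {h'} p q i →
                trans (cong (to (σ g)) (q i)) (p (to (σ h') i)) }
          ; assoc = λ _ _ _ _ → refl }
        ; identity = (λ _ _ → refl) , (λ _ _ → refl) }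
      ; inverse = (λ g i → from-to (σ g) i) , (λ g i → to-from (σ g) i)
      ; ⁻¹-cong = λ {g} {h} p i →
          inj (σ g) (trans (to-from (σ g) i)
            (sym (trans (p (from (σ h) i)) (to-from (σ h) i)))) }

  AutGroup : Group 0ℓ 0ℓ
  AutGroup = record
    { Carrier = Aut D ; _≈_ = _≈A_ ; _∙_ = _∙A_ ; ε = εA ; _⁻¹ = _⁻¹A
    ; isGroup = isGrp }

module _ (G : Group 0ℓ 0ℓ) where
  open Group G

  pow : Carrier → ℕ → Carrier
  pow g zero    = ε
  pow g (suc k) = g ∙ pow g k

  data Word : Set where
    gen-a gen-b one : Word
    inv : Word → Word
    mul : Word → Word → Word

  eval : Carrier → Carrier → Word → Carrier
  eval a b gen-a     = a
  eval a b gen-b     = b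
  eval a b one       = ε
  eval a b (inv w)   = eval a b w ⁻¹
  eval a b (mul v w) = eval a b v ∙ eval a b w

Relations : Set₁
Relations = (H : Group 0ℓ 0ℓ) → Group.Carrier H → Group.Carrier H → Set

-- G ≅ ⟨ a , b ∣ R ⟩ : G is generated by elements a, b satisfying R, and
-- (universal property) any pair satisfying R in any group H is the image of
-- (a , b) under a group homomorphism G → H.
Presents : Group 0ℓ 0ℓ → Relations → Set₁
Presents G R =
  Σ (Group.Carrier G) λ a → Σ (Group.Carrier G) λ b →
    R G a b
    × (∀ g → Σ (Word G) λ w → Group._≈_ G (eval G a b w) g)
    × ((H : Group 0ℓ 0ℓ) (a′ b′ : Group.Carrier H) → R H a′ b′ →
        Σ (Group.Carrier G → Group.Carrier H) λ f →
          GroupMorphisms.IsGroupHomomorphism (Group.rawGroup G) (Group.rawGroup H) f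
          × Group._≈_ H (f a) a′ × Group._≈_ H (f b) b′)

data Family : Set where
  M₁ : (d e f : ℕ) → Family
  M₂ : (d e f : ℕ) → Family
  M₃ : (d e h f : ℕ) → Family

dOf eOf : Family → ℕ
dOf (M₁ d e f)   = d
dOf (M₂ d e f)   = d
dOf (M₃ d e h f) = d
eOf (M₁ d e f)   = e
eOf (M₂ d e f)   = e
eOf (M₃ d e h f) = e

Admissible : Family → Set
Admissible (M₁ d e f) =
  (1 ≤ d × d ≤ f × f ≤ e × e ≤ d + f) ⊎ (1 ≤ f × f < d × d ≤ e × e ≤ d + f)
Admissible (M₂ d e f) = 1 ≤ f × f < d × d < e
Admissible (M₃ d e h f) = h ∸ d ≤ f × f < d × d < h × h < e

conj : (H : Group 0ℓ 0ℓ) → Group.Carrier H → Group.Carrier H → Group.Carrier H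
conj H a b = Group._∙_ H (Group._∙_ H (Group._⁻¹ H b) a) b

rels : ℕ → Family → Relations
rels p (M₁ d e f) H a b =
  pow H a (p ^ e) ≈ ε × pow H b (p ^ d) ≈ ε × conj H a b ≈ pow H a (1 + p ^ f)
  where open Group H
rels p (M₂ d e f) H a b =
  pow H a (p ^ d) ≈ ε × pow H b (p ^ e) ≈ ε × conj H a b ≈ pow H a (1 + p ^ f)
  where open Group H
rels p (M₃ d e h f) H a b =
  pow H a (p ^ h) ≈ ε × pow H b (p ^ (d + e ∸ h)) ≈ pow H a (p ^ d)
    × conj H a b ≈ pow H a (1 + p ^ f)
  where open Group H

{-# OPTIONS --safe #-}
module Submission where

-- A regular dessin on K_{p^d,p^e} makes its automorphism group G an exact product ⟨a⟩⟨b⟩ of cyclic groups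
-- of orders p^e and p^d (the rotations of the two vertices of an edge). A pigeonhole argument shows that the
-- subgroup of order p of the larger factor is central; induction modulo this subgroup yields q with
-- G′ ≤ ⟨q⟩ ≤ Φ(G). Since p is odd, powers of p are multiplicative up to powers of q, so q is a proper p-th
-- power of some c = aᴵbᴶ with I or J prime to p. Then ⟨c⟩ is normal and G = ⟨c⟩⟨b⟩ or G = ⟨c⟩⟨a⟩; the order of
-- ⟨c⟩ modulo ⟨b⟩ or ⟨a⟩, and a discrete logarithm modulo p^k turning the action into 1 + p^f, give the three families.
--
-- Conversely the exponent of G, the exponent of G′ and the two invariants of G / G′ determine the family and
-- its parameters. Lower bounds for them come from an affine model acting on ℤ/p^k and from the coordinates of G / G′.

open import Defs
open import Level using (0ℓ)
open import Data.Nat using (ℕ; zero; suc; pred; _⊔_; _⊓_; _+_; _*_; _∸_; _^_; _≤_; _<_; z≤n; s≤s; NonZero;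
  >-nonZero; >-nonZero⁻¹)
open import Data.Nat.Properties
open import Data.Nat.Divisibility
open import Data.Nat.DivMod using (_%_; _/_; m≡m%n+[m/n]*n; m%n<n)
open import Data.Nat.Primality using (Prime; prime⇒nonZero; euclidsLemma; prime⇒irreducible)
open import Data.Nat.Coprimality using (Coprime; coprime-Bézout)
open import Data.Nat.GCD using (module Bézout)
open import Data.Nat.Tactic.RingSolver using (solve-∀)
open import Data.Fin as Fin using (Fin; toℕ; fromℕ<)
import Data.Fin.Properties as Fin
open import Data.Product using (Σ; ∃; ∃₂; _×_; _,_; proj₁; proj₂)
open import Data.Sum using (_⊎_; inj₁; inj₂)
open import Data.Empty using (⊥; ⊥-elim)
open import Relation.Nullary using (¬_; Dec; yes; no)
open import Relation.Binary.PropositionalEquality using (_≡_; refl; sym; trans; cong; cong₂; subst; subst₂)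
open import Function.Bundles using (module Equivalence)
open import Algebra.Bundles using (Group)
open import Algebra.Morphism.Structures using (module GroupMorphisms)
open import Tactic.MonoidSolver using () renaming (solve to msolve)
import Algebra.Properties.Group as GroupProperties
import Relation.Binary.Reasoning.Setoid as SetoidReasoning


-- Arithmetic modulo powers of p

-- The delicate point of the induction is that cyclicity of the commutators has to survive a central
-- extension. Downstairs the group is spanned by a normal ⟨c⟩ and one further element g, with c g =
-- g c^(1 + pw). Upstairs this holds only up to the central element z, and the commutator of c and g
-- becomes q = c^(pw) z^u. As z is central and q commutes with c, conjugation by g sends q to q^(1 +
-- pw); hence ⟨q⟩ is normal and absorbs all commutators. The two coordinates of G / Φ(G) are carried
-- along the induction because they force both exponents of q to be divisible by p.
--
-- The order of G is never counted. Exponents are natural numbers, congruences allow multiples of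
-- the modulus on both sides, and orders enter only through the exponents that give the identity.

record Cong (M x y : ℕ) : Set where
  constructor mkC
  field
    cs ct : ℕ
    ceq   : x + cs * M ≡ y + ct * M

module _ {M : ℕ} where

  c-refl : ∀ {x} → Cong M x x
  c-refl = mkC 0 0 refl

  c-≡ : ∀ {x y} → x ≡ y → Cong M x y
  c-≡ refl = c-refl

  c-sym : ∀ {x y} → Cong M x y → Cong M y x
  c-sym (mkC s t e) = mkC t s (sym e)

  c-trans : ∀ {x y z} → Cong M x y → Cong M y z → Cong M x z
  c-trans {x} {y} {z} (mkC s t e) (mkC s′ t′ e′) = mkC (s + s′) (t + t′)
    (trans (l₁ x s s′ M) (trans (cong (_+ s′ * M) e) (trans (l₂ y t s′ M)
      (trans (cong (_+ t * M) e′) (l₃ z t t′ M)))))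
    where
    l₁ : ∀ x s s′ M → x + (s + s′) * M ≡ (x + s * M) + s′ * M
    l₁ = solve-∀
    l₂ : ∀ y t s′ M → (y + t * M) + s′ * M ≡ (y + s′ * M) + t * M
    l₂ = solve-∀
    l₃ : ∀ z t t′ M → (z + t′ * M) + t * M ≡ z + (t + t′) * M
    l₃ = solve-∀

  c-+ : ∀ {x x′ y y′} → Cong M x x′ → Cong M y y′ → Cong M (x + y) (x′ + y′)
  c-+ {x} {x′} {y} {y′} (mkC s t e) (mkC s′ t′ e′) = mkC (s + s′) (t + t′)
    (trans (l x y s s′ M) (trans (cong₂ _+_ e e′) (sym (l x′ y′ t t′ M))))
    where
    l : ∀ x y s s′ M → (x + y) + (s + s′) * M ≡ (x + s * M) + (y + s′ * M)
    l = solve-∀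

  c-*ʳ : ∀ {x x′} k → Cong M x x′ → Cong M (x * k) (x′ * k)
  c-*ʳ {x} {x′} k (mkC s t e) = mkC (s * k) (t * k)
    (trans (l x s k M) (trans (cong (_* k) e) (sym (l x′ t k M))))
    where
    l : ∀ x s k M → x * k + s * k * M ≡ (x + s * M) * k
    l = solve-∀

  c-*ˡ : ∀ {x x′} k → Cong M x x′ → Cong M (k * x) (k * x′)
  c-*ˡ {x} {x′} k c = subst₂ (Cong M) (*-comm x k) (*-comm x′ k) (c-*ʳ k c)

  c-* : ∀ {x x′ y y′} → Cong M x x′ → Cong M y y′ → Cong M (x * y) (x′ * y′)
  c-* {x} {x′} {y} {y′} c d = c-trans (c-*ʳ y c) (c-*ˡ x′ d)

  c-^ : ∀ {x x′} n → Cong M x x′ → Cong M (x ^ n) (x′ ^ n)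
  c-^ zero    c = c-refl
  c-^ (suc n) c = c-* c (c-^ n c)

  ∣⇒c : ∀ {x} → M ∣ x → Cong M x 0
  ∣⇒c (divides q refl) = mkC 0 q (+-identityʳ _)

  c-∣ : ∀ {x y} → Cong M x y → M ∣ y → M ∣ x
  c-∣ {x} {y} (mkC s t e) M∣y = ∣m+n∣m⇒∣n
    (subst (M ∣_) (trans (sym e) (+-comm x (s * M))) (∣m∣n⇒∣m+n M∣y (n∣m*n t))) (n∣m*n s)

  c⇒∣ : ∀ {x} → Cong M x 0 → M ∣ x
  c⇒∣ c = c-∣ c (M ∣0)

  c-+-cancelʳ : ∀ {x y} k → Cong M (x + k) (y + k) → Cong M x y
  c-+-cancelʳ {x} {y} k (mkC s t e) = mkC s t
    (+-cancelʳ-≡ k _ _ (trans (l x s k M) (trans e (sym (l y t k M)))))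
    where
    l : ∀ x s k M → x + s * M + k ≡ x + k + s * M
    l = solve-∀

  c-+-cancelˡ : ∀ {x y} k → Cong M (k + x) (k + y) → Cong M x y
  c-+-cancelˡ {x} {y} k c = c-+-cancelʳ k (subst₂ (Cong M) (+-comm k x) (+-comm k y) c)

  ∣⇒c+ : ∀ {x} y → M ∣ x → Cong M (x + y) y
  ∣⇒c+ y d = c-+ (∣⇒c d) c-refl

  ∣⇒c+ʳ : ∀ {x} y → M ∣ x → Cong M (y + x) y
  ∣⇒c+ʳ {x} y d = subst (λ k → Cong M k y) (+-comm x y) (∣⇒c+ y d)

c-weaken : ∀ {M M′ x y} → M′ ∣ M → Cong M x y → Cong M′ x y
c-weaken {x = x} {y} (divides q refl) (mkC s t e) = mkC (s * q) (t * q)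
  (trans (cong (x +_) (*-assoc s q _)) (trans e (cong (y +_) (sym (*-assoc t q _)))))

c-scale : ∀ {M x y} k → Cong M x y → Cong (k * M) (k * x) (k * y)
c-scale {M} {x} {y} k (mkC s t e) = mkC s t
  (trans (l x s k M) (trans (cong (k *_) e) (sym (l y t k M))))
  where
  l : ∀ x s k M → k * x + s * (k * M) ≡ k * (x + s * M)
  l = solve-∀

c-unscale : ∀ {M x y} k .{{_ : NonZero k}} → Cong (k * M) (k * x) (k * y) → Cong M x y
c-unscale {M} {x} {y} k (mkC s t e) = mkC s t
  (*-cancelˡ-≡ _ _ k (trans (sym (l x s k M)) (trans e (l y t k M))))
  where
  l : ∀ x s k M → k * x + s * (k * M) ≡ k * (x + s * M)
  l = solve-∀

^-∣ : ∀ p {m n} → m ≤ n → (p ^ m) ∣ (p ^ n)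
^-∣ p {m} {n} m≤n = divides (p ^ (n ∸ m))
  (trans (cong (p ^_) (sym (m∸n+n≡m m≤n))) (^-distribˡ-+-* p (n ∸ m) m))

pos-suc : ∀ n .{{_ : NonZero n}} → ∃ λ k → n ≡ suc k
pos-suc (suc k) = k , refl

-- The binomial coefficient n(n - 1)/2: the second-order coefficient of a power of `1 + X`, and also
-- the number of swaps of h past g that sort (g h)^n.
tri : ℕ → ℕ
tri zero    = 0
tri (suc n) = n + tri n

2*tri : ∀ n → 2 * tri (suc n) ≡ suc n * n
2*tri zero    = refl
2*tri (suc n) = trans (*-distribˡ-+ 2 (suc n) (tri (suc n)))
  (trans (cong (2 * suc n +_) (2*tri n)) (l n))
  where
  l : ∀ n → 2 * suc n + suc n * n ≡ suc (suc n) * suc n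
  l = solve-∀

expand₂ : ∀ X n → ∃ λ R → (1 + X) ^ n ≡ 1 + n * X + tri n * (X * X) + X * X * X * R
expand₂ X zero = 0 , l X
  where
  l : ∀ X → 1 ≡ 1 + 0 * X + 0 * (X * X) + X * X * X * 0
  l = solve-∀
expand₂ X (suc n) with expand₂ X n
... | R , e = tri n + R + X * R , trans (cong ((1 + X) *_) e) (l X n (tri n) R)
  where
  l : ∀ X n t R → (1 + X) * (1 + n * X + t * (X * X) + X * X * X * R)
    ≡ 1 + suc n * X + (n + t) * (X * X) + X * X * X * (t + R + X * R)
  l = solve-∀

expand₁ : ∀ X n → ∃ λ R → (1 + X) ^ n ≡ 1 + n * X + X * X * R
expand₁ X n with expand₂ X n
... | R , e = tri n + X * R , trans e (l X n (tri n) R)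
  where
  l : ∀ X n t R → 1 + n * X + t * (X * X) + X * X * X * R ≡ 1 + n * X + X * X * (t + X * R)
  l = solve-∀

binom : ℕ → ℕ → ℕ
binom _       zero    = 1
binom zero    (suc k) = 0
binom (suc n) (suc k) = binom n k + binom n (suc k)

-- Absorption replaces the factorial formula: it exhibits the factor `suc n` without a division, and
-- Euclid's lemma then moves that factor to the binomial coefficient.
binom-absorb : ∀ n k → suc k * binom (suc n) (suc k) ≡ suc n * binom n k
binom-absorb zero zero = refl
binom-absorb zero (suc k) = *-zeroʳ (suc (suc k))
binom-absorb (suc n) zero = trans (l (binom (suc n) 1)) (trans (cong suc (binom-absorb n 0)) refl)
  where
  l : ∀ b → 1 * (1 + b) ≡ suc (1 * b)
  l = solve-∀
binom-absorb (suc n) (suc k) = trans (l₁ k (binom n k) (binom n (suc k)) (binom (suc n) (suc (suc k))))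
  (trans (cong₂ (λ u v → (binom n k + binom n (suc k)) + u + v)
           (binom-absorb n k) (binom-absorb n (suc k)))
    (l₂ n (binom n k) (binom n (suc k))))
  where
  l₁ : ∀ k a b c → suc (suc k) * ((a + b) + c) ≡ (a + b) + suc k * (a + b) + suc (suc k) * c
  l₁ = solve-∀
  l₂ : ∀ n a b → (a + b) + suc n * a + suc n * b ≡ suc (suc n) * (a + b)
  l₂ = solve-∀

binom-big : ∀ n k → binom n (suc (n + k)) ≡ 0
binom-big zero    k = refl
binom-big (suc n) k = cong₂ _+_ (binom-big n k)
  (trans (cong (λ j → binom n (suc j)) (sym (+-suc n k))) (binom-big n (suc k)))

binom-diag : ∀ n → binom n n ≡ 1
binom-diag zero    = refl
binom-diag (suc n) = cong₂ _+_ (binom-diag n)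
  (trans (cong (λ j → binom n (suc j)) (sym (+-identityʳ n))) (binom-big n 0))

-- Partial sums of the binomial expansion. The free upper limit lets Pascal's rule be summed by
-- induction and the middle terms be discarded one at a time modulo p.
binomSum : ℕ → ℕ → ℕ → ℕ
binomSum n v zero    = 0
binomSum n v (suc K) = binomSum n v K + binom n K * v ^ K

binomSum-suc : ∀ n v K → binomSum (suc n) v (suc K) ≡ binomSum n v (suc K) + v * binomSum n v K
binomSum-suc n v zero    = l v
  where
  l : ∀ v → 0 + 1 * 1 ≡ 0 + 1 * 1 + v * 0
  l = solve-∀
binomSum-suc n v (suc K) = trans (cong (_+ binom (suc n) (suc K) * (v * v ^ K)) (binomSum-suc n v K))
  (l (binomSum n v (suc K)) (binomSum n v K) v (v ^ K) (binom n K) (binom n (suc K)))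
  where
  l : ∀ A B v w b c → (A + v * B) + (b + c) * (v * w) ≡ (A + c * (v * w)) + v * (B + b * w)
  l = solve-∀

binomial : ∀ n v → binomSum n v (suc n) ≡ (1 + v) ^ n
binomial zero    v = refl
binomial (suc n) v = trans (binomSum-suc n v (suc n))
  (trans (cong (λ k → (binomSum n v (suc n) + k * v ^ suc n) + v * binomSum n v (suc n))
           (trans (cong (λ j → binom n (suc j)) (sym (+-identityʳ n))) (binom-big n 0)))
  (trans (l (binomSum n v (suc n)) v (v ^ suc n)) (cong ((1 + v) *_) (binomial n v))))
  where
  l : ∀ A v w → (A + 0 * w) + v * A ≡ (1 + v) * A
  l = solve-∀

module Arith (p : ℕ) (pr : Prime p) (2<p : 2 < p) where

  instance
    p-nz : NonZero p
    p-nz = prime⇒nonZero pr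

  pow-nz : ∀ n → NonZero (p ^ n)
  pow-nz n = m^n≢0 p n

  ∤-* : ∀ {x y} → ¬ p ∣ x → ¬ p ∣ y → ¬ p ∣ x * y
  ∤-* {x} {y} a b d with euclidsLemma x y pr d
  ... | inj₁ u = a u
  ... | inj₂ u = b u

  p∤1 : ¬ p ∣ 1
  p∤1 d = <⇒≱ (≤-trans (s≤s (s≤s z≤n)) 2<p) (∣⇒≤ d)

  c-∤ : ∀ {x y} → Cong p x y → ¬ p ∣ y → ¬ p ∣ x
  c-∤ c h d = h (c-∣ (c-sym c) d)

  p∣tri : p ∣ tri p
  p∣tri with pos-suc p
  ... | k , refl with euclidsLemma 2 (tri (suc k)) pr (subst (suc k ∣_) (sym (2*tri k)) (m∣m*n k))
  ...   | inj₁ d = ⊥-elim (<⇒≱ 2<p (∣⇒≤ d))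
  ...   | inj₂ d = d

  p∣binom : ∀ k → suc k < p → p ∣ binom p (suc k)
  p∣binom k k<p with pos-suc p
  ... | n , refl with euclidsLemma (suc k) (binom (suc n) (suc k)) pr
                        (subst (suc n ∣_) (sym (binom-absorb n k)) (m∣m*n (binom n k)))
  ...   | inj₁ d = ⊥-elim (<⇒≱ k<p (∣⇒≤ d))
  ...   | inj₂ d = d

  freshman : ∀ v → Cong p ((1 + v) ^ p) (1 + v ^ p)
  freshman v = subst (λ s → Cong p s (1 + v ^ p)) (binomial p v)
    (c-+ {x = binomSum p v p} (belowp) (c-≡ (trans (cong (_* v ^ p) (binom-diag p)) (*-identityˡ _))))
    where
    below : ∀ K → suc K ≤ p → Cong p (binomSum p v (suc K)) 1
    below zero    _   = c-refl
    below (suc K) K<p = c-+ (below K (≤-trans (n≤1+n _) K<p))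
      (∣⇒c (∣m⇒∣m*n (v ^ suc K) (p∣binom K K<p)))
    belowp : Cong p (binomSum p v p) 1
    belowp = subst (λ k → Cong p (binomSum p v k) 1) (suc-pred p) (below (pred p) (≤-reflexive (suc-pred p)))

  fermat : ∀ v → Cong p (v ^ p) v
  fermat zero with pos-suc p
  ... | k , refl = c-refl
  fermat (suc v) = c-trans (freshman v) (c-+ {x = 1} c-refl (fermat v))

  fermat^ : ∀ n v → Cong p (v ^ (p ^ n)) v
  fermat^ zero    v = c-≡ (*-identityʳ v)
  fermat^ (suc n) v = c-trans (c-≡ (sym (^-*-assoc v p (p ^ n))))
    (c-trans (c-^ (p ^ n) (fermat v)) (fermat^ n v))

  abstract
    inv-p : ∀ u → ¬ p ∣ u → ∃ λ w → Cong p (u * w) 1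
    inv-p u h with coprime-Bézout {u} {p} cop
      where
      cop : Coprime u p
      cop {d} (d∣u , d∣p) with prime⇒irreducible pr d∣p
      ... | inj₁ e    = e
      ... | inj₂ refl = ⊥-elim (h d∣u)
    ... | Bézout.+- x y e = x , mkC 0 y (trans (+-identityʳ _) (trans (*-comm u x) (sym e)))
    -- Here 1 + xu = yp, so xu is -1 modulo p, and u times x(xu) is its square.
    ... | Bézout.-+ x y e = x * (x * u) , mkC (2 * y) (y * y * p)
      (trans (l₁ u x y p) (trans (cong (λ k → x * u * (x * u) + 2 * k) (sym e)) (trans (l₂ (x * u))
        (trans (cong (λ k → 1 + k * k) e) (l₃ y p)))))
      where
      l₁ : ∀ u x y p → u * (x * (x * u)) + 2 * y * p ≡ x * u * (x * u) + 2 * (y * p)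
      l₁ = solve-∀
      l₂ : ∀ k → k * k + 2 * (1 + k) ≡ 1 + (1 + k) * (1 + k)
      l₂ = solve-∀
      l₃ : ∀ y p → 1 + y * p * (y * p) ≡ 1 + y * y * p * p
      l₃ = solve-∀

  one-pow : ∀ L t → ∃ λ r → (1 + p * t) ^ (p ^ L) ≡ 1 + p ^ suc L * r
  one-pow zero t = t , l p t
    where
    l : ∀ p t → (1 + p * t) * 1 ≡ 1 + p * 1 * t
    l = solve-∀
  one-pow (suc L) t with one-pow L t
  ... | r , e with expand₁ (p ^ suc L * r) p
  ...   | R , e′ = r + p ^ L * (r * (r * R)) ,
    trans (cong ((1 + p * t) ^_) (*-comm p (p ^ L))) (trans (sym (^-*-assoc (1 + p * t) (p ^ L) p))
      (trans (cong (_^ p) e) (trans e′ (l p (p ^ L) r R))))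
    where
    l : ∀ p q r R → 1 + p * (p * q * r) + p * q * r * (p * q * r) * R
      ≡ 1 + p * (p * q) * (r + q * (r * (r * R)))
    l = solve-∀

  -- A natural number congruent to 1 cannot lie below 1, because 0 is excluded by p > 2; so the
  -- quotient is itself a natural number.
  cong-1 : ∀ {y} → Cong p y 1 → ∃ λ t → y ≡ 1 + p * t
  cong-1 {y} (mkC s t e) with ≤-total s t
  ... | inj₁ s≤t = t ∸ s , +-cancelʳ-≡ (s * p) _ _ (trans e
          (trans (cong (λ k → 1 + k * p) (sym (m∸n+n≡m s≤t))) (l p (t ∸ s) s)))
    where
    l : ∀ p d s → 1 + (d + s) * p ≡ 1 + p * d + s * p
    l = solve-∀
  ... | inj₂ t≤s with s ∸ t in eq
  ...   | zero  = 0 , trans (+-cancelʳ-≡ (t * p) y 1 (trans (cong (λ k → y + k * p) (≤-antisym t≤s (m∸n≡0⇒m≤n eq))) e))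
                    (cong suc (sym (*-zeroʳ p)))
  ...   | suc d = ⊥-elim (bad y≡)
    where
    y≡ : y + suc d * p ≡ 1
    y≡ = +-cancelʳ-≡ (t * p) _ _ (trans (trans (+-assoc y _ _) (cong (y +_) (trans (sym (*-distribʳ-+ p (suc d) t))
           (cong (_* p) (trans (cong (_+ t) (sym eq)) (m∸n+n≡m t≤s)))))) e)
    bad : ¬ (y + suc d * p ≡ 1)
    bad e₁ = <⇒≱ 2<p (≤-trans (≤-trans (m≤m+n p (d * p)) (m≤n+m _ y)) (≤-trans (≤-reflexive e₁) (s≤s z≤n)))

  abstract
    -- If uw is 1 modulo p, then (uw)^(p^L) is 1 modulo p^L; splitting off one factor u leaves the
    -- inverse. No Bézout identity for p^L is needed.
    inv-mod : ∀ L u → ¬ p ∣ u → ∃ λ w → Cong (p ^ L) (u * w) 1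
    inv-mod L u h with inv-p u h
    ... | w , c with cong-1 c | pos-suc (p ^ L) {{pow-nz L}}
    ...   | t , e | K , eK with one-pow L t
    ...     | r , e₂ = w * (u * w) ^ K , c-trans (c-≡ (trans (l u w ((u * w) ^ K))
                (trans (cong ((u * w) ^_) (sym eK)) (trans (cong (_^ p ^ L) e) e₂))))
              (∣⇒c+ʳ 1 (∣m⇒∣m*n r (n∣m*n p)))
      where
      l : ∀ u w k → u * (w * k) ≡ u * w * k
      l = solve-∀

  -- (1 + X)ᵖ = 1 + pX + p(p−1)/2 X² + X³R, so for X = pᶠv with f ≥ 1 the last two terms vanish
  -- modulo pᶠ⁺²; this is where p > 2 is needed.
  lte : ∀ f v → ∃ λ v′ → Cong p v′ v × (1 + p ^ suc f * v) ^ p ≡ 1 + p ^ suc (suc f) * v′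
  lte f v with expand₂ (p ^ suc f * v) p | p∣tri | p≡
    where
    p≡ : ∃ λ k → p ≡ 3 + k
    p≡ = p ∸ 3 , sym (m+[n∸m]≡n 2<p)
  ... | R , e | divides T eT | k , _ = v + p * D ,
    ∣⇒c+ʳ v (m∣m*n D) ,
    trans e (trans (cong (λ τ → 1 + p * (p ^ suc f * v) + τ * (p ^ suc f * v * (p ^ suc f * v)) +
      p ^ suc f * v * (p ^ suc f * v) * (p ^ suc f * v) * R) eT)
      (trans (cong (λ X → 1 + p * X + T * p * (X * X) + X * X * X * R) (*-assoc p (p ^ f) v))
        (trans (cong suc (l₁ p (p ^ f * v) T R)) (cong suc (l₂ p (p ^ f) v (T * (p ^ f * v) + p ^ f * v * (p ^ f * v) * R))))))
    where
    D = v * (T * (p ^ f * v) + p ^ f * v * (p ^ f * v) * R)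
    l₁ : ∀ p y T R → p * (p * y) + T * p * (p * y * (p * y)) + p * y * (p * y) * (p * y) * R
      ≡ p * p * (y * (1 + p * (T * y + y * y * R)))
    l₁ = solve-∀
    l₂ : ∀ p q v z → p * p * (q * v * (1 + p * z)) ≡ p * (p * q) * (v + p * (v * z))
    l₂ = solve-∀

  lte^ : ∀ f v k → ∃ λ v′ → Cong p v′ v × (1 + p ^ suc f * v) ^ (p ^ k) ≡ 1 + p ^ suc (f + k) * v′
  lte^ f v zero = v , c-refl , trans (*-identityʳ _) (cong (λ j → 1 + p ^ suc j * v) (sym (+-identityʳ f)))
  lte^ f v (suc k) = proj₁ n₂ , c-trans (proj₁ (proj₂ n₂)) (proj₁ (proj₂ n₁)) ,
    trans (pow-p (1 + p ^ suc f * v) k)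
      (trans (cong (_^ p) (proj₂ (proj₂ n₁)))
        (trans (proj₂ (proj₂ n₂)) (cong (λ j → 1 + p ^ suc j * proj₁ n₂) (sym (+-suc f k)))))
    where
    n₁ = lte^ f v k
    n₂ = lte (f + k) (proj₁ n₁)
    pow-p : ∀ b k → b ^ (p ^ suc k) ≡ (b ^ (p ^ k)) ^ p
    pow-p b k = trans (cong (b ^_) (*-comm p (p ^ k))) (sym (^-*-assoc b (p ^ k) p))

  -- In `lte^` the cofactor stays congruent to v, hence prime to p, so the valuation of the power
  -- minus 1 is exactly f + 1 + k.
  lte-bound : ∀ f v k m → ¬ p ∣ v → Cong (p ^ m) ((1 + p ^ suc f * v) ^ (p ^ k)) 1 → m ≤ suc f + k
  lte-bound f v k m h c with lte^ f v k
  ... | v′ , c′ , e with m ≤? suc f + k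
  ...   | yes q = q
  ...   | no ¬q = ⊥-elim (c-∤ c′ h (*-cancelˡ-∣ (p ^ suc (f + k)) {{pow-nz (suc (f + k))}}
      (subst (_∣ p ^ suc (f + k) * v′) (*-comm p (p ^ suc (f + k)))
        (∣-trans (^-∣ p (≰⇒> ¬q)) (c⇒∣ (c-+-cancelˡ 1 (subst (λ j → Cong (p ^ m) j 1) e c)))))))

  neg-mod : ∀ x → ∃ λ y → p ∣ x + y
  neg-mod x with pos-suc p
  ... | k , refl = x * k , divides x (l x k)
    where
    l : ∀ x k → x + x * k ≡ x * suc k
    l = solve-∀

  -- Since p divides P, the square of P vanishes modulo pP. Taking powers is therefore linear, and
  -- the exponent w just multiplies v by w.
  dlog-base : ∀ P v w → p ∣ P → Cong p (v * w) 1 → Cong (p * P) ((1 + P * v) ^ w) (1 + P)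
  dlog-base P v w (divides g eg) c = c-trans (c-≡ (proj₂ ex))
    (c-trans (∣⇒c+ʳ _ (divides (g * v * v * proj₁ ex) (trans (cong (λ z → z * v * (P * v) * proj₁ ex) eg) (l₁ p P g v (proj₁ ex)))))
      (c-+ {x = 1} c-refl (subst₂ (λ M z → Cong M (w * (P * v)) z) (*-comm P p) (*-identityʳ P)
        (c-trans (c-≡ (l₂ w P v)) (c-scale P c)))))
    where
    ex = expand₁ (P * v) w
    l₁ : ∀ p P g v R → g * p * v * (P * v) * R ≡ g * v * v * R * (p * P)
    l₁ = solve-∀
    l₂ : ∀ w P v → w * (P * v) ≡ P * (v * w)
    l₂ = solve-∀

  -- A Hensel step. The error of A modulo pM is (t - s)M, and the factor (1 + Mv)^r contributes Mvr
  -- because A is 1 modulo p. So r has to solve vr = s - t modulo p, with `t⁻` standing for -t.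
  dlog-step : ∀ M P A v → p ∣ M → Cong p A 1 → ¬ p ∣ v → Cong M A (1 + P) →
    ∃ λ r → Cong (p * M) (A * (1 + M * v) ^ r) (1 + P)
  dlog-step M P A v (divides g eg) A≡1 v∤ (mkC s t e) = r ,
    c-+-cancelʳ (t * M) (c-trans (c-+ step (c-refl {x = t * M})) (c-trans step₂ (c-≡ e)))
    where
    w = proj₁ (inv-p v v∤)
    t⁻ = proj₁ (neg-mod t)
    r = w * (s + t⁻)
    R = proj₁ (expand₁ (M * v) r)
    vr : Cong p (v * r + t) s
    vr = c-trans (c-≡ (l v w s t⁻ t)) (c-trans (c-+ (c-*ʳ (s + t⁻) (proj₂ (inv-p v v∤))) (c-refl {x = t}))
      (c-trans (c-≡ (l′ s t⁻ t)) (∣⇒c+ʳ s (proj₂ (neg-mod t)))))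
      where
      l : ∀ v w s y t → v * (w * (s + y)) + t ≡ v * w * (s + y) + t
      l = solve-∀
      l′ : ∀ s y t → 1 * (s + y) + t ≡ s + (t + y)
      l′ = solve-∀
    l₁ : ∀ A r M v → A * (1 + r * (M * v)) ≡ A + M * (A * (v * r))
    l₁ = solve-∀
    l₂ : ∀ p M g v R → g * p * v * (M * v) * R ≡ g * v * v * R * (p * M)
    l₂ = solve-∀
    l₃ : ∀ A M z t → A + M * z + t * M ≡ A + M * (z + t)
    l₃ = solve-∀
    step : Cong (p * M) (A * (1 + M * v) ^ r) (A + M * (v * r))
    step = c-trans (c-*ˡ A (c-trans (c-≡ (proj₂ (expand₁ (M * v) r)))
        (∣⇒c+ʳ (1 + r * (M * v)) (divides (g * v * v * R) (trans (cong (λ z → z * v * (M * v) * R) eg) (l₂ p M g v R))))))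
      (c-trans (c-≡ (l₁ A r M v)) (c-+ (c-refl {x = A})
        (c-trans (subst (λ z → Cong z (M * (A * (v * r))) (M * (1 * (v * r)))) (*-comm M p) (c-scale M (c-*ʳ (v * r) A≡1)))
          (c-≡ (cong (M *_) (*-identityˡ _))))))
    step₂ : Cong (p * M) (A + M * (v * r) + t * M) (A + s * M)
    step₂ = c-trans (c-≡ (l₃ A M (v * r) t)) (c-+ (c-refl {x = A})
      (subst₂ (λ z₁ z₂ → Cong z₁ (M * (v * r + t)) z₂) (*-comm M p) (*-comm M s) (c-scale M vr)))

  DLog : ℕ → ℕ → ℕ → Set
  DLog f v i = ∃ λ k → ¬ p ∣ k × Cong (p ^ (i + suc f)) ((1 + p ^ suc f * v) ^ k) (1 + p ^ suc f)

  -- The correcting factor is available as b^(p^(i+1)), whose distance from 1 has exactly the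
  -- valuation of the current modulus. The exponent changes by a multiple of p and so remains prime
  -- to p; this would fail for the very first lift, which is why `dlog-base` treats it separately.
  dlog-next : ∀ f v → ¬ p ∣ v → ∀ i → DLog f v (suc i) → DLog f v (suc (suc i))
  dlog-next f v h i rec = k + p ^ suc i * proj₁ st ,
    c-∤ (∣⇒c+ʳ k (∣m⇒∣m*n (proj₁ st) (m∣m*n (p ^ i)))) (proj₁ (proj₂ rec)) ,
    subst (λ z → Cong (p ^ suc (suc i + suc f)) z (1 + p ^ suc f)) (sym eqn) (proj₂ st)
    where
    k = proj₁ rec
    b = 1 + p ^ suc f * v
    L = lte^ f v (suc i)
    v′ = proj₁ L
    b≡1 : Cong p (b ^ k) 1
    b≡1 = c-trans (c-^ k (∣⇒c+ʳ 1 (∣m⇒∣m*n v (m∣m*n (p ^ f))))) (c-≡ (^-zeroˡ k))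
    st : ∃ λ r → Cong (p * p ^ (suc i + suc f)) (b ^ k * (1 + p ^ (suc i + suc f) * v′) ^ r) (1 + p ^ suc f)
    st = dlog-step (p ^ (suc i + suc f)) (p ^ suc f) (b ^ k) v′ (m∣m*n (p ^ (i + suc f))) b≡1
           (c-∤ (proj₁ (proj₂ L)) h) (proj₂ (proj₂ rec))
    eqn : b ^ (k + p ^ suc i * proj₁ st) ≡ b ^ k * (1 + p ^ (suc i + suc f) * v′) ^ proj₁ st
    eqn = trans (^-distribˡ-+-* b k (p ^ suc i * proj₁ st)) (cong (b ^ k *_)
      (trans (sym (^-*-assoc b (p ^ suc i) (proj₁ st))) (cong (_^ proj₁ st)
        (trans (proj₂ (proj₂ L)) (cong (λ j → 1 + p ^ j * v′) (+-comm (suc f) (suc i)))))))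

  dlog : ∀ f v → ¬ p ∣ v → ∀ i → DLog f v i
  dlog f v h zero = 1 , p∤1 ,
      (c-trans (c-≡ (*-identityʳ _)) (c-trans (∣⇒c+ʳ 1 (m∣m*n v)) (c-sym (∣⇒c+ʳ 1 ∣-refl))))
  dlog f v h (suc zero) = proj₁ (inv-p v h) ,
    (λ d → p∤1 (c-∣ (c-sym (proj₂ (inv-p v h))) (∣n⇒∣m*n v d))) ,
    dlog-base (p ^ suc f) v (proj₁ (inv-p v h)) (m∣m*n (p ^ f)) (proj₂ (inv-p v h))
  dlog f v h (suc (suc i)) = dlog-next f v h i (dlog f v h (suc i))

  abstract
    -- The p-adic valuation truncated at M. Truncation gives 0 a place, and the recursion runs on M;
    -- exponents matter only modulo p^M in any case.
    val : ∀ M x → p ^ M ∣ x ⊎ ∃₂ λ k I → k < M × x ≡ p ^ k * I × ¬ p ∣ I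
    val zero    x = inj₁ (1∣ x)
    val (suc M) x with p ∣? x
    ... | no h = inj₂ (0 , x , s≤s z≤n , sym (*-identityˡ x) , h)
    ... | yes (divides q refl) with val M q
    ...   | inj₁ d = inj₁ (subst (p ^ suc M ∣_) (*-comm p q) (*-monoʳ-∣ p d))
    ...   | inj₂ (k , I , k<M , e , h) = inj₂ (suc k , I , s≤s k<M ,
              trans (*-comm q p) (trans (cong (p *_) e) (sym (*-assoc p (p ^ k) I))) , h)

  cancel-unit : ∀ M {x y} → ¬ p ∣ y → p ^ M ∣ x * y → p ^ M ∣ x
  cancel-unit M {x} {y} h d with inv-mod M y h
  ... | w , c = c⇒∣ (c-trans (c-sym (c-trans (c-≡ (*-assoc x y w)) (c-trans (c-*ˡ x c) (c-≡ (*-identityʳ x)))))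
        (∣⇒c (∣m⇒∣m*n w d)))

-- Powers in groups

-- Powers taken with respect to bare operations, so that they do not change when the equality of the
-- group is coarsened.
iterate : {A : Set} → (A → A → A) → A → A → ℕ → A
iterate _·_ e g zero    = e
iterate _·_ e g (suc k) = g · iterate _·_ e g k

module Powers (G : Group 0ℓ 0ℓ) where
  open Group G public using (Carrier; _≈_; _∙_; ε; _⁻¹; ∙-cong; ∙-congˡ; ∙-congʳ; assoc; identityˡ; identityʳ; inverseˡ; inverseʳ; setoid; monoid)
    renaming (refl to ≈-refl; sym to ≈-sym; trans to ≈-trans; reflexive to ≈-reflexive)
  open GroupProperties G public using (∙-cancelˡ; ∙-cancelʳ)
  module R = SetoidReasoning setoid

  infixr 8 _↑_
  _↑_ : Carrier → ℕ → Carrier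
  _↑_ = iterate _∙_ ε

  pow≡↑ : ∀ g k → pow G g k ≡ g ↑ k
  pow≡↑ g zero    = refl
  pow≡↑ g (suc k) = cong (g ∙_) (pow≡↑ g k)

  ↑-cong : ∀ {g h} k → g ≈ h → g ↑ k ≈ h ↑ k
  ↑-cong zero    e = ≈-refl
  ↑-cong (suc k) e = ∙-cong e (↑-cong k e)

  ↑-≡ : ∀ g {k l} → k ≡ l → g ↑ k ≈ g ↑ l
  ↑-≡ g refl = ≈-refl

  ↑-+ : ∀ g k l → g ↑ (k + l) ≈ g ↑ k ∙ g ↑ l
  ↑-+ g zero    l = ≈-sym (identityˡ _)
  ↑-+ g (suc k) l = ≈-trans (∙-congˡ (↑-+ g k l)) (≈-sym (assoc _ _ _))

  ↑-1 : ∀ g → g ↑ 1 ≈ g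
  ↑-1 g = identityʳ g

  ε↑ : ∀ k → ε ↑ k ≈ ε
  ε↑ zero    = ≈-refl
  ε↑ (suc k) = ≈-trans (identityˡ _) (ε↑ k)

  ↑-* : ∀ g k l → g ↑ (k * l) ≈ (g ↑ l) ↑ k
  ↑-* g zero    l = ≈-refl
  ↑-* g (suc k) l = ≈-trans (↑-+ g l (k * l)) (∙-congˡ (↑-* g k l))

  ↑-*′ : ∀ g k l → g ↑ (k * l) ≈ (g ↑ k) ↑ l
  ↑-*′ g k l = ≈-trans (↑-≡ g (*-comm k l)) (↑-* g l k)

  ↑-ε : ∀ {g} M k → g ↑ M ≈ ε → g ↑ (k * M) ≈ ε
  ↑-ε {g} M k e = ≈-trans (↑-* g k M) (≈-trans (↑-cong k e) (ε↑ k))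

  ↑-∣ : ∀ {g M k} → g ↑ M ≈ ε → M ∣ k → g ↑ k ≈ ε
  ↑-∣ e (divides q refl) = ↑-ε _ q e

  ↑-mod : ∀ {g M i j} → g ↑ M ≈ ε → Cong M i j → g ↑ i ≈ g ↑ j
  ↑-mod {g} {M} {i} {j} e (mkC s t eq) = begin
    g ↑ i                ≈⟨ identityʳ _ ⟨
    g ↑ i ∙ ε            ≈⟨ ∙-congˡ (↑-ε M s e) ⟨
    g ↑ i ∙ g ↑ (s * M)  ≈⟨ ↑-+ g i _ ⟨
    g ↑ (i + s * M)      ≈⟨ ↑-≡ g eq ⟩
    g ↑ (j + t * M)      ≈⟨ ↑-+ g j _ ⟩
    g ↑ j ∙ g ↑ (t * M)  ≈⟨ ∙-congˡ (↑-ε M t e) ⟩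
    g ↑ j ∙ ε            ≈⟨ identityʳ _ ⟩
    g ↑ j                ∎
    where open R

  -- With natural exponents, `k * pred M` plays the part of -k for an element killed by M. This
  -- convention is used everywhere below.
  ↑-inv : ∀ {g M} k → .{{NonZero M}} → g ↑ M ≈ ε → g ↑ k ∙ g ↑ (k * pred M) ≈ ε
  ↑-inv {g} {M} k e = ≈-trans (≈-sym (↑-+ g k _)) (≈-trans
    (↑-≡ g (trans (sym (*-suc k (pred M))) (cong (k *_) (suc-pred M)))) (↑-ε M k e))

  ↑-inv′ : ∀ {g M} k → .{{NonZero M}} → g ↑ M ≈ ε → g ↑ (k * pred M) ∙ g ↑ k ≈ ε
  ↑-inv′ {g} {M} k e = ≈-trans (≈-sym (↑-+ g (k * pred M) k)) (≈-trans (↑-≡ g (+-comm (k * pred M) k))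
    (≈-trans (↑-+ g k _) (↑-inv k e)))

  comm-↑ : ∀ {g h} k → g ∙ h ≈ h ∙ g → g ↑ k ∙ h ≈ h ∙ g ↑ k
  comm-↑ zero    e = ≈-trans (identityˡ _) (≈-sym (identityʳ _))
  comm-↑ {g} {h} (suc k) e = begin
    (g ∙ g ↑ k) ∙ h  ≈⟨ assoc _ _ _ ⟩
    g ∙ (g ↑ k ∙ h)  ≈⟨ ∙-congˡ (comm-↑ k e) ⟩
    g ∙ (h ∙ g ↑ k)  ≈⟨ assoc _ _ _ ⟨
    (g ∙ h) ∙ g ↑ k  ≈⟨ ∙-congʳ e ⟩
    (h ∙ g) ∙ g ↑ k  ≈⟨ assoc _ _ _ ⟩
    h ∙ (g ∙ g ↑ k)  ∎
    where open R

  comm-↑↑ : ∀ {g h} k l → g ∙ h ≈ h ∙ g → g ↑ k ∙ h ↑ l ≈ h ↑ l ∙ g ↑ k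
  comm-↑↑ k l e = ≈-sym (comm-↑ l (≈-sym (comm-↑ k e)))

  ↑-comm : ∀ g k l → g ↑ k ∙ g ↑ l ≈ g ↑ l ∙ g ↑ k
  ↑-comm g k l = comm-↑↑ k l ≈-refl

  comm-∙ : ∀ {x y z} → x ∙ z ≈ z ∙ x → y ∙ z ≈ z ∙ y → (x ∙ y) ∙ z ≈ z ∙ (x ∙ y)
  comm-∙ {x} {y} {z} e f = begin
    (x ∙ y) ∙ z  ≈⟨ assoc _ _ _ ⟩
    x ∙ (y ∙ z)  ≈⟨ ∙-congˡ f ⟩
    x ∙ (z ∙ y)  ≈⟨ assoc _ _ _ ⟨
    (x ∙ z) ∙ y  ≈⟨ ∙-congʳ e ⟩
    (z ∙ x) ∙ y  ≈⟨ assoc _ _ _ ⟩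
    z ∙ (x ∙ y)  ∎
    where open R

  comm-dist : ∀ {g h} k → g ∙ h ≈ h ∙ g → (g ∙ h) ↑ k ≈ g ↑ k ∙ h ↑ k
  comm-dist zero    e = ≈-sym (identityˡ _)
  comm-dist {g} {h} (suc k) e = begin
    (g ∙ h) ∙ (g ∙ h) ↑ k      ≈⟨ ∙-congˡ (comm-dist k e) ⟩
    (g ∙ h) ∙ (g ↑ k ∙ h ↑ k)  ≈⟨ assoc _ _ _ ⟩
    g ∙ (h ∙ (g ↑ k ∙ h ↑ k))  ≈⟨ ∙-congˡ (assoc _ _ _) ⟨
    g ∙ ((h ∙ g ↑ k) ∙ h ↑ k)  ≈⟨ ∙-congˡ (∙-congʳ (comm-↑ k e)) ⟨
    g ∙ ((g ↑ k ∙ h) ∙ h ↑ k)  ≈⟨ ∙-congˡ (assoc _ _ _) ⟩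
    g ∙ (g ↑ k ∙ (h ∙ h ↑ k))  ≈⟨ assoc _ _ _ ⟨
    (g ∙ g ↑ k) ∙ (h ∙ h ↑ k)  ∎
    where open R

  conj-↑ : ∀ {x y y′} k → y ∙ x ≈ x ∙ y′ → y ↑ k ∙ x ≈ x ∙ y′ ↑ k
  conj-↑ zero e = ≈-trans (identityˡ _) (≈-sym (identityʳ _))
  conj-↑ {x} {y} {y′} (suc k) e = begin
    (y ∙ y ↑ k) ∙ x    ≈⟨ assoc _ _ _ ⟩
    y ∙ (y ↑ k ∙ x)    ≈⟨ ∙-congˡ (conj-↑ k e) ⟩
    y ∙ (x ∙ y′ ↑ k)   ≈⟨ assoc _ _ _ ⟨
    (y ∙ x) ∙ y′ ↑ k   ≈⟨ ∙-congʳ e ⟩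
    (x ∙ y′) ∙ y′ ↑ k  ≈⟨ assoc _ _ _ ⟩
    x ∙ (y′ ∙ y′ ↑ k)  ∎
    where open R

  skew : ∀ {c g v} i → c ∙ g ≈ g ∙ c ↑ v → c ↑ i ∙ g ≈ g ∙ c ↑ (i * v)
  skew {c} {g} {v} i e = ≈-trans (conj-↑ i e) (∙-congˡ (≈-sym (↑-* c i v)))

  skew² : ∀ {c g v} i j → c ∙ g ≈ g ∙ c ↑ v → c ↑ i ∙ g ↑ j ≈ g ↑ j ∙ c ↑ (i * v ^ j)
  skew² {c} {g} {v} i zero e = ≈-trans (identityʳ _) (≈-sym (≈-trans (identityˡ _) (↑-≡ c (*-identityʳ i))))
  skew² {c} {g} {v} i (suc j) e = begin
    c ↑ i ∙ (g ∙ g ↑ j)                ≈⟨ assoc _ _ _ ⟨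
    (c ↑ i ∙ g) ∙ g ↑ j                ≈⟨ ∙-congʳ (skew i e) ⟩
    (g ∙ c ↑ (i * v)) ∙ g ↑ j          ≈⟨ assoc _ _ _ ⟩
    g ∙ (c ↑ (i * v) ∙ g ↑ j)          ≈⟨ ∙-congˡ (skew² (i * v) j e) ⟩
    g ∙ (g ↑ j ∙ c ↑ (i * v * v ^ j))  ≈⟨ assoc _ _ _ ⟨
    (g ∙ g ↑ j) ∙ c ↑ (i * v * v ^ j)  ≈⟨ ∙-congˡ (↑-≡ c (*-assoc i v _)) ⟩
    (g ∙ g ↑ j) ∙ c ↑ (i * v ^ suc j)  ∎
    where open R

  skew¹ : ∀ {c g v} j → c ∙ g ≈ g ∙ c ↑ v → c ∙ g ↑ j ≈ g ↑ j ∙ c ↑ (v ^ j)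
  skew¹ {c} {g} {v} j e = ≈-trans (∙-congʳ (≈-sym (↑-1 c))) (≈-trans (skew² {v = v} 1 j e)
    (∙-congˡ (↑-≡ c (*-identityˡ (v ^ j)))))

  -- The tail q^(kt) is itself c^(kpst) and can be moved to the other side. The exponent of c that
  -- results is k times something congruent to 1 modulo p, so no information on valuations is lost.
  absorb-tail : ∀ {c q A D} p N s t k → .{{NonZero N}} → c ↑ N ≈ ε → q ≈ c ↑ (p * s) →
    c ↑ k ≈ A ∙ (D ∙ q ↑ (k * t)) → c ↑ (k * (1 + p * (s * t * pred N))) ≈ A ∙ D
  absorb-tail {c} {q} {A} {D} p N s t k ord q≈ e = begin
    c ↑ (k * (1 + p * (s * t * pred N)))     ≈⟨ ↑-≡ c (ring k p s t (pred N)) ⟩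
    c ↑ (k + E * pred N)                     ≈⟨ ↑-+ c k (E * pred N) ⟩
    c ↑ k ∙ c ↑ (E * pred N)                 ≈⟨ ∙-congʳ e ⟩
    (A ∙ (D ∙ q ↑ (k * t))) ∙ c ↑ (E * pred N)  ≈⟨ ∙-congʳ (∙-congˡ (∙-congˡ qE)) ⟩
    (A ∙ (D ∙ c ↑ E)) ∙ c ↑ (E * pred N)     ≈⟨ msolve monoid ⟩
    (A ∙ D) ∙ (c ↑ E ∙ c ↑ (E * pred N))     ≈⟨ ∙-congˡ (↑-inv E ord) ⟩
    (A ∙ D) ∙ ε                              ≈⟨ identityʳ _ ⟩
    A ∙ D                                    ∎
    where
    open R
    E = k * (p * s * t)
    ring : ∀ k p s t N → k * (1 + p * (s * t * N)) ≡ k + k * (p * s * t) * N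
    ring = solve-∀
    ring₂ : ∀ k p s t → p * s * (k * t) ≡ k * (p * s * t)
    ring₂ = solve-∀
    qE : q ↑ (k * t) ≈ c ↑ E
    qE = ≈-trans (↑-cong (k * t) q≈) (≈-trans (≈-sym (↑-*′ c (p * s) (k * t))) (↑-≡ c (ring₂ k p s t)))

-- Powers of products when commutators lie in a cyclic group

module Commutators (p : ℕ) (pr : Prime p) (2<p : 2 < p) (G : Group 0ℓ 0ℓ) where
  open Arith p pr 2<p
  open Powers G

  -- A hypothesis on one pair rather than on the whole group: it passes from g, h, ζ to their p-th
  -- powers, whereas commutators of arbitrary elements need not lie in ⟨ζ^p⟩.
  record Loc (g h ζ : Carrier) : Set where
    constructor mkLoc
    field
      lc lr ls : ℕ
      swap : h ∙ g ≈ g ∙ (h ∙ ζ ↑ lc)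
      normˡ : ζ ∙ g ≈ g ∙ ζ ↑ (1 + p * lr)
      normʳ : ζ ∙ h ≈ h ∙ ζ ↑ (1 + p * ls)

  unit^ : ∀ r n → ∃ λ t → (1 + p * r) ^ n ≡ 1 + p * t
  unit^ r n = cong-1 (c-trans (c-^ n (∣⇒c+ʳ 1 (m∣m*n r))) (c-≡ (^-zeroˡ n)))

  -- Exponents of ζ matter only modulo p, so they are kept in the form c n + p t.
  swapⁿ : ∀ {g h ζ} (l : Loc g h ζ) n → ∃ λ t → h ∙ g ↑ n ≈ g ↑ n ∙ (h ∙ ζ ↑ (Loc.lc l * n + p * t))
  swapⁿ {g} {h} {ζ} (mkLoc c r s sw nl nr) zero = 0 , (begin
    h ∙ ε                          ≈⟨ identityʳ h ⟩
    h                              ≈⟨ identityʳ h ⟨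
    h ∙ ζ ↑ 0                      ≈⟨ ∙-congˡ (↑-≡ ζ {0} {c * 0 + p * 0} (sym (cong₂ _+_ (*-zeroʳ c) (*-zeroʳ p)))) ⟩
    h ∙ ζ ↑ (c * 0 + p * 0)        ≈⟨ identityˡ _ ⟨
    ε ∙ (h ∙ ζ ↑ (c * 0 + p * 0))  ∎)
    where open R
  swapⁿ {g} {h} {ζ} l@(mkLoc c r s sw nl nr) (suc n) with swapⁿ l n
  ... | t , e = t + c * r′ , (begin
    h ∙ (g ∙ g ↑ n)                                          ≈⟨ assoc _ _ _ ⟨
    (h ∙ g) ∙ g ↑ n                                          ≈⟨ ∙-congʳ sw ⟩
    (g ∙ (h ∙ ζ ↑ c)) ∙ g ↑ n                                ≈⟨ msolve monoid ⟩
    g ∙ (h ∙ (ζ ↑ c ∙ g ↑ n))                                ≈⟨ ∙-congˡ (∙-congˡ (skew² {v = 1 + p * r} c n nl)) ⟩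
    g ∙ (h ∙ (g ↑ n ∙ ζ ↑ k))                                ≈⟨ msolve monoid ⟩
    g ∙ ((h ∙ g ↑ n) ∙ ζ ↑ k)                                ≈⟨ ∙-congˡ (∙-congʳ e) ⟩
    g ∙ ((g ↑ n ∙ (h ∙ ζ ↑ (c * n + p * t))) ∙ ζ ↑ k)        ≈⟨ msolve monoid ⟩
    (g ∙ g ↑ n) ∙ (h ∙ (ζ ↑ (c * n + p * t) ∙ ζ ↑ k))        ≈⟨ ∙-congˡ (∙-congˡ (↑-+ ζ (c * n + p * t) k)) ⟨
    (g ∙ g ↑ n) ∙ (h ∙ ζ ↑ (c * n + p * t + k))              ≈⟨ ∙-congˡ (∙-congˡ (↑-≡ ζ (trans (cong (λ z → c * n + p * t + c * z) (proj₂ (unit^ r n))) (ring c n p t r′)))) ⟩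
    (g ∙ g ↑ n) ∙ (h ∙ ζ ↑ (c * suc n + p * (t + c * r′)))   ∎)
    where
    open R
    r′ = proj₁ (unit^ r n)
    k = c * (1 + p * r) ^ n
    ring : ∀ c n p t r → c * n + p * t + c * (1 + p * r) ≡ c * suc n + p * (t + c * r)
    ring = solve-∀

  swapʳ : ∀ {g h ζ} → Loc g h ζ → ∀ n → ∃ λ k → h ↑ n ∙ g ≈ g ∙ (h ↑ n ∙ ζ ↑ k)
  swapʳ {g} {h} {ζ} (mkLoc c r s sw nl nr) zero = 0 , msolve monoid
  swapʳ {g} {h} {ζ} l@(mkLoc c r s sw nl nr) (suc n) with swapʳ l n
  ... | t , e = k + t , (begin
    (h ∙ h ↑ n) ∙ g                       ≈⟨ assoc _ _ _ ⟩
    h ∙ (h ↑ n ∙ g)                       ≈⟨ ∙-congˡ e ⟩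
    h ∙ (g ∙ (h ↑ n ∙ ζ ↑ t))             ≈⟨ assoc _ _ _ ⟨
    (h ∙ g) ∙ (h ↑ n ∙ ζ ↑ t)             ≈⟨ ∙-congʳ sw ⟩
    (g ∙ (h ∙ ζ ↑ c)) ∙ (h ↑ n ∙ ζ ↑ t)   ≈⟨ msolve monoid ⟩
    g ∙ (h ∙ ((ζ ↑ c ∙ h ↑ n) ∙ ζ ↑ t))   ≈⟨ ∙-congˡ (∙-congˡ (∙-congʳ (skew² {v = 1 + p * s} c n nr))) ⟩
    g ∙ (h ∙ ((h ↑ n ∙ ζ ↑ k) ∙ ζ ↑ t))   ≈⟨ msolve monoid ⟩
    g ∙ ((h ∙ h ↑ n) ∙ (ζ ↑ k ∙ ζ ↑ t))   ≈⟨ ∙-congˡ (∙-congˡ (↑-+ ζ k t)) ⟨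
    g ∙ ((h ∙ h ↑ n) ∙ ζ ↑ (k + t))       ∎)
    where
    open R
    k = c * (1 + p * s) ^ n

  prodⁿ : ∀ {g h ζ} (l : Loc g h ζ) n → ∃ λ t → (g ∙ h) ↑ n ≈ g ↑ n ∙ (h ↑ n ∙ ζ ↑ (Loc.lc l * tri n + p * t))
  prodⁿ {g} {h} {ζ} (mkLoc c r s sw nl nr) zero = 0 , (begin
    ε                              ≈⟨ msolve monoid ⟩
    ε ∙ (ε ∙ ε)                    ≈⟨ ∙-congˡ (∙-congˡ (↑-≡ ζ {0} {c * 0 + p * 0} (sym (cong₂ _+_ (*-zeroʳ c) (*-zeroʳ p))))) ⟩
    ε ∙ (ε ∙ ζ ↑ (c * 0 + p * 0))  ∎)
    where open R
  prodⁿ {g} {h} {ζ} l@(mkLoc c r s sw nl nr) (suc n) with prodⁿ l n | swapⁿ l n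
  ... | t , e | t₁ , e₁ = t₁ + (c * n + p * t₁) * s′ + t , (begin
    (g ∙ h) ∙ (g ∙ h) ↑ n                                ≈⟨ ∙-congˡ e ⟩
    (g ∙ h) ∙ (g ↑ n ∙ (h ↑ n ∙ ζ ↑ E))                  ≈⟨ msolve monoid ⟩
    g ∙ ((h ∙ g ↑ n) ∙ (h ↑ n ∙ ζ ↑ E))                  ≈⟨ ∙-congˡ (∙-congʳ e₁) ⟩
    g ∙ ((g ↑ n ∙ (h ∙ ζ ↑ k)) ∙ (h ↑ n ∙ ζ ↑ E))        ≈⟨ msolve monoid ⟩
    (g ∙ g ↑ n) ∙ (h ∙ ((ζ ↑ k ∙ h ↑ n) ∙ ζ ↑ E))        ≈⟨ ∙-congˡ (∙-congˡ (∙-congʳ (skew² {v = 1 + p * s} k n nr))) ⟩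
    (g ∙ g ↑ n) ∙ (h ∙ ((h ↑ n ∙ ζ ↑ k′) ∙ ζ ↑ E))       ≈⟨ msolve monoid ⟩
    (g ∙ g ↑ n) ∙ ((h ∙ h ↑ n) ∙ (ζ ↑ k′ ∙ ζ ↑ E))       ≈⟨ ∙-congˡ (∙-congˡ (↑-+ ζ k′ E)) ⟨
    (g ∙ g ↑ n) ∙ ((h ∙ h ↑ n) ∙ ζ ↑ (k′ + E))           ≈⟨ ∙-congˡ (∙-congˡ (↑-≡ ζ (trans (cong (λ z → k * z + E) (proj₂ (unit^ s n))) (ring c n p t₁ s′ (tri n) t)))) ⟩
    (g ∙ g ↑ n) ∙ ((h ∙ h ↑ n) ∙ ζ ↑ (c * tri (suc n) + p * (t₁ + (c * n + p * t₁) * s′ + t))) ∎)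
    where
    open R
    s′ = proj₁ (unit^ s n)
    E = c * tri n + p * t
    k = c * n + p * t₁
    k′ = k * (1 + p * s) ^ n
    ring : ∀ c n p t s T t′ → (c * n + p * t) * (1 + p * s) + (c * T + p * t′) ≡ c * (n + T) + p * (t + (c * n + p * t) * s + t′)
    ring = solve-∀

  normⁿ : ∀ {g ζ} r n → ζ ∙ g ≈ g ∙ ζ ↑ (1 + p * r) → ∃ λ r′ → ζ ↑ p ∙ g ↑ n ≈ g ↑ n ∙ (ζ ↑ p) ↑ (1 + p * r′)
  normⁿ {g} {ζ} r n e = proj₁ (unit^ r n) , ≈-trans (skew² {v = 1 + p * r} p n e)
    (∙-congˡ (≈-trans (↑-*′ ζ p ((1 + p * r) ^ n)) (↑-≡ (ζ ↑ p) (proj₂ (unit^ r n)))))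

  -- Moving h past g^p produces the exponent cp + pt, a multiple of p, so the commutator of g^p and
  -- h already lies in ⟨ζ^p⟩. Raising h to the p-th power afterwards keeps it there.
  Loc-↑p : ∀ {g h ζ} → Loc g h ζ → Loc (g ↑ p) (h ↑ p) (ζ ↑ p)
  Loc-↑p {g} {h} {ζ} l@(mkLoc c r s sw nl nr) = mkLoc (proj₁ sw′) (proj₁ (normⁿ r p nl)) (proj₁ (normⁿ s p nr))
    (proj₂ sw′) (proj₂ (normⁿ r p nl)) (proj₂ (normⁿ s p nr))
    where
    t = proj₁ (swapⁿ l p)
    nr₁ : ∃ λ s′ → ζ ↑ p ∙ h ≈ h ∙ (ζ ↑ p) ↑ (1 + p * s′)
    nr₁ = proj₁ (normⁿ s 1 nr) , ≈-trans (∙-congˡ (≈-sym (↑-1 h))) (≈-trans (proj₂ (normⁿ s 1 nr)) (∙-congʳ (↑-1 h)))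
    half : Loc (g ↑ p) h (ζ ↑ p)
    half = mkLoc (c + t) (proj₁ (normⁿ r p nl)) (proj₁ nr₁)
      (≈-trans (proj₂ (swapⁿ l p)) (∙-congˡ (∙-congˡ (≈-trans (↑-≡ ζ (ring c p t)) (↑-*′ ζ p (c + t))))))
      (proj₂ (normⁿ r p nl)) (proj₂ nr₁)
      where
      ring : ∀ c p t → c * p + p * t ≡ p * (c + t)
      ring = solve-∀
    sw′ = swapʳ half p

  module _ {ζ : Carrier} (M : ℕ) {{_ : NonZero M}} (ord : ζ ↑ M ≈ ε) where

    -- The first pair hides the tail ζ^k, left by one step of the power formula, inside h; the
    -- second pair allows it to be separated again after the remaining powers have been taken.
    Loc-absorb : ∀ {g h} k → Loc g h ζ → Loc g (h ∙ ζ ↑ k) ζ × Loc h (ζ ↑ k) ζ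
    Loc-absorb {g} {h} k (mkLoc c r s sw nl nr) =
      mkLoc (k * pred M + (c + k * (1 + p * r))) r s
        (begin
          (h ∙ ζ ↑ k) ∙ g                                   ≈⟨ assoc _ _ _ ⟩
          h ∙ (ζ ↑ k ∙ g)                                   ≈⟨ ∙-congˡ (skew {v = 1 + p * r} k nl) ⟩
          h ∙ (g ∙ ζ ↑ e)                                   ≈⟨ assoc _ _ _ ⟨
          (h ∙ g) ∙ ζ ↑ e                                   ≈⟨ ∙-congʳ sw ⟩
          (g ∙ (h ∙ ζ ↑ c)) ∙ ζ ↑ e                         ≈⟨ msolve monoid ⟩
          g ∙ (h ∙ (ε ∙ (ζ ↑ c ∙ ζ ↑ e)))                   ≈⟨ ∙-congˡ (∙-congˡ (∙-cong (≈-sym (↑-inv k ord)) (≈-sym (↑-+ ζ c e)))) ⟩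
          g ∙ (h ∙ ((ζ ↑ k ∙ ζ ↑ (k * pred M)) ∙ ζ ↑ (c + e)))  ≈⟨ msolve monoid ⟩
          g ∙ ((h ∙ ζ ↑ k) ∙ (ζ ↑ (k * pred M) ∙ ζ ↑ (c + e)))  ≈⟨ ∙-congˡ (∙-congˡ (↑-+ ζ (k * pred M) (c + e))) ⟨
          g ∙ ((h ∙ ζ ↑ k) ∙ ζ ↑ (k * pred M + (c + e)))    ∎)
        nl
        (begin
          ζ ∙ (h ∙ ζ ↑ k)                  ≈⟨ assoc _ _ _ ⟨
          (ζ ∙ h) ∙ ζ ↑ k                  ≈⟨ ∙-congʳ nr ⟩
          (h ∙ ζ ↑ (1 + p * s)) ∙ ζ ↑ k    ≈⟨ assoc _ _ _ ⟩
          h ∙ (ζ ↑ (1 + p * s) ∙ ζ ↑ k)    ≈⟨ ∙-congˡ (↑-comm ζ (1 + p * s) k) ⟩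
          h ∙ (ζ ↑ k ∙ ζ ↑ (1 + p * s))    ≈⟨ assoc _ _ _ ⟨
          (h ∙ ζ ↑ k) ∙ ζ ↑ (1 + p * s)    ∎) ,
      mkLoc (k * (p * s)) s 0
        (begin
          ζ ↑ k ∙ h                        ≈⟨ skew {v = 1 + p * s} k nr ⟩
          h ∙ ζ ↑ (k * (1 + p * s))        ≈⟨ ∙-congˡ (↑-≡ ζ (trans (*-distribˡ-+ k 1 (p * s)) (cong (_+ k * (p * s)) (*-identityʳ k)))) ⟩
          h ∙ ζ ↑ (k + k * (p * s))        ≈⟨ ∙-congˡ (↑-+ ζ k (k * (p * s))) ⟩
          h ∙ (ζ ↑ k ∙ ζ ↑ (k * (p * s)))  ∎)
        nr
        (≈-trans (≈-sym (comm-↑ k ≈-refl)) (∙-congˡ (≈-trans (≈-sym (↑-1 ζ)) (↑-≡ ζ (cong suc (sym (*-zeroʳ p)))))))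
      where
      open R
      e = k * (1 + p * r)

  -- One step is (gh)ᵖ = gᵖ hᵖ ζ^(c p(p−1)/2 + pt), where p divides p(p−1)/2 because p is odd, so that the
  -- induction continues with gᵖ, hᵖζ^(pt) and ζᵖ.
  prod-p^′ : ∀ {g h ζ} M → {{NonZero M}} → ζ ↑ M ≈ ε → Loc g h ζ → ∀ k →
    ∃ λ t → (g ∙ h) ↑ (p ^ k) ≈ g ↑ (p ^ k) ∙ (h ↑ (p ^ k) ∙ ζ ↑ (p ^ k * t))
  prod-p^′ {g} {h} {ζ} M ord l zero = 0 , (begin
    (g ∙ h) ↑ 1                    ≈⟨ msolve monoid ⟩
    g ↑ 1 ∙ (h ↑ 1 ∙ ζ ↑ (1 * 0))  ∎)
    where open R
  prod-p^′ {g} {h} {ζ} M ord l (suc k) = t₁ + t₂ , (begin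
    (g ∙ h) ↑ (p * q)                        ≈⟨ ↑-*′ (g ∙ h) p q ⟩
    ((g ∙ h) ↑ p) ↑ q                        ≈⟨ ↑-cong q step ⟩
    (X ∙ (Y ∙ Z ↑ t)) ↑ q                    ≈⟨ proj₂ ih₁ ⟩
    X ↑ q ∙ ((Y ∙ Z ↑ t) ↑ q ∙ Z ↑ (q * t₁)) ≈⟨ ∙-congˡ (∙-congʳ (proj₂ ih₂)) ⟩
    X ↑ q ∙ ((Y ↑ q ∙ ((Z ↑ t) ↑ q ∙ Z ↑ (q * t₂′))) ∙ Z ↑ (q * t₁))
      ≈⟨ ∙-congˡ (∙-congʳ (∙-congˡ (≈-trans (∙-congʳ (≈-sym (↑-*′′ Z t q))) (≈-sym (↑-+ Z (q * t) (q * t₂′)))))) ⟩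
    X ↑ q ∙ ((Y ↑ q ∙ Z ↑ (q * t + q * t₂′)) ∙ Z ↑ (q * t₁))  ≈⟨ ∙-congˡ (assoc _ _ _) ⟩
    X ↑ q ∙ (Y ↑ q ∙ (Z ↑ (q * t + q * t₂′) ∙ Z ↑ (q * t₁)))  ≈⟨ ∙-congˡ (∙-congˡ (↑-+ Z (q * t + q * t₂′) (q * t₁))) ⟨
    X ↑ q ∙ (Y ↑ q ∙ Z ↑ (q * t + q * t₂′ + q * t₁))  ≈⟨ ∙-cong (≈-sym (↑-*′ g p q)) (∙-cong (≈-sym (↑-*′ h p q)) (≈-trans (≈-sym (↑-*′ ζ p (q * t + q * t₂′ + q * t₁))) (↑-≡ ζ (ring p q t t₂′ t₁)))) ⟩
    g ↑ (p * q) ∙ (h ↑ (p * q) ∙ ζ ↑ (p * q * (t₁ + t₂)))  ∎)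
    where
    open R
    q = p ^ k
    X = g ↑ p
    Y = h ↑ p
    Z = ζ ↑ p
    pn = prodⁿ l p
    t = Loc.lc l * _∣_.quotient p∣tri + proj₁ pn
    ↑-*′′ : ∀ z t q → z ↑ (q * t) ≈ (z ↑ t) ↑ q
    ↑-*′′ z t q = ↑-* z q t
    step : (g ∙ h) ↑ p ≈ X ∙ (Y ∙ Z ↑ t)
    step = ≈-trans (proj₂ pn) (∙-congˡ (∙-congˡ (≈-trans (↑-≡ ζ
      (trans (cong (λ z → Loc.lc l * z + p * proj₁ pn) (m∣n⇒n≡quotient*m p∣tri)) (ring₁ (Loc.lc l) (_∣_.quotient p∣tri) p (proj₁ pn))))
      (↑-*′ ζ p t))))
      where
      ring₁ : ∀ c a p b → c * (a * p) + p * b ≡ p * (c * a + b)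
      ring₁ = solve-∀
    ordZ : Z ↑ M ≈ ε
    ordZ = ≈-trans (≈-sym (↑-*′ ζ p M)) (↑-ε M p ord)
    ab = Loc-absorb M ordZ t (Loc-↑p l)
    ih₁ = prod-p^′ M ordZ (proj₁ ab) k
    ih₂ = prod-p^′ M ordZ (proj₂ ab) k
    t₁ = proj₁ ih₁
    t₂′ = proj₁ ih₂
    t₂ = t + t₂′
    ring : ∀ p q t t₂ t₁ → p * (q * t + q * t₂ + q * t₁) ≡ p * q * (t₁ + (t + t₂))
    ring = solve-∀

  abstract
    prod-p^ : ∀ {g h ζ} M → {{NonZero M}} → ζ ↑ M ≈ ε → Loc g h ζ → ∀ k →
      ∃ λ t → (g ∙ h) ↑ (p ^ k) ≈ g ↑ (p ^ k) ∙ (h ↑ (p ^ k) ∙ ζ ↑ (p ^ k * t))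
    prod-p^ = prod-p^′

  record CyclicDerived (q : Carrier) : Set where
    field
      comm : ∀ g h → ∃ λ k → h ∙ g ≈ g ∙ (h ∙ q ↑ k)
      norm : ∀ g → ∃ λ w → q ∙ g ≈ g ∙ q ↑ (1 + p * w)

    loc : ∀ g h → Loc g h q
    loc g h = mkLoc (proj₁ (comm g h)) (proj₁ (norm g)) (proj₁ (norm h)) (proj₂ (comm g h)) (proj₂ (norm g)) (proj₂ (norm h))

-- Exact products of two cyclic p-groups

module _ (G : Group 0ℓ 0ℓ) where
  open Powers G

  module Quotient (z : Carrier) (M : ℕ) {{_ : NonZero M}} (ord : z ↑ M ≈ ε)
      (central : ∀ g → z ∙ g ≈ g ∙ z) where

    _≈z_ : Carrier → Carrier → Set
    g ≈z h = ∃ λ k → g ≈ h ∙ z ↑ k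

    ≈⇒≈z : ∀ {g h} → g ≈ h → g ≈z h
    ≈⇒≈z e = 0 , ≈-trans e (≈-sym (identityʳ _))

    z^-central : ∀ k g → z ↑ k ∙ g ≈ g ∙ z ↑ k
    z^-central k g = comm-↑ k (central g)

    symz : ∀ {g h} → g ≈z h → h ≈z g
    symz {g} {h} (k , e) = k * pred M , (begin
      h                                   ≈⟨ identityʳ h ⟨
      h ∙ ε                               ≈⟨ ∙-congˡ (↑-inv k ord) ⟨
      h ∙ (z ↑ k ∙ z ↑ (k * pred M))      ≈⟨ assoc _ _ _ ⟨
      (h ∙ z ↑ k) ∙ z ↑ (k * pred M)      ≈⟨ ∙-congʳ e ⟨
      g ∙ z ↑ (k * pred M)                ∎)
      where open R

    transz : ∀ {g h k} → g ≈z h → h ≈z k → g ≈z k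
    transz {g} {h} {k} (i , e) (j , f) = j + i , (begin
      g                      ≈⟨ e ⟩
      h ∙ z ↑ i              ≈⟨ ∙-congʳ f ⟩
      (k ∙ z ↑ j) ∙ z ↑ i    ≈⟨ assoc _ _ _ ⟩
      k ∙ (z ↑ j ∙ z ↑ i)    ≈⟨ ∙-congˡ (↑-+ z j i) ⟨
      k ∙ z ↑ (j + i)        ∎)
      where open R

    congz : ∀ {g g′ h h′} → g ≈z g′ → h ≈z h′ → (g ∙ h) ≈z (g′ ∙ h′)
    congz {g} {g′} {h} {h′} (i , e) (j , f) = i + j , (begin
      g ∙ h                            ≈⟨ ∙-cong e f ⟩
      (g′ ∙ z ↑ i) ∙ (h′ ∙ z ↑ j)      ≈⟨ msolve monoid ⟩
      g′ ∙ ((z ↑ i ∙ h′) ∙ z ↑ j)      ≈⟨ ∙-congˡ (∙-congʳ (z^-central i h′)) ⟩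
      g′ ∙ ((h′ ∙ z ↑ i) ∙ z ↑ j)      ≈⟨ msolve monoid ⟩
      (g′ ∙ h′) ∙ (z ↑ i ∙ z ↑ j)      ≈⟨ ∙-congˡ (↑-+ z i j) ⟨
      (g′ ∙ h′) ∙ z ↑ (i + j)          ∎)
      where open R

    invz : ∀ {g h} → g ≈z h → (g ⁻¹) ≈z (h ⁻¹)
    invz {g} {h} (k , e) = k * pred M , ≈-sym (inverseˡ-unique (h ⁻¹ ∙ z ↑ (k * pred M)) g (begin
      (h ⁻¹ ∙ z ↑ (k * pred M)) ∙ g             ≈⟨ ∙-congˡ (≈-trans e (≈-sym (z^-central k h))) ⟩
      (h ⁻¹ ∙ z ↑ (k * pred M)) ∙ (z ↑ k ∙ h)   ≈⟨ msolve monoid ⟩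
      h ⁻¹ ∙ ((z ↑ (k * pred M) ∙ z ↑ k) ∙ h)   ≈⟨ ∙-congˡ (∙-congʳ (↑-inv′ k ord)) ⟩
      h ⁻¹ ∙ (ε ∙ h)                            ≈⟨ ∙-congˡ (identityˡ h) ⟩
      h ⁻¹ ∙ h                                  ≈⟨ inverseˡ h ⟩
      ε                                         ∎))
      where
      open R
      open GroupProperties G using (inverseˡ-unique)

    group : Group 0ℓ 0ℓ
    group = record
      { Carrier = Carrier ; _≈_ = _≈z_ ; _∙_ = _∙_ ; ε = ε ; _⁻¹ = _⁻¹
      ; isGroup = record
        { isMonoid = record
          { isSemigroup = record
            { isMagma = record
              { isEquivalence = record { refl = ≈⇒≈z ≈-refl ; sym = symz ; trans = transz }
              ; ∙-cong = congz }
            ; assoc = λ g h k → ≈⇒≈z (assoc g h k) }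
          ; identity = (λ g → ≈⇒≈z (identityˡ g)) , (λ g → ≈⇒≈z (identityʳ g)) }
        ; inverse = (λ g → ≈⇒≈z (inverseˡ g)) , (λ g → ≈⇒≈z (inverseʳ g))
        ; ⁻¹-cong = invz } }

-- The exponent functions need not respect equality; `uniq` makes them well defined modulo the
-- orders. It also contains both that the orders of a and b are exactly p^m and p^n and that ⟨a⟩ and
-- ⟨b⟩ meet trivially.
record Bicyclic (p : ℕ) (G : Group 0ℓ 0ℓ) (a b : Group.Carrier G) (m n : ℕ) : Set where
  open Powers G
  field
    e₁ e₂ : Carrier → ℕ
    dec   : ∀ g → g ≈ a ↑ e₁ g ∙ b ↑ e₂ g
    ord-a : a ↑ (p ^ m) ≈ ε
    ord-b : b ↑ (p ^ n) ≈ ε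
    uniq  : ∀ i j → a ↑ i ∙ b ↑ j ≈ ε → p ^ m ∣ i × p ^ n ∣ j

module _ (p : ℕ) (pr : Prime p) (2<p : 2 < p) (G : Group 0ℓ 0ℓ) where
  open Powers G

  module BicyclicProps (a b : Carrier) (m n : ℕ) (B : Bicyclic p G a b m n) where
    open Arith p pr 2<p
    open Bicyclic B public

    P Q : ℕ
    P = p ^ m
    Q = p ^ n

    instance
      P-nz : NonZero P
      P-nz = pow-nz m
      Q-nz : NonZero Q
      Q-nz = pow-nz n

    uniq² : ∀ i j k l → a ↑ i ∙ b ↑ j ≈ a ↑ k ∙ b ↑ l → Cong P i k × Cong Q j l
    uniq² i j k l e = fix (n∣m*n k) pk (proj₁ u) , fix (n∣m*n l) pl (subst (Q ∣_) (+-comm j _) (proj₂ u))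
      where
      open R
      k′ = k * pred P
      l′ = l * pred Q
      u : P ∣ k′ + i × Q ∣ j + l′
      u = uniq (k′ + i) (j + l′) (begin
        a ↑ (k′ + i) ∙ b ↑ (j + l′)                ≈⟨ ∙-cong (↑-+ a k′ i) (↑-+ b j l′) ⟩
        (a ↑ k′ ∙ a ↑ i) ∙ (b ↑ j ∙ b ↑ l′)        ≈⟨ msolve monoid ⟩
        a ↑ k′ ∙ ((a ↑ i ∙ b ↑ j) ∙ b ↑ l′)        ≈⟨ ∙-congˡ (∙-congʳ e) ⟩
        a ↑ k′ ∙ ((a ↑ k ∙ b ↑ l) ∙ b ↑ l′)        ≈⟨ msolve monoid ⟩
        (a ↑ k′ ∙ a ↑ k) ∙ (b ↑ l ∙ b ↑ l′)        ≈⟨ ∙-cong (↑-inv′ k ord-a) (↑-inv l ord-b) ⟩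
        ε ∙ ε                                      ≈⟨ identityˡ ε ⟩
        ε                                          ∎)
      pk : k * P ≡ k + k′
      pk = trans (cong (k *_) (sym (suc-pred P))) (*-suc k (pred P))
      pl : l * Q ≡ l + l′
      pl = trans (cong (l *_) (sym (suc-pred Q))) (*-suc l (pred Q))
      fix : ∀ {M i k kM k′} → M ∣ kM → kM ≡ k + k′ → M ∣ k′ + i → Cong M i k
      fix {M} {i} {k} {kM} {k′} d e d′ = c-trans (c-sym (∣⇒c+ i d))
        (c-trans (c-≡ (trans (cong (_+ i) e) (+-assoc k k′ i))) (∣⇒c+ʳ k d′))

    e-cong : ∀ {g h} → g ≈ h → Cong P (e₁ g) (e₁ h) × Cong Q (e₂ g) (e₂ h)
    e-cong {g} {h} e = uniq² (e₁ g) (e₂ g) (e₁ h) (e₂ h) (≈-trans (≈-sym (dec g)) (≈-trans e (dec h)))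

    a-exp : ∀ {i k} → a ↑ i ≈ a ↑ k → Cong P i k
    a-exp {i} {k} e = proj₁ (uniq² i 0 k 0 (∙-congʳ e))

    a-exp-∣ : ∀ {i} → a ↑ i ≈ ε → P ∣ i
    a-exp-∣ {i} e = proj₁ (uniq i 0 (≈-trans (identityʳ _) e))

    b-exp-∣ : ∀ {j} → b ↑ j ≈ ε → Q ∣ j
    b-exp-∣ {j} e = proj₂ (uniq 0 j (≈-trans (identityˡ _) e))

    -- Inverting the factorisation of g⁻¹ exchanges the two factors.
    flip : Bicyclic p G b a n m
    flip = record
      { e₁ = λ g → e₂ (g ⁻¹) * pred Q
      ; e₂ = λ g → e₁ (g ⁻¹) * pred P
      ; dec = λ g → ∙-cancelˡ (g ⁻¹) _ _ (≈-trans (inverseˡ g) (≈-sym (flipped g)))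
      ; ord-a = ord-b
      ; ord-b = ord-a
      ; uniq = λ i j e → let u = uniq j i (rot _ _ e) in proj₂ u , proj₁ u }
      where
      open R
      rot : ∀ g h → g ∙ h ≈ ε → h ∙ g ≈ ε
      rot g h e = ∙-cancelˡ g _ _ (≈-trans (≈-sym (assoc g h g)) (≈-trans (∙-congʳ e)
        (≈-trans (identityˡ g) (≈-sym (identityʳ g)))))
      flipped : ∀ g → g ⁻¹ ∙ (b ↑ (e₂ (g ⁻¹) * pred Q) ∙ a ↑ (e₁ (g ⁻¹) * pred P)) ≈ ε
      flipped g = begin
        g ⁻¹ ∙ (b ↑ j′ ∙ a ↑ i′)                  ≈⟨ ∙-congʳ (dec (g ⁻¹)) ⟩
        (a ↑ i ∙ b ↑ j) ∙ (b ↑ j′ ∙ a ↑ i′)       ≈⟨ msolve monoid ⟩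
        a ↑ i ∙ ((b ↑ j ∙ b ↑ j′) ∙ a ↑ i′)       ≈⟨ ∙-congˡ (∙-congʳ (↑-inv j ord-b)) ⟩
        a ↑ i ∙ (ε ∙ a ↑ i′)                      ≈⟨ ∙-congˡ (identityˡ _) ⟩
        a ↑ i ∙ a ↑ i′                            ≈⟨ ↑-inv i ord-a ⟩
        ε                                         ∎
        where
        i = e₁ (g ⁻¹)
        j = e₂ (g ⁻¹)
        i′ = i * pred P
        j′ = j * pred Q

-- When |a| ≥ |b|, the subgroup of order p of ⟨a⟩ is central: two of the conjugates b⁻¹aⁱb (i < |b|) have
-- the same b-component because the component of b itself is never attained, so b normalises a
-- non-trivial subgroup of ⟨a⟩; being of p-power order, it centralises the socle.
module _ (p : ℕ) (pr : Prime p) (2<p : 2 < p) (G : Group 0ℓ 0ℓ) where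
  open Powers G

  module Socle (a b : Carrier) (m n : ℕ) (B : Bicyclic p G a b (suc m) (suc n)) (n≤m : n ≤ m) where
    open Arith p pr 2<p
    open BicyclicProps p pr 2<p G a b (suc m) (suc n) B

    f₁ f₂ : ℕ → ℕ
    f₁ i = e₁ (b ⁻¹ ∙ (a ↑ i ∙ b))
    f₂ i = e₂ (b ⁻¹ ∙ (a ↑ i ∙ b))

    conj-dec : ∀ i → a ↑ i ∙ b ≈ b ∙ (a ↑ f₁ i ∙ b ↑ f₂ i)
    conj-dec i = begin
      a ↑ i ∙ b                     ≈⟨ identityˡ _ ⟨
      ε ∙ (a ↑ i ∙ b)               ≈⟨ ∙-congʳ (inverseʳ b) ⟨
      (b ∙ b ⁻¹) ∙ (a ↑ i ∙ b)      ≈⟨ assoc _ _ _ ⟩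
      b ∙ (b ⁻¹ ∙ (a ↑ i ∙ b))      ≈⟨ ∙-congˡ (dec _) ⟩
      b ∙ (a ↑ f₁ i ∙ b ↑ f₂ i)     ∎
      where open R

    %⇒Cong : ∀ i j → i % Q ≡ j % Q → Cong Q i j
    %⇒Cong i j e = mkC (j / Q) (i / Q) (trans (cong (_+ j / Q * Q) (m≡m%n+[m/n]*n i Q))
      (trans (cong (λ r → r + i / Q * Q + j / Q * Q) e) (trans (ring (j % Q) (i / Q * Q) (j / Q * Q))
        (cong (_+ i / Q * Q) (sym (m≡m%n+[m/n]*n j Q))))))
      where
      ring : ∀ r x y → r + x + y ≡ r + y + x
      ring = solve-∀

    -- Cancelling b on the right of aⁱ b = b a^f b would put b into ⟨a⟩.
    not-1 : ∀ i → ¬ Cong Q (f₂ i) 1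
    not-1 i c = p∤1 (∣-trans (m∣m*n (p ^ n)) (c⇒∣ (c-sym (proj₂ (uniq² (i + f₁ i * pred P) 0 0 1 eq)))))
      where
      open R
      f = f₁ i
      e : a ↑ i ≈ b ∙ a ↑ f
      e = ∙-cancelʳ b _ _ (begin
        a ↑ i ∙ b                ≈⟨ conj-dec i ⟩
        b ∙ (a ↑ f ∙ b ↑ f₂ i)   ≈⟨ ∙-congˡ (∙-congˡ (≈-trans (↑-mod {j = 1} ord-b c) (↑-1 b))) ⟩
        b ∙ (a ↑ f ∙ b)          ≈⟨ assoc _ _ _ ⟨
        (b ∙ a ↑ f) ∙ b          ∎)
      eq : a ↑ (i + f * pred P) ∙ ε ≈ ε ∙ b ↑ 1
      eq = begin
        a ↑ (i + f * pred P) ∙ ε         ≈⟨ ∙-congʳ (↑-+ a i (f * pred P)) ⟩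
        (a ↑ i ∙ a ↑ (f * pred P)) ∙ ε   ≈⟨ ∙-congʳ (∙-congʳ e) ⟩
        ((b ∙ a ↑ f) ∙ a ↑ (f * pred P)) ∙ ε  ≈⟨ msolve monoid ⟩
        b ∙ (a ↑ f ∙ a ↑ (f * pred P))   ≈⟨ ∙-congˡ (↑-inv f ord-a) ⟩
        b ∙ ε                            ≈⟨ msolve monoid ⟩
        ε ∙ b ↑ 1                        ∎

    collide : ∀ i δ → Cong Q (f₂ i) (f₂ (δ + i)) → ∃ λ u → a ↑ δ ∙ b ≈ b ∙ a ↑ u
    collide i δ c = fj + fi * pred P , (begin
      a ↑ δ ∙ b                                     ≈⟨ msolve monoid ⟩
      (a ↑ δ ∙ b) ∙ ε                               ≈⟨ ∙-congˡ (↑-inv fi ord-a) ⟨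
      (a ↑ δ ∙ b) ∙ (a ↑ fi ∙ a ↑ (fi * pred P))    ≈⟨ assoc _ _ _ ⟨
      ((a ↑ δ ∙ b) ∙ a ↑ fi) ∙ a ↑ (fi * pred P)    ≈⟨ ∙-congʳ e ⟩
      (b ∙ a ↑ fj) ∙ a ↑ (fi * pred P)              ≈⟨ assoc _ _ _ ⟩
      b ∙ (a ↑ fj ∙ a ↑ (fi * pred P))              ≈⟨ ∙-congˡ (↑-+ a fj (fi * pred P)) ⟨
      b ∙ a ↑ (fj + fi * pred P)                    ∎)
      where
      open R
      fi = f₁ i
      fj = f₁ (δ + i)
      g = f₂ i
      e : (a ↑ δ ∙ b) ∙ a ↑ fi ≈ b ∙ a ↑ fj
      e = ∙-cancelʳ (b ↑ g) _ _ (begin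
        ((a ↑ δ ∙ b) ∙ a ↑ fi) ∙ b ↑ g     ≈⟨ msolve monoid ⟩
        a ↑ δ ∙ (b ∙ (a ↑ fi ∙ b ↑ g))     ≈⟨ ∙-congˡ (conj-dec i) ⟨
        a ↑ δ ∙ (a ↑ i ∙ b)                ≈⟨ assoc _ _ _ ⟨
        (a ↑ δ ∙ a ↑ i) ∙ b                ≈⟨ ∙-congʳ (↑-+ a δ i) ⟨
        a ↑ (δ + i) ∙ b                    ≈⟨ conj-dec (δ + i) ⟩
        b ∙ (a ↑ fj ∙ b ↑ f₂ (δ + i))      ≈⟨ ∙-congˡ (∙-congˡ (↑-mod ord-b c)) ⟨
        b ∙ (a ↑ fj ∙ b ↑ g)               ≈⟨ assoc _ _ _ ⟨
        (b ∙ a ↑ fj) ∙ b ↑ g               ∎)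

    -- Index 0 occupies the residue 1, which no conjugate attains; a collision must therefore
    -- involve two genuine conjugates.
    F : Fin (suc Q) → Fin Q
    F Fin.zero    = fromℕ< (m%n<n 1 Q)
    F (Fin.suc i) = fromℕ< (m%n<n (f₂ (toℕ i)) Q)

    F-inj : ∀ i j → fromℕ< (m%n<n i Q) ≡ fromℕ< (m%n<n j Q) → Cong Q i j
    F-inj i j e = %⇒Cong i j (trans (sym (Fin.toℕ-fromℕ< (m%n<n i Q))) (trans (cong toℕ e) (Fin.toℕ-fromℕ< (m%n<n j Q))))

    δ-exists : ∃₂ λ δ u → NonZero δ × δ < Q × a ↑ δ ∙ b ≈ b ∙ a ↑ u
    δ-exists with Fin.pigeonhole (n<1+n Q) F
    ... | Fin.zero , Fin.zero , () , e
    ... | Fin.suc i , Fin.zero , () , e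
    ... | Fin.zero , Fin.suc j , _ , e = ⊥-elim (not-1 (toℕ j) (c-sym (F-inj 1 (f₂ (toℕ j)) e)))
    ... | Fin.suc i , Fin.suc j , s≤s i<j , e = δ , proj₁ col , >-nonZero (m<n⇒0<n∸m i<j) ,
        ≤-trans (s≤s (m∸n≤m (toℕ j) (toℕ i))) (Fin.toℕ<n j) , proj₂ col
      where
      δ = toℕ j ∸ toℕ i
      col = collide (toℕ i) δ (subst (λ k → Cong Q (f₂ (toℕ i)) (f₂ k)) (sym (m∸n+n≡m (<⇒≤ i<j)))
              (F-inj (f₂ (toℕ i)) (f₂ (toℕ j)) e))

    z : Carrier
    z = a ↑ (p ^ m)

    z-ord : z ↑ p ≈ ε
    z-ord = ≈-trans (≈-sym (↑-* a p (p ^ m))) ord-a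

    -- By `n≤m`, δ < Q ≤ P, so a^δ is not the identity; every non-trivial subgroup of a cyclic
    -- p-group contains its subgroup of order p.
    z-multiple : ∀ δ → NonZero δ → δ < Q → ∃ λ r → Cong P (δ * r) (p ^ m)
    z-multiple δ nz δ<Q with val (suc m) δ
    ... | inj₁ d = ⊥-elim (<⇒≱ (≤-trans δ<Q (∣⇒≤ (^-∣ p (s≤s n≤m)))) (∣⇒≤ {{nz}} d))
    ... | inj₂ (κ , I , s≤s κ≤m , refl , h) = w * p ^ (m ∸ κ) ,
        c-trans (c-≡ (ring (p ^ κ) I w (p ^ (m ∸ κ)))) (c-trans (c-*ʳ (p ^ κ * p ^ (m ∸ κ)) (proj₂ (inv-mod (suc m) I h)))
          (c-≡ (trans (*-identityˡ _) (trans (sym (^-distribˡ-+-* p κ (m ∸ κ))) (cong (p ^_) (m+[n∸m]≡n κ≤m))))))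
      where
      w = proj₁ (inv-mod (suc m) I h)
      ring : ∀ k I w q → k * I * (w * q) ≡ I * w * (k * q)
      ring = solve-∀

    z-conj : ∃ λ v → z ∙ b ≈ b ∙ z ↑ v
    z-conj with δ-exists
    ... | δ , u , nz , δ<Q , e with z-multiple δ nz δ<Q
    ...   | r , c = v , ≈-trans zb (∙-congˡ (≈-trans (↑-≡ a (m∣n⇒n≡quotient*m dv)) (↑-* a v (p ^ m))))
      where
      open R
      zb : z ∙ b ≈ b ∙ a ↑ (r * u)
      zb = begin
        z ∙ b            ≈⟨ ∙-congʳ (↑-mod ord-a c) ⟨
        a ↑ (δ * r) ∙ b  ≈⟨ ∙-congʳ (↑-*′ a δ r) ⟩
        (a ↑ δ) ↑ r ∙ b  ≈⟨ conj-↑ r e ⟩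
        b ∙ (a ↑ u) ↑ r  ≈⟨ ∙-congˡ (↑-* a r u) ⟨
        b ∙ a ↑ (r * u)  ∎
      pu : a ↑ (p * (r * u)) ≈ ε
      pu = ∙-cancelˡ b _ _ (begin
        b ∙ a ↑ (p * (r * u))   ≈⟨ ∙-congˡ (↑-* a p (r * u)) ⟩
        b ∙ (a ↑ (r * u)) ↑ p   ≈⟨ conj-↑ p zb ⟨
        z ↑ p ∙ b               ≈⟨ ∙-congʳ z-ord ⟩
        ε ∙ b                   ≈⟨ msolve monoid ⟩
        b ∙ ε                   ∎)
      dv : p ^ m ∣ r * u
      dv = *-cancelˡ-∣ p (a-exp-∣ pu)
      v = _∣_.quotient dv

    z-b : z ∙ b ≈ b ∙ z
    z-b with z-conj
    ... | v , e = ≈-trans e (∙-congˡ (≈-trans (↑-mod z-ord v≡1) (↑-1 z)))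
      where
      open R
      zz : a ↑ (p ^ m * 1) ≈ a ↑ (p ^ m * v ^ Q)
      zz = begin
        a ↑ (p ^ m * 1)        ≈⟨ ↑-≡ a (*-identityʳ (p ^ m)) ⟩
        z                      ≈⟨ identityʳ z ⟨
        z ∙ ε                  ≈⟨ ∙-congˡ ord-b ⟨
        z ∙ b ↑ Q              ≈⟨ skew¹ {v = v} Q e ⟩
        b ↑ Q ∙ z ↑ (v ^ Q)    ≈⟨ ∙-congʳ ord-b ⟩
        ε ∙ z ↑ (v ^ Q)        ≈⟨ identityˡ _ ⟩
        z ↑ (v ^ Q)            ≈⟨ ↑-*′ a (p ^ m) (v ^ Q) ⟨
        a ↑ (p ^ m * v ^ Q)    ∎
      v≡1 : Cong p v 1
      v≡1 = c-sym (c-trans (c-unscale (p ^ m) {{pow-nz m}} (subst (λ k → Cong k (p ^ m * 1) (p ^ m * v ^ Q)) (*-comm p (p ^ m)) (a-exp {p ^ m * 1} {p ^ m * v ^ Q} zz)))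
        (fermat^ (suc n) v))

    z-central : ∀ g → z ∙ g ≈ g ∙ z
    z-central g = ≈-trans (∙-congˡ (dec g)) (≈-trans (≈-sym (comm-∙
      (comm-↑ (e₁ g) (≈-sym (comm-↑ (p ^ m) ≈-refl))) (comm-↑ (e₂ g) (≈-sym z-b)))) (∙-congʳ (≈-sym (dec g))))

-- A normal cyclic subgroup containing the commutators

module CyclicNormal (p : ℕ) (pr : Prime p) (2<p : 2 < p) where
  open Arith p pr 2<p

  record Functional (G : Group 0ℓ 0ℓ) (h : Group.Carrier G → ℕ) : Set where
    open Powers G
    field
      resp : ∀ {g k} → g ≈ k → Cong p (h g) (h k)
      h-∙  : ∀ g k → Cong p (h (g ∙ k)) (h g + h k)

    h-ε : Cong p (h ε) 0
    h-ε = c-+-cancelʳ (h ε) (c-trans (c-sym (h-∙ ε ε)) (resp (identityˡ ε)))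

    h-↑ : ∀ g k → Cong p (h (g ↑ k)) (k * h g)
    h-↑ g zero    = h-ε
    h-↑ g (suc k) = c-trans (h-∙ g (g ↑ k)) (c-+ (c-refl {x = h g}) (h-↑ g k))

  -- h₁ and h₂ are the coordinates of G / Φ(G) ≅ (ℤ/p)² in the basis a, b.
  record CyclicCommutators (G : Group 0ℓ 0ℓ) (a b : Group.Carrier G) : Set where
    open Powers G
    open Commutators p pr 2<p G
    field
      q     : Carrier
      L     : ℕ
      expo  : ∀ g → g ↑ (p ^ L) ≈ ε
      cyc   : CyclicDerived q
      h₁ h₂ : Carrier → ℕ
      hom₁  : Functional G h₁
      hom₂  : Functional G h₂
      h₁a   : Cong p (h₁ a) 1
      h₁b   : Cong p (h₁ b) 0
      h₁q   : Cong p (h₁ q) 0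
      h₂a   : Cong p (h₂ a) 0
      h₂b   : Cong p (h₂ b) 1
      h₂q   : Cong p (h₂ q) 0

  flipCC : ∀ {G a b} → CyclicCommutators G a b → CyclicCommutators G b a
  flipCC C = record { q = q ; L = L ; expo = expo ; cyc = cyc ; h₁ = h₂ ; h₂ = h₁ ; hom₁ = hom₂ ; hom₂ = hom₁
    ; h₁a = h₂b ; h₁b = h₂a ; h₁q = h₂q ; h₂a = h₁b ; h₂b = h₁a ; h₂q = h₁q }
    where open CyclicCommutators C

  -- The field `pc` expresses the powers of c in the coordinates of a and b, up to an exponent
  -- congruent to 1 modulo p. The order of c and its intersections with ⟨a⟩ and ⟨b⟩ are all read off
  -- from it.
  record NormalCyclic (G : Group 0ℓ 0ℓ) (a b : Group.Carrier G) : Set where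
    open Powers G
    field
      I J  : ℕ
      L    : ℕ
    c : Carrier
    c = a ↑ I ∙ b ↑ J
    field
      expo : ∀ g → g ↑ (p ^ L) ≈ ε
      pc   : ∀ k → ∃ λ t → c ↑ (p ^ k * (1 + p * t)) ≈ a ↑ (p ^ k * I) ∙ b ↑ (p ^ k * J)
      norm : ∀ g → ∃ λ w → c ∙ g ≈ g ∙ c ↑ (1 + p * w)
      unit : ¬ p ∣ I ⊎ ¬ p ∣ J

  module _ (G : Group 0ℓ 0ℓ) where
    open Powers G

    module FindNormal (a b : Carrier) (m n : ℕ) (B : Bicyclic p G a b (suc m) (suc n))
        (C : CyclicCommutators G a b) where
      open Commutators p pr 2<p G
      open BicyclicProps p pr 2<p G a b (suc m) (suc n) B
      open CyclicCommutators C
      open CyclicDerived cyc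

      instance
        N-nz : NonZero (p ^ L)
        N-nz = pow-nz L

      -- With K = p^(κ+1), the power formula gives c^K = q · q^(Kt) = q^(1 + Kt). This exponent is
      -- invertible, so q is a power of c^p, and a commutator of c with anything lies in ⟨q⟩, hence
      -- in ⟨c^p⟩.
      core : ∀ κ I J → ¬ p ∣ I ⊎ ¬ p ∣ J → q ≈ a ↑ (p ^ suc κ * I) ∙ b ↑ (p ^ suc κ * J) → NormalCyclic G a b
      core κ I J h e = record { I = I ; J = J ; L = L ; expo = expo ; pc = pc ; norm = norm′ ; unit = h }
        where
        open R
        c = a ↑ I ∙ b ↑ J
        pp₀ = prod-p^ (p ^ L) (expo q) (loc (a ↑ I) (b ↑ J))
        pp : ∀ k → ∃ λ t → c ↑ (p ^ k) ≈ a ↑ (p ^ k * I) ∙ (b ↑ (p ^ k * J) ∙ q ↑ (p ^ k * t))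
        pp k = proj₁ (pp₀ k) , ≈-trans (proj₂ (pp₀ k)) (∙-cong (≈-sym (↑-* a (p ^ k) I)) (∙-congʳ (≈-sym (↑-* b (p ^ k) J))))
        K : ℕ
        K = p ^ suc κ
        t : ℕ
        t = proj₁ (pp (suc κ))
        unit : ¬ p ∣ 1 + K * t
        unit = c-∤ (∣⇒c+ʳ 1 (∣m⇒∣m*n t (m∣m*n (p ^ κ)))) p∤1
        u : ℕ
        u = proj₁ (inv-mod L (1 + K * t) unit)
        s : ℕ
        s = p ^ κ * u
        cK : c ↑ K ≈ q ↑ (1 + K * t)
        cK = ≈-trans (proj₂ (pp (suc κ))) (≈-trans (≈-sym (assoc _ _ _)) (∙-congʳ (≈-sym e)))
        q≈ : q ≈ c ↑ (p * s)
        q≈ = begin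
          q                          ≈⟨ ↑-1 q ⟨
          q ↑ 1                      ≈⟨ ↑-mod (expo q) (c-sym (proj₂ (inv-mod L (1 + K * t) unit))) ⟩
          q ↑ ((1 + K * t) * u)      ≈⟨ ↑-*′ q (1 + K * t) u ⟩
          (q ↑ (1 + K * t)) ↑ u      ≈⟨ ↑-cong u cK ⟨
          (c ↑ K) ↑ u                ≈⟨ ↑-*′ c K u ⟨
          c ↑ (K * u)                ≈⟨ ↑-≡ c (*-assoc p (p ^ κ) u) ⟩
          c ↑ (p * s)                ∎
        norm′ : ∀ g → ∃ λ w → c ∙ g ≈ g ∙ c ↑ (1 + p * w)
        norm′ g = norm-from (proj₁ (comm g c)) (proj₂ (comm g c))
          where
          norm-from : ∀ k → c ∙ g ≈ g ∙ (c ∙ q ↑ k) → ∃ λ w → c ∙ g ≈ g ∙ c ↑ (1 + p * w)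
          norm-from k e = s * k , ≈-trans e (∙-congˡ (∙-congˡ (≈-trans (↑-cong k q≈)
            (≈-trans (≈-sym (↑-*′ c (p * s) k)) (↑-≡ c (*-assoc p s k))))))
        pc : ∀ k → ∃ λ t → c ↑ (p ^ k * (1 + p * t)) ≈ a ↑ (p ^ k * I) ∙ b ↑ (p ^ k * J)
        pc k = s * proj₁ (pp k) * pred (p ^ L) , absorb-tail p (p ^ L) s (proj₁ (pp k)) (p ^ k) (expo c) q≈ (proj₂ (pp k))

      -- The first coordinate on G / Φ(G) kills q, and on a product of powers of a and b it returns
      -- the exponent of a modulo p.
      p∣e₁ : p ∣ e₁ q
      p∣e₁ = c⇒∣ (c-trans (c-sym (c-trans (resp (dec q)) (c-trans (h-∙ _ _)
        (c-trans (c-+ (c-trans (h-↑ a (e₁ q)) (c-*ˡ (e₁ q) h₁a)) (c-trans (h-↑ b (e₂ q)) (c-*ˡ (e₂ q) h₁b)))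
          (c-≡ (trans (cong₂ _+_ (*-identityʳ (e₁ q)) (*-zeroʳ (e₂ q))) (+-identityʳ _))))))) h₁q)
        where open Functional hom₁

      p∣e₂ : p ∣ e₂ q
      p∣e₂ = c⇒∣ (c-trans (c-sym (c-trans (resp (dec q)) (c-trans (h-∙ _ _)
        (c-trans (c-+ (c-trans (h-↑ a (e₁ q)) (c-*ˡ (e₁ q) h₂a)) (c-trans (h-↑ b (e₂ q)) (c-*ˡ (e₂ q) h₂b)))
          (c-≡ (cong₂ _+_ (*-zeroʳ (e₁ q)) (*-identityʳ (e₂ q)))))))) h₂q)
        where open Functional hom₂

      split : ∀ κ l J → κ ≤ l → p ^ suc l * J ≡ p ^ suc κ * (p ^ (l ∸ κ) * J)
      split κ l J κ≤l = trans (cong (_* J) (trans (cong (p ^_) (cong suc (sym (m+[n∸m]≡n κ≤l)))) (^-distribˡ-+-* p (suc κ) (l ∸ κ))))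
        (*-assoc (p ^ suc κ) (p ^ (l ∸ κ)) J)

      normal : NormalCyclic G a b
      normal with val (suc m) (e₁ q) | val (suc n) (e₂ q)
      -- Here q is trivial and G is abelian; c = a serves.
      ... | inj₁ dx | inj₁ dy = core m 1 0 (inj₁ p∤1) (≈-trans (dec q)
            (∙-cong (≈-trans (↑-∣ ord-a dx) (≈-sym (↑-∣ {M = P} {P * 1} ord-a (m∣m*n 1))))
              (≈-trans (↑-∣ ord-b dy) (↑-≡ b {0} {P * 0} (sym (*-zeroʳ P))))))
      ... | inj₂ (zero , I , _ , ex , h) | _ = ⊥-elim (h (subst (p ∣_) (trans ex (*-identityˡ I)) p∣e₁))
      ... | _ | inj₂ (zero , J , _ , ey , h) = ⊥-elim (h (subst (p ∣_) (trans ey (*-identityˡ J)) p∣e₂))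
      ... | inj₂ (suc κ , I , _ , ex , h) | inj₁ dy = core κ I 0 (inj₁ h) (≈-trans (dec q)
            (∙-cong (↑-≡ a ex) (≈-trans (↑-∣ ord-b dy) (↑-≡ b {0} {p ^ suc κ * 0} (sym (*-zeroʳ (p ^ suc κ)))))))
      ... | inj₁ dx | inj₂ (suc κ , J , _ , ey , h) = core κ 0 J (inj₂ h) (≈-trans (dec q)
            (∙-cong (≈-trans (↑-∣ ord-a dx) (↑-≡ a {0} {p ^ suc κ * 0} (sym (*-zeroʳ (p ^ suc κ))))) (↑-≡ b ey)))
      -- Extracting the smaller of the two valuations leaves I or J prime to p.
      ... | inj₂ (suc κ , I , _ , ex , h) | inj₂ (suc l , J , _ , ey , h′) with ≤-total κ l
      ...   | inj₁ κ≤l = core κ I (p ^ (l ∸ κ) * J) (inj₁ h) (≈-trans (dec q) (∙-cong (↑-≡ a ex)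
                (↑-≡ b (trans ey (split κ l J κ≤l)))))
      ...   | inj₂ l≤κ = core l (p ^ (κ ∸ l) * I) J (inj₂ h′) (≈-trans (dec q) (∙-cong
                (↑-≡ a (trans ex (split l κ I l≤κ))) (↑-≡ b ey)))

  module _ (G : Group 0ℓ 0ℓ) where
    open Powers G

    module Span (c g : Carrier) (v : ℕ) (e : c ∙ g ≈ g ∙ c ↑ v) where

      InSpan : Carrier → Set
      InSpan k = ∃₂ λ j i → k ≈ g ↑ j ∙ c ↑ i

      span-≈ : ∀ {k l} → k ≈ l → InSpan l → InSpan k
      span-≈ e (j , i , f) = j , i , ≈-trans e f

      span-g : ∀ j → InSpan (g ↑ j)
      span-g j = j , 0 , ≈-sym (identityʳ _)

      span-c : ∀ i → InSpan (c ↑ i)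
      span-c i = 0 , i , ≈-sym (identityˡ _)

      span-∙ : ∀ {k l} → InSpan k → InSpan l → InSpan (k ∙ l)
      span-∙ {k} {l} (j , i , ek) (j′ , i′ , el) = j + j′ , i * v ^ j′ + i′ , (begin
        k ∙ l                                                     ≈⟨ ∙-cong ek el ⟩
        (g ↑ j ∙ c ↑ i) ∙ (g ↑ j′ ∙ c ↑ i′)                       ≈⟨ msolve monoid ⟩
        g ↑ j ∙ ((c ↑ i ∙ g ↑ j′) ∙ c ↑ i′)                       ≈⟨ ∙-congˡ (∙-congʳ (skew² {v = v} i j′ e)) ⟩
        g ↑ j ∙ ((g ↑ j′ ∙ c ↑ (i * v ^ j′)) ∙ c ↑ i′)            ≈⟨ msolve monoid ⟩
        (g ↑ j ∙ g ↑ j′) ∙ (c ↑ (i * v ^ j′) ∙ c ↑ i′)            ≈⟨ ∙-cong (↑-+ g j j′) (↑-+ c (i * v ^ j′) i′) ⟨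
        g ↑ (j + j′) ∙ c ↑ (i * v ^ j′ + i′)                      ∎)
        where open R

      span-↑ : ∀ {k} n → InSpan k → InSpan (k ↑ n)
      span-↑ zero    s = span-g 0
      span-↑ (suc n) s = span-∙ s (span-↑ n s)

  module _ (G : Group 0ℓ 0ℓ) where
    open Powers G

    module NormalGen (a b : Carrier) (m n : ℕ) (B : Bicyclic p G a b m n) (C : NormalCyclic G a b) where
      open BicyclicProps p pr 2<p G a b m n B
      open NormalCyclic C

      a^I≈ : a ↑ I ≈ c ∙ b ↑ (J * pred Q)
      a^I≈ = ≈-sym (≈-trans (assoc _ _ _) (≈-trans (∙-congˡ (↑-inv J ord-b)) (identityʳ _)))

      b^J≈ : b ↑ J ≈ a ↑ (I * pred P) ∙ c
      b^J≈ = ≈-sym (≈-trans (≈-sym (assoc _ _ _)) (≈-trans (∙-congʳ (↑-inv′ I ord-a)) (identityˡ _)))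

      a≈ : (h : ¬ p ∣ I) → a ≈ (a ↑ I) ↑ proj₁ (inv-mod m I h)
      a≈ h = ≈-trans (≈-sym (↑-1 a)) (≈-trans (↑-mod {M = P} {1} {I * proj₁ (inv-mod m I h)} ord-a (c-sym (proj₂ (inv-mod m I h)))) (↑-*′ a I (proj₁ (inv-mod m I h))))

      b≈ : (h : ¬ p ∣ J) → b ≈ (b ↑ J) ↑ proj₁ (inv-mod n J h)
      b≈ h = ≈-trans (≈-sym (↑-1 b)) (≈-trans (↑-mod {M = Q} {1} {J * proj₁ (inv-mod n J h)} ord-b (c-sym (proj₂ (inv-mod n J h)))) (↑-*′ b J (proj₁ (inv-mod n J h))))

      -- The power a^I is c times a power of b; as I is invertible modulo the order of a, it
      -- generates ⟨a⟩.
      spanned-b : ¬ p ∣ I → ∀ g → ∃₂ λ j i → g ≈ b ↑ j ∙ c ↑ i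
      spanned-b h g = span-≈ (dec g) (span-∙ (span-↑ (e₁ g) sa) (span-g (e₂ g)))
        where
        open Span G c b (1 + p * proj₁ (norm b)) (proj₂ (norm b))
        sa : InSpan a
        sa = span-≈ (a≈ h) (span-↑ (proj₁ (inv-mod m I h)) (span-≈ a^I≈ (span-∙ (span-≈ (≈-sym (↑-1 c)) (span-c 1)) (span-g (J * pred Q)))))

      spanned-a : ¬ p ∣ J → ∀ g → ∃₂ λ j i → g ≈ a ↑ j ∙ c ↑ i
      spanned-a h g = span-≈ (dec g) (span-∙ (span-g (e₁ g)) (span-↑ (e₂ g) sb))
        where
        open Span G c a (1 + p * proj₁ (norm a)) (proj₂ (norm a))
        sb : InSpan b
        sb = span-≈ (b≈ h) (span-↑ (proj₁ (inv-mod n J h)) (span-≈ b^J≈ (span-∙ (span-g (I * pred P)) (span-≈ (≈-sym (↑-1 c)) (span-c 1)))))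

  module _ (G : Group 0ℓ 0ℓ) where
    open Powers G

    -- Stated with a central z so as to serve twice: for the extension by the socle in the
    -- induction, and with z trivial for the presented groups.
    module Derived (g c z : Carrier) (w u N : ℕ) {{_ : NonZero N}} (expo : (c ↑ (p * w) ∙ z ↑ u) ↑ N ≈ ε)
        (central : ∀ k → z ∙ k ≈ k ∙ z) (cg : c ∙ g ≈ g ∙ (c ∙ (c ↑ (p * w) ∙ z ↑ u)))
        (gen : ∀ k → ∃₂ λ j i → ∃ λ l → k ≈ (g ↑ j ∙ c ↑ i) ∙ z ↑ l) where
      open Commutators p pr 2<p G

      q : Carrier
      q = c ↑ (p * w) ∙ z ↑ u

      Nm : Carrier → Set
      Nm k = ∃ λ r → q ∙ k ≈ k ∙ q ↑ (1 + p * r)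

      Nm-comm : ∀ {k} → q ∙ k ≈ k ∙ q → Nm k
      Nm-comm e = 0 , ≈-trans e (∙-congˡ (≈-trans (≈-sym (↑-1 q)) (↑-≡ q (cong suc (sym (*-zeroʳ p))))))

      Nm-∙ : ∀ {k l} → Nm k → Nm l → Nm (k ∙ l)
      Nm-∙ {k} {l} (r , e) (s , f) = r + (1 + p * r) * s , (begin
        q ∙ (k ∙ l)                                ≈⟨ assoc _ _ _ ⟨
        (q ∙ k) ∙ l                                ≈⟨ ∙-congʳ e ⟩
        (k ∙ q ↑ (1 + p * r)) ∙ l                  ≈⟨ assoc _ _ _ ⟩
        k ∙ (q ↑ (1 + p * r) ∙ l)                  ≈⟨ ∙-congˡ (skew {v = 1 + p * s} (1 + p * r) f) ⟩
        k ∙ (l ∙ q ↑ ((1 + p * r) * (1 + p * s)))  ≈⟨ assoc _ _ _ ⟨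
        (k ∙ l) ∙ q ↑ ((1 + p * r) * (1 + p * s))  ≈⟨ ∙-congˡ (↑-≡ q (ring p r s)) ⟩
        (k ∙ l) ∙ q ↑ (1 + p * (r + (1 + p * r) * s)) ∎)
        where
        open R
        ring : ∀ p r s → (1 + p * r) * (1 + p * s) ≡ 1 + p * (r + (1 + p * r) * s)
        ring = solve-∀

      Nm-↑ : ∀ {k} n → Nm k → Nm (k ↑ n)
      Nm-↑ zero    s = Nm-comm (≈-trans (identityʳ q) (≈-sym (identityˡ q)))
      Nm-↑ (suc n) s = Nm-∙ s (Nm-↑ n s)

      z^ : ∀ l k → z ↑ l ∙ k ≈ k ∙ z ↑ l
      z^ l k = comm-↑ l (central k)

      qc : q ∙ c ≈ c ∙ q
      qc = comm-∙ (comm-↑ (p * w) ≈-refl) (z^ u c)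

      -- Conjugation by g turns c into cq and fixes z; since q commutes with c, the power (cq)^(pw)
      -- splits, and the factor c^(pw) reassembles with z^u to q.
      qg : q ∙ g ≈ g ∙ q ↑ (1 + p * w)
      qg = begin
        (c ↑ (p * w) ∙ z ↑ u) ∙ g                            ≈⟨ assoc _ _ _ ⟩
        c ↑ (p * w) ∙ (z ↑ u ∙ g)                            ≈⟨ ∙-congˡ (z^ u g) ⟩
        c ↑ (p * w) ∙ (g ∙ z ↑ u)                            ≈⟨ assoc _ _ _ ⟨
        (c ↑ (p * w) ∙ g) ∙ z ↑ u                            ≈⟨ ∙-congʳ (conj-↑ (p * w) cg) ⟩
        (g ∙ (c ∙ q) ↑ (p * w)) ∙ z ↑ u                      ≈⟨ ∙-congʳ (∙-congˡ (comm-dist (p * w) (≈-sym qc))) ⟩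
        (g ∙ (c ↑ (p * w) ∙ q ↑ (p * w))) ∙ z ↑ u            ≈⟨ msolve monoid ⟩
        g ∙ (c ↑ (p * w) ∙ (q ↑ (p * w) ∙ z ↑ u))            ≈⟨ ∙-congˡ (∙-congˡ (z^ u _)) ⟨
        g ∙ (c ↑ (p * w) ∙ (z ↑ u ∙ q ↑ (p * w)))            ≈⟨ ∙-congˡ (assoc _ _ _) ⟨
        g ∙ (q ∙ q ↑ (p * w))                                ∎
        where open R

      norm : ∀ k → Nm k
      norm k with gen k
      ... | j , i , l , e = let (r , f) = Nm-∙ (Nm-∙ (Nm-↑ j (w , qg)) (Nm-↑ i (Nm-comm qc))) (Nm-↑ l (Nm-comm (≈-sym (central q))))
                            in r , ≈-trans (∙-congˡ e) (≈-trans f (∙-congʳ (≈-sym e)))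

      Cm : Carrier → Carrier → Set
      Cm k l = ∃ λ r → l ∙ k ≈ k ∙ (l ∙ q ↑ r)

      Cm-comm : ∀ {k l} → l ∙ k ≈ k ∙ l → Cm k l
      Cm-comm e = 0 , ≈-trans e (∙-congˡ (≈-sym (identityʳ _)))

      Cm-≈ : ∀ {k k′ l l′} → k ≈ k′ → l ≈ l′ → Cm k′ l′ → Cm k l
      Cm-≈ e f (r , d) = r , ≈-trans (∙-cong f e) (≈-trans d (∙-cong (≈-sym e) (∙-congʳ (≈-sym f))))

      Cm-∙-Nm : ∀ {k k′ l} → Nm k′ → Cm k l → Cm k′ l → Cm (k ∙ k′) l
      Cm-∙-Nm {k} {k′} {l} (t , n) (r , e) (s , f) = s + r * (1 + p * t) , (begin
        l ∙ (k ∙ k′)                                      ≈⟨ assoc _ _ _ ⟨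
        (l ∙ k) ∙ k′                                      ≈⟨ ∙-congʳ e ⟩
        (k ∙ (l ∙ q ↑ r)) ∙ k′                            ≈⟨ msolve monoid ⟩
        k ∙ (l ∙ (q ↑ r ∙ k′))                            ≈⟨ ∙-congˡ (∙-congˡ (skew {v = 1 + p * t} r n)) ⟩
        k ∙ (l ∙ (k′ ∙ q ↑ (r * (1 + p * t))))            ≈⟨ msolve monoid ⟩
        k ∙ ((l ∙ k′) ∙ q ↑ (r * (1 + p * t)))            ≈⟨ ∙-congˡ (∙-congʳ f) ⟩
        k ∙ ((k′ ∙ (l ∙ q ↑ s)) ∙ q ↑ (r * (1 + p * t)))  ≈⟨ msolve monoid ⟩
        (k ∙ k′) ∙ (l ∙ (q ↑ s ∙ q ↑ (r * (1 + p * t))))  ≈⟨ ∙-congˡ (∙-congˡ (↑-+ q s (r * (1 + p * t)))) ⟨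
        (k ∙ k′) ∙ (l ∙ q ↑ (s + r * (1 + p * t)))        ∎)
        where open R

      Cm-∙ˡ : ∀ {k k′ l} → Cm k l → Cm k′ l → Cm (k ∙ k′) l
      Cm-∙ˡ {k} {k′} = Cm-∙-Nm (norm k′)

      Cm-sym : ∀ {k l} → Cm k l → Cm l k
      Cm-sym {k} {l} (r , e) = r * pred N , (begin
        k ∙ l                                             ≈⟨ msolve monoid ⟩
        k ∙ (l ∙ ε)                                       ≈⟨ ∙-congˡ (∙-congˡ (↑-inv r expo)) ⟨
        k ∙ (l ∙ (q ↑ r ∙ q ↑ (r * pred N)))              ≈⟨ msolve monoid ⟩
        (k ∙ (l ∙ q ↑ r)) ∙ q ↑ (r * pred N)              ≈⟨ ∙-congʳ e ⟨
        (l ∙ k) ∙ q ↑ (r * pred N)                        ≈⟨ assoc _ _ _ ⟩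
        l ∙ (k ∙ q ↑ (r * pred N))                        ∎)
        where open R

      Cm-↑ˡ : ∀ {k l} n → Cm k l → Cm (k ↑ n) l
      Cm-↑ˡ zero    e = Cm-comm (≈-trans (identityʳ _) (≈-sym (identityˡ _)))
      Cm-↑ˡ (suc n) e = Cm-∙ˡ e (Cm-↑ˡ n e)

      Cm-gen : ∀ {l} → Cm g l → Cm c l → ∀ k → Cm k l
      Cm-gen {l} eg ec k with gen k
      ... | j , i , n , e = Cm-≈ e ≈-refl (Cm-∙ˡ (Cm-∙ˡ (Cm-↑ˡ j eg) (Cm-↑ˡ i ec)) (Cm-↑ˡ n (Cm-comm (≈-sym (central l)))))

      -- The relation `Cm` is closed under products because ⟨q⟩ is normal, and symmetric because q
      -- has finite order. Extending first one argument and then the other carries the single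
      -- relation between g and c to all pairs.
      comm : ∀ k l → Cm k l
      comm k l = Cm-gen (Cm-sym (Cm-gen (Cm-comm ≈-refl) gc l)) (Cm-sym (Cm-gen cgm (Cm-comm ≈-refl) l)) k
        where
        cgm : Cm g c
        cgm = 1 , ≈-trans cg (∙-congˡ (∙-congˡ (≈-sym (↑-1 q))))
        gc : Cm c g
        gc = Cm-sym cgm

      cyclicDerived : CyclicDerived q
      cyclicDerived = record { comm = comm ; norm = norm }

-- Induction through central quotients of order p

module Reduction (p : ℕ) (pr : Prime p) (2<p : 2 < p) where
  open Arith p pr 2<p
  open CyclicNormal p pr 2<p

  module _ (G : Group 0ℓ 0ℓ) where
    open Powers G

    module Reduce (a b : Carrier) (m n : ℕ) (B : Bicyclic p G a b (suc (suc m)) (suc n))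
        (n≤m : n ≤ suc m) where
      open BicyclicProps p pr 2<p G a b (suc (suc m)) (suc n) B
      open Socle p pr 2<p G a b (suc m) n B n≤m using (z; z-ord; z-central)
      open Quotient G z p z-ord z-central using (_≈z_; ≈⇒≈z) renaming (group to H)

      B/z : Bicyclic p H a b (suc m) (suc n)
      B/z = record
        { e₁ = e₁ ; e₂ = e₂
        ; dec = λ g → ≈⇒≈z (dec g)
        ; ord-a = 1 , ≈-trans (≈-sym (↑-1 z)) (≈-sym (identityˡ _))
        ; ord-b = ≈⇒≈z ord-b
        ; uniq = uniq/z }
        where
        uniq/z : ∀ i j → (a ↑ i ∙ b ↑ j) ≈z ε → p ^ suc m ∣ i × p ^ suc n ∣ j
        uniq/z i j (k , e) = c-∣ (c-weaken (n∣m*n p) (proj₁ u)) (n∣m*n k) , c⇒∣ (proj₂ u)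
          where
          u : Cong P i (k * p ^ suc m) × Cong Q j 0
          u = uniq² i j (k * p ^ suc m) 0 (≈-trans e (≈-trans (identityˡ _)
            (≈-trans (≈-sym (↑-* a k (p ^ suc m))) (≈-sym (identityʳ _)))))

      module _ (C : CyclicCommutators H a b) (g c : Carrier) (w u : ℕ)
        (cg : c ∙ g ≈ g ∙ (c ∙ (c ↑ (p * w) ∙ z ↑ u)))
        (gen : ∀ k → ∃₂ λ j i → (k ≈z (g ↑ j ∙ c ↑ i))) where
        open CyclicCommutators C hiding (q; cyc; expo; h₁q; h₂q; hom₁; hom₂)

        functional : ∀ {h} → Functional H h → Functional G h
        functional F = record { resp = λ e → Functional.resp F (≈⇒≈z e) ; h-∙ = Functional.h-∙ F }

        expo : ∀ k → k ↑ (p ^ suc L) ≈ ε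
        expo k with CyclicCommutators.expo C k
        ... | l , e = begin
          k ↑ (p * p ^ L)      ≈⟨ ↑-* k p (p ^ L) ⟩
          (k ↑ (p ^ L)) ↑ p    ≈⟨ ↑-cong p (≈-trans e (identityˡ _)) ⟩
          (z ↑ l) ↑ p          ≈⟨ ↑-* z p l ⟨
          z ↑ (p * l)          ≈⟨ ↑-∣ {z} {p} {p * l} z-ord (m∣m*n l) ⟩
          ε                    ∎
          where open R

        instance
          N-nz : NonZero (p ^ suc L)
          N-nz = pow-nz (suc L)

        gen′ : ∀ k → ∃₂ λ j i → ∃ λ l → k ≈ (g ↑ j ∙ c ↑ i) ∙ z ↑ l
        gen′ k = gen k

        open Derived G g c z w u (p ^ suc L) (expo (c ↑ (p * w) ∙ z ↑ u)) z-central cg gen′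

        -- By `cg`, q is a commutator, and the values of h add up in an abelian group.
        kills-q : ∀ {h} → Functional G h → Cong p (h q) 0
        kills-q {h} F = c-+-cancelˡ (h g + h c) (c-trans (c-≡ (+-assoc (h g) (h c) (h q)))
          (c-trans (c-+ (c-refl {x = h g}) (c-sym (h-∙ c q))) (c-trans (c-sym (h-∙ g (c ∙ q)))
            (c-trans (c-sym (resp cg)) (c-trans (h-∙ c g)
              (c-≡ (trans (+-comm (h c) (h g)) (sym (+-identityʳ (h g + h c))))))))))
          where open Functional F

        lifted : CyclicCommutators G a b
        lifted = record
          { q = q ; L = suc L ; expo = expo ; cyc = cyclicDerived
          ; h₁ = h₁ ; h₂ = h₂ ; hom₁ = functional (CyclicCommutators.hom₁ C) ; hom₂ = functional (CyclicCommutators.hom₂ C)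
          ; h₁a = h₁a ; h₁b = h₁b ; h₁q = kills-q (functional (CyclicCommutators.hom₁ C))
          ; h₂a = h₂a ; h₂b = h₂b ; h₂q = kills-q (functional (CyclicCommutators.hom₂ C)) }

      regroup : ∀ {c g} w → (c ∙ g) ≈z (g ∙ c ↑ (1 + p * w)) → ∃ λ u → c ∙ g ≈ g ∙ (c ∙ (c ↑ (p * w) ∙ z ↑ u))
      regroup w (u , e) = u , ≈-trans e (≈-trans (assoc _ _ _) (∙-congˡ (assoc _ _ _)))

      reduce : CyclicCommutators H a b → CyclicCommutators G a b
      reduce C = by-unit (NormalCyclic.unit N)
        where
        N : NormalCyclic H a b
        N = FindNormal.normal H a b m n B/z C
        open NormalCyclic N using (c; norm; I; J)
        by-unit : ¬ p ∣ I ⊎ ¬ p ∣ J → CyclicCommutators G a b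
        by-unit (inj₁ h) = let (u , e) = regroup (proj₁ (norm b)) (proj₂ (norm b)) in
          lifted C b c (proj₁ (norm b)) u e (NormalGen.spanned-b H a b (suc m) (suc n) B/z N h)
        by-unit (inj₂ h) = let (u , e) = regroup (proj₁ (norm a)) (proj₂ (norm a)) in
          lifted C a c (proj₁ (norm a)) u e (NormalGen.spanned-a H a b (suc m) (suc n) B/z N h)

  -- When both orders are p, the socle of ⟨a⟩ is ⟨a⟩ itself. So a is central, G is abelian, and the
  -- exponents are the coordinates.
  elementary : ∀ {G a b} → Bicyclic p G a b 1 1 → CyclicCommutators G a b
  elementary {G} {a} {b} B = record
    { q = ε ; L = 1 ; expo = expo
    ; cyc = record
      { comm = λ g h → 0 , ≈-trans (abelian h g) (∙-congˡ (≈-sym (identityʳ h)))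
      ; norm = λ g → 0 , ≈-trans (identityˡ g) (≈-sym (≈-trans (∙-congˡ (ε↑ (1 + p * 0))) (identityʳ g))) }
    ; h₁ = e₁ ; h₂ = e₂
    ; hom₁ = record { resp = λ e → weak (proj₁ (e-cong e)) ; h-∙ = λ g h → weak (proj₁ (e-∙ g h)) }
    ; hom₂ = record { resp = λ e → weak (proj₂ (e-cong e)) ; h-∙ = λ g h → weak (proj₂ (e-∙ g h)) }
    ; h₁a = weak (proj₁ ea) ; h₁b = weak (proj₁ eb) ; h₁q = weak (proj₁ eε)
    ; h₂a = weak (proj₂ ea) ; h₂b = weak (proj₂ eb) ; h₂q = weak (proj₂ eε) }
    where
    open Powers G
    open BicyclicProps p pr 2<p G a b 1 1 B
    open Socle p pr 2<p G a b 0 0 B z≤n using (z-central)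
    weak : ∀ {x y} → Cong P x y → Cong p x y
    weak = c-weaken (m∣m*n 1)
    a-central : ∀ g → a ∙ g ≈ g ∙ a
    a-central g = ≈-trans (∙-congʳ (≈-sym (↑-1 a))) (≈-trans (z-central g) (∙-congˡ (↑-1 a)))
    b-central : ∀ g → b ∙ g ≈ g ∙ b
    b-central g = ≈-trans (∙-congˡ (dec g)) (≈-trans (≈-sym (comm-∙
      (comm-↑ (e₁ g) (a-central b)) (comm-↑ (e₂ g) ≈-refl))) (∙-congʳ (≈-sym (dec g))))
    abelian : ∀ g h → g ∙ h ≈ h ∙ g
    abelian g h = ≈-trans (∙-congʳ (dec g)) (≈-trans (comm-∙ (comm-↑ (e₁ g) (a-central h)) (comm-↑ (e₂ g) (b-central h)))
      (∙-congˡ (≈-sym (dec g))))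
    expo : ∀ g → g ↑ P ≈ ε
    expo g = ≈-trans (↑-cong P (dec g)) (≈-trans (comm-dist P (abelian _ _))
      (≈-trans (∙-cong (≈-trans (≈-sym (↑-* a P (e₁ g))) (↑-∣ {a} {P} {P * e₁ g} ord-a (m∣m*n (e₁ g))))
                       (≈-trans (≈-sym (↑-* b P (e₂ g))) (↑-∣ {b} {P} {P * e₂ g} ord-b (m∣m*n (e₂ g)))))
        (identityˡ ε)))
    e-∙ : ∀ g h → Cong P (e₁ (g ∙ h)) (e₁ g + e₁ h) × Cong Q (e₂ (g ∙ h)) (e₂ g + e₂ h)
    e-∙ g h = uniq² (e₁ (g ∙ h)) (e₂ (g ∙ h)) (e₁ g + e₁ h) (e₂ g + e₂ h) (begin
      a ↑ e₁ (g ∙ h) ∙ b ↑ e₂ (g ∙ h)                          ≈⟨ dec (g ∙ h) ⟨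
      g ∙ h                                                    ≈⟨ ∙-cong (dec g) (dec h) ⟩
      (a ↑ e₁ g ∙ b ↑ e₂ g) ∙ (a ↑ e₁ h ∙ b ↑ e₂ h)            ≈⟨ ≈-trans (assoc _ _ _) (∙-congˡ (≈-sym (assoc _ _ _))) ⟩
      a ↑ e₁ g ∙ ((b ↑ e₂ g ∙ a ↑ e₁ h) ∙ b ↑ e₂ h)            ≈⟨ ∙-congˡ (∙-congʳ (abelian _ _)) ⟩
      a ↑ e₁ g ∙ ((a ↑ e₁ h ∙ b ↑ e₂ g) ∙ b ↑ e₂ h)            ≈⟨ ≈-trans (∙-congˡ (assoc _ _ _)) (≈-sym (assoc _ _ _)) ⟩
      (a ↑ e₁ g ∙ a ↑ e₁ h) ∙ (b ↑ e₂ g ∙ b ↑ e₂ h)            ≈⟨ ∙-cong (↑-+ a (e₁ g) (e₁ h)) (↑-+ b (e₂ g) (e₂ h)) ⟨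
      a ↑ (e₁ g + e₁ h) ∙ b ↑ (e₂ g + e₂ h)                    ∎)
      where open R
    ea : Cong P (e₁ a) 1 × Cong Q (e₂ a) 0
    ea = uniq² (e₁ a) (e₂ a) 1 0 (≈-trans (≈-sym (dec a)) (≈-trans (≈-sym (↑-1 a)) (≈-sym (identityʳ _))))
    eb : Cong P (e₁ b) 0 × Cong Q (e₂ b) 1
    eb = uniq² (e₁ b) (e₂ b) 0 1 (≈-trans (≈-sym (dec b)) (≈-trans (≈-sym (↑-1 b)) (≈-sym (identityˡ _))))
    eε : Cong P (e₁ ε) 0 × Cong Q (e₂ ε) 0
    eε = uniq² (e₁ ε) (e₂ ε) 0 0 (≈-trans (≈-sym (dec ε)) (≈-sym (identityˡ _)))

  -- The subgroup factored out always lies in a factor of largest order. Outside the base case that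
  -- order is at least p², so neither factor collapses before both have order p.
  cyclicCommutators : ∀ s m n → m + n ≤ s → ∀ G a b → Bicyclic p G a b (suc m) (suc n) → CyclicCommutators G a b
  cyclicCommutators s zero zero _ G a b B = elementary B
  cyclicCommutators (suc s) zero (suc n) (s≤s le) G a b B =
    flipCC (Reduce.reduce G b a n 0 B′ z≤n
      (cyclicCommutators s n 0 (subst (_≤ s) (sym (+-identityʳ n)) le) _ b a (Reduce.B/z G b a n 0 B′ z≤n)))
    where B′ = BicyclicProps.flip p pr 2<p G a b 1 (suc (suc n)) B
  cyclicCommutators (suc s) (suc m) n (s≤s le) G a b B with n ≤? suc m
  ... | yes n≤m = Reduce.reduce G a b m n B n≤m (cyclicCommutators s m n le _ a b (Reduce.B/z G a b m n B n≤m))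
  cyclicCommutators (suc s) (suc m) zero (s≤s le) G a b B | no h = ⊥-elim (h z≤n)
  cyclicCommutators (suc s) (suc m) (suc n) (s≤s le) G a b B | no h =
    flipCC (Reduce.reduce G b a n (suc m) B′ h′
      (cyclicCommutators s n (suc m) (subst (_≤ s) (trans (+-comm m (suc n)) (sym (+-suc n m))) le) _ b a (Reduce.B/z G b a n (suc m) B′ h′)))
    where
    B′ = BicyclicProps.flip p pr 2<p G a b (suc (suc m)) (suc (suc n)) B
    h′ : suc m ≤ suc n
    h′ = <⇒≤ (≰⇒> h)

  abstract
    normalCyclic : ∀ G a b m n → Bicyclic p G a b (suc m) (suc n) → NormalCyclic G a b
    normalCyclic G a b m n B = FindNormal.normal G a b m n B (cyclicCommutators (m + n) m n ≤-refl G a b B)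

-- Presentations

-- The presentations of all three families have the shape
-- ⟨ α , β ∣ α^(p^h) = 1 , β^(p^s) = α^(p^t) , α β = β α^(1 + p^f) ⟩.
hOf sOf tOf fOf : Family → ℕ
hOf (M₁ d e f)   = e
hOf (M₂ d e f)   = d
hOf (M₃ d e h f) = h
sOf (M₁ d e f)   = d
sOf (M₂ d e f)   = e
sOf (M₃ d e h f) = d + e ∸ h
tOf (M₁ d e f)   = e
tOf (M₂ d e f)   = d
tOf (M₃ d e h f) = d
fOf (M₁ d e f)   = f
fOf (M₂ d e f)   = f
fOf (M₃ d e h f) = f

record Rel (p : ℕ) (H : Group 0ℓ 0ℓ) (α β : Group.Carrier H) (h s t f : ℕ) : Set where
  open Powers H
  field
    rel-α : α ↑ (p ^ h) ≈ ε
    rel-β : β ↑ (p ^ s) ≈ α ↑ (p ^ t)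
    rel-c : α ∙ β ≈ β ∙ α ↑ (1 + p ^ f)

RelF : ℕ → (F : Family) (H : Group 0ℓ 0ℓ) (α β : Group.Carrier H) → Set
RelF p F H α β = Rel p H α β (hOf F) (sOf F) (tOf F) (fOf F)

module _ (p : ℕ) (H : Group 0ℓ 0ℓ) where
  open Powers H

  module _ (α β : Carrier) where

    conj⇒ : ∀ {δ} → conj H α β ≈ δ → α ∙ β ≈ β ∙ δ
    conj⇒ {δ} e = begin
      α ∙ β                      ≈⟨ identityˡ _ ⟨
      ε ∙ (α ∙ β)                ≈⟨ ∙-congʳ (inverseʳ β) ⟨
      (β ∙ β ⁻¹) ∙ (α ∙ β)       ≈⟨ assoc _ _ _ ⟩
      β ∙ (β ⁻¹ ∙ (α ∙ β))       ≈⟨ ∙-congˡ (assoc _ _ _) ⟨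
      β ∙ ((β ⁻¹ ∙ α) ∙ β)       ≈⟨ ∙-congˡ e ⟩
      β ∙ δ                      ∎
      where open R

    ⇒conj : ∀ {δ} → α ∙ β ≈ β ∙ δ → conj H α β ≈ δ
    ⇒conj {δ} e = begin
      (β ⁻¹ ∙ α) ∙ β    ≈⟨ assoc _ _ _ ⟩
      β ⁻¹ ∙ (α ∙ β)    ≈⟨ ∙-congˡ e ⟩
      β ⁻¹ ∙ (β ∙ δ)    ≈⟨ assoc _ _ _ ⟨
      (β ⁻¹ ∙ β) ∙ δ    ≈⟨ ∙-congʳ (inverseˡ β) ⟩
      ε ∙ δ             ≈⟨ identityˡ δ ⟩
      δ                 ∎
      where open R

    pow⇒↑ : ∀ g k → pow H g k ≈ g ↑ k
    pow⇒↑ g k = ≈-reflexive (pow≡↑ g k)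

    conj-pow⇒ : ∀ {k} → conj H α β ≈ pow H α k → α ∙ β ≈ β ∙ α ↑ k
    conj-pow⇒ {k} e = conj⇒ (≈-trans e (pow⇒↑ α k))

    ⇒conj-pow : ∀ {k} → α ∙ β ≈ β ∙ α ↑ k → conj H α β ≈ pow H α k
    ⇒conj-pow {k} e = ≈-trans (⇒conj e) (≈-sym (pow⇒↑ α k))

    rels⇒Rel : ∀ F → rels p F H α β → RelF p F H α β
    rels⇒Rel (M₁ d e f) (u , v , w) = let u′ = ≈-trans (≈-sym (pow⇒↑ α (p ^ e))) u in record
      { rel-α = u′
      ; rel-β = ≈-trans (≈-trans (≈-sym (pow⇒↑ β (p ^ d))) v) (≈-sym u′) ; rel-c = conj-pow⇒ {1 + p ^ f} w }
    rels⇒Rel (M₂ d e f) (u , v , w) = let u′ = ≈-trans (≈-sym (pow⇒↑ α (p ^ d))) u in record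
      { rel-α = u′
      ; rel-β = ≈-trans (≈-trans (≈-sym (pow⇒↑ β (p ^ e))) v) (≈-sym u′) ; rel-c = conj-pow⇒ {1 + p ^ f} w }
    rels⇒Rel (M₃ d e h f) (u , v , w) = record
      { rel-α = ≈-trans (≈-sym (pow⇒↑ α (p ^ h))) u
      ; rel-β = ≈-trans (≈-sym (pow⇒↑ β (p ^ (d + e ∸ h)))) (≈-trans v (pow⇒↑ α (p ^ d))) ; rel-c = conj-pow⇒ {1 + p ^ f} w }

    Rel⇒rels : ∀ F → RelF p F H α β → rels p F H α β
    Rel⇒rels (M₁ d e f) record { rel-α = u ; rel-β = v ; rel-c = w } =
      ≈-trans (pow⇒↑ α (p ^ e)) u , ≈-trans (pow⇒↑ β (p ^ d)) (≈-trans v u) , ⇒conj-pow {1 + p ^ f} w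
    Rel⇒rels (M₂ d e f) record { rel-α = u ; rel-β = v ; rel-c = w } =
      ≈-trans (pow⇒↑ α (p ^ d)) u , ≈-trans (pow⇒↑ β (p ^ e)) (≈-trans v u) , ⇒conj-pow {1 + p ^ f} w
    Rel⇒rels (M₃ d e h f) record { rel-α = u ; rel-β = v ; rel-c = w } =
      ≈-trans (pow⇒↑ α (p ^ h)) u , ≈-trans (pow⇒↑ β (p ^ (d + e ∸ h))) (≈-trans v (≈-sym (pow⇒↑ α (p ^ d)))) ,
      ⇒conj-pow {1 + p ^ f} w

module _ (p : ℕ) {{p-nz : NonZero p}} (H : Group 0ℓ 0ℓ) where
  open Powers H

  module NormalForm (α β : Carrier) (h s t f : ℕ) (r : Rel p H α β h s t f) where
    open Rel r public

    nf : ℕ → ℕ → Carrier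
    nf j i = β ↑ j ∙ α ↑ i

    private instance
      P-nz : NonZero (p ^ h)
      P-nz = m^n≢0 p h

    nf-∙ : ∀ j i k l → nf j i ∙ nf k l ≈ nf (j + k) (i * (1 + p ^ f) ^ k + l)
    nf-∙ j i k l = nf-∙′ (1 + p ^ f) rel-c
      where
      nf-∙′ : ∀ v → α ∙ β ≈ β ∙ α ↑ v → nf j i ∙ nf k l ≈ nf (j + k) (i * v ^ k + l)
      nf-∙′ v e = begin
        (β ↑ j ∙ α ↑ i) ∙ (β ↑ k ∙ α ↑ l)            ≈⟨ msolve monoid ⟩
        β ↑ j ∙ ((α ↑ i ∙ β ↑ k) ∙ α ↑ l)            ≈⟨ ∙-congˡ (∙-congʳ (skew² {v = v} i k e)) ⟩
        β ↑ j ∙ ((β ↑ k ∙ α ↑ (i * v ^ k)) ∙ α ↑ l)  ≈⟨ msolve monoid ⟩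
        (β ↑ j ∙ β ↑ k) ∙ (α ↑ (i * v ^ k) ∙ α ↑ l)  ≈⟨ ∙-cong (↑-+ β j k) (↑-+ α (i * v ^ k) l) ⟨
        β ↑ (j + k) ∙ α ↑ (i * v ^ k + l)            ∎
        where open R

    nf-trivial : ∀ {j i} j′ → j ≡ p ^ s * j′ → p ^ h ∣ p ^ t * j′ + i → nf j i ≈ ε
    nf-trivial {_} {i} j′ refl d = begin
      β ↑ (p ^ s * j′) ∙ α ↑ i    ≈⟨ ∙-congʳ (↑-*′ β (p ^ s) j′) ⟩
      (β ↑ (p ^ s)) ↑ j′ ∙ α ↑ i  ≈⟨ ∙-congʳ (↑-cong j′ rel-β) ⟩
      (α ↑ (p ^ t)) ↑ j′ ∙ α ↑ i  ≈⟨ ∙-congʳ (↑-*′ α (p ^ t) j′) ⟨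
      α ↑ (p ^ t * j′) ∙ α ↑ i    ≈⟨ ↑-+ α (p ^ t * j′) i ⟨
      α ↑ (p ^ t * j′ + i)        ≈⟨ ↑-∣ rel-α d ⟩
      ε                           ∎
      where open R

    α-transfer : ∀ {γ} i l → γ ∙ α ↑ i ≈ α ↑ l → γ ∙ α ↑ (i + l * pred (p ^ h)) ≈ ε
    α-transfer i l e = ≈-trans (∙-congˡ (↑-+ α i (l * pred (p ^ h)))) (≈-trans (≈-sym (assoc _ _ _))
      (≈-trans (∙-congʳ e) (↑-inv l rel-α)))

    α-transfer′ : ∀ {γ} i l → γ ∙ α ↑ (i + l * pred (p ^ h)) ≈ ε → γ ∙ α ↑ i ≈ α ↑ l
    α-transfer′ {γ} i l e = begin
      γ ∙ α ↑ i                                         ≈⟨ identityʳ _ ⟨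
      (γ ∙ α ↑ i) ∙ ε                                   ≈⟨ ∙-congˡ (↑-inv′ l rel-α) ⟨
      (γ ∙ α ↑ i) ∙ (α ↑ (l * pred (p ^ h)) ∙ α ↑ l)    ≈⟨ ≈-trans (assoc _ _ _) (≈-trans (∙-congˡ (≈-sym (assoc _ _ _))) (≈-sym (assoc _ _ _))) ⟩
      (γ ∙ (α ↑ i ∙ α ↑ (l * pred (p ^ h)))) ∙ α ↑ l    ≈⟨ ∙-congʳ (∙-congˡ (↑-+ α i (l * pred (p ^ h)))) ⟨
      (γ ∙ α ↑ (i + l * pred (p ^ h))) ∙ α ↑ l          ≈⟨ ∙-congʳ e ⟩
      ε ∙ α ↑ l                                         ≈⟨ identityˡ _ ⟩
      α ↑ l                                             ∎
      where open R

module _ (p : ℕ) {{p-nz : NonZero p}} (G : Group 0ℓ 0ℓ) where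
  open Powers G

  -- The hypothesis `exact` says that the defining relations account for every relation between
  -- powers of β and α. Together with `spanned` it yields the universal property directly, without a
  -- comparison of orders with an abstractly presented group.
  module Presentation (α β : Carrier) (h s t f : ℕ) (r : Rel p G α β h s t f)
      (spanned : ∀ g → ∃₂ λ j i → g ≈ β ↑ j ∙ α ↑ i)
      (exact : ∀ j i → β ↑ j ∙ α ↑ i ≈ ε → ∃ λ j′ → j ≡ p ^ s * j′ × p ^ h ∣ p ^ t * j′ + i) where
    open NormalForm p G α β h s t f r using (nf; nf-∙; α-transfer)

    powWord : Word G → ℕ → Word G
    powWord w zero    = one
    powWord w (suc k) = mul w (powWord w k)

    eval-powWord : ∀ w k → eval G α β (powWord w k) ≈ eval G α β w ↑ k
    eval-powWord w zero    = ≈-refl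
    eval-powWord w (suc k) = ∙-congˡ (eval-powWord w k)

    jOf iOf : Carrier → ℕ
    jOf g = proj₁ (spanned g)
    iOf g = proj₁ (proj₂ (spanned g))

    nf-eq : ∀ g → g ≈ nf (jOf g) (iOf g)
    nf-eq g = proj₂ (proj₂ (spanned g))

    module Universal (H : Group 0ℓ 0ℓ) (α′ β′ : Group.Carrier H) (r′ : Rel p H α′ β′ h s t f) where
      private module H = Powers H
      module N′ = NormalForm p H α′ β′ h s t f r′

      -- Cancelling the common power of β leaves β^d αⁱ = α^l; once α^l is moved to the left this
      -- has the form that `exact` treats.
      well-defined-≤ : ∀ k l i d → nf (k + d) i ≈ nf k l → N′.nf (k + d) i H.≈ N′.nf k l
      well-defined-≤ k l i d e = H.≈-trans (H.∙-congʳ (H.↑-+ β′ k d)) (H.≈-trans (H.assoc _ _ _)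
        (H.∙-congˡ (N′.α-transfer′ i l (N′.nf-trivial {d} {i + l * pred (p ^ h)} (proj₁ ex) (proj₁ (proj₂ ex)) (proj₂ (proj₂ ex))))))
        where
        ex : ∃ λ j′ → d ≡ p ^ s * j′ × p ^ h ∣ p ^ t * j′ + (i + l * pred (p ^ h))
        ex = exact d (i + l * pred (p ^ h)) (α-transfer i l (∙-cancelˡ (β ↑ k) _ _
          (≈-trans (≈-sym (assoc _ _ _)) (≈-trans (∙-congʳ (≈-sym (↑-+ β k d))) e))))

      well-defined : ∀ j i k l → nf j i ≈ nf k l → N′.nf j i H.≈ N′.nf k l
      well-defined j i k l e with ≤-total k j
      ... | inj₁ k≤j = subst (λ j → N′.nf j i H.≈ N′.nf k l) (m+[n∸m]≡n k≤j)
            (well-defined-≤ k l i (j ∸ k) (subst (λ j → nf j i ≈ nf k l) (sym (m+[n∸m]≡n k≤j)) e))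
      ... | inj₂ j≤k = H.≈-sym (subst (λ k → N′.nf k l H.≈ N′.nf j i) (m+[n∸m]≡n j≤k)
            (well-defined-≤ j i l (k ∸ j) (subst (λ k → nf k l ≈ nf j i) (sym (m+[n∸m]≡n j≤k)) (≈-sym e))))

      φ : Carrier → H.Carrier
      φ g = N′.nf (jOf g) (iOf g)

      φ-nf : ∀ {g} j i → g ≈ nf j i → φ g H.≈ N′.nf j i
      φ-nf {g} j i e = well-defined (jOf g) (iOf g) j i (≈-trans (≈-sym (nf-eq g)) e)

      φ-ε : φ ε H.≈ H.ε
      φ-ε = H.≈-trans (φ-nf 0 0 (≈-sym (identityˡ ε))) (H.identityˡ _)

      φ-∙ : ∀ g k → φ (g ∙ k) H.≈ φ g H.∙ φ k
      φ-∙ g k = H.≈-trans (φ-nf (jOf g + jOf k) (iOf g * (1 + p ^ f) ^ jOf k + iOf k)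
          (≈-trans (∙-cong (nf-eq g) (nf-eq k)) (nf-∙ (jOf g) (iOf g) (jOf k) (iOf k))))
        (H.≈-sym (N′.nf-∙ (jOf g) (iOf g) (jOf k) (iOf k)))

      φ-cong : ∀ {g k} → g ≈ k → φ g H.≈ φ k
      φ-cong {g} {k} e = φ-nf (jOf k) (iOf k) (≈-trans e (nf-eq k))

      φ-hom : GroupMorphisms.IsGroupHomomorphism (Group.rawGroup G) (Group.rawGroup H) φ
      φ-hom = record
        { isMonoidHomomorphism = record
          { isMagmaHomomorphism = record
            { isRelHomomorphism = record { cong = φ-cong }
            ; homo = φ-∙ }
          ; ε-homo = φ-ε }
        ; ⁻¹-homo = λ g → inverseˡ-unique (φ (g ⁻¹)) (φ g)
            (H.≈-trans (H.≈-sym (φ-∙ (g ⁻¹) g)) (H.≈-trans (φ-cong (inverseˡ g)) φ-ε)) }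
        where open GroupProperties H using (inverseˡ-unique)

    induced : (H : Group 0ℓ 0ℓ) (α′ β′ : Group.Carrier H) → Rel p H α′ β′ h s t f →
      Σ (Carrier → Group.Carrier H) λ φ → GroupMorphisms.IsGroupHomomorphism (Group.rawGroup G) (Group.rawGroup H) φ
        × Group._≈_ H (φ α) α′ × Group._≈_ H (φ β) β′
    induced H α′ β′ r′ = φ , φ-hom ,
        H.≈-trans (φ-nf 0 1 (≈-trans (≈-sym (↑-1 α)) (≈-sym (identityˡ _)))) (H.≈-trans (H.identityˡ _) (H.↑-1 α′)) ,
        H.≈-trans (φ-nf 1 0 (≈-trans (≈-sym (↑-1 β)) (≈-sym (identityʳ _)))) (H.≈-trans (H.identityʳ _) (H.↑-1 β′))
      where
      open Universal H α′ β′ r′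
      module H = Powers H

    presents : ∀ F → hOf F ≡ h → sOf F ≡ s → tOf F ≡ t → fOf F ≡ f → Presents G (rels p F)
    presents F refl refl refl refl = α , β , Rel⇒rels p G α β F r ,
      (λ g → mul (powWord gen-b (jOf g)) (powWord gen-a (iOf g)) ,
        ≈-trans (∙-cong (eval-powWord gen-b (jOf g)) (eval-powWord gen-a (iOf g))) (≈-sym (nf-eq g))) ,
      λ H α′ β′ r′ → induced H α′ β′ (rels⇒Rel p H α′ β′ F r′)

-- Classification of the exact products

module Classify (p : ℕ) (pr : Prime p) (2<p : 2 < p) where
  open Arith p pr 2<p
  open CyclicNormal p pr 2<p
  open Reduction p pr 2<p

  Result : Group 0ℓ 0ℓ → ℕ → ℕ → Set₁
  Result G d e = Σ Family λ F → Admissible F × dOf F ≡ d × eOf F ≡ e × Presents G (rels p F)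

  ^-∣⇒≤ : ∀ {m k} → p ^ m ∣ p ^ k → m ≤ k
  ^-∣⇒≤ {m} {k} d with m ≤? k
  ... | yes q = q
  ... | no h  = ⊥-elim (p∤1 (*-cancelʳ-∣ (p ^ k) {{pow-nz k}}
    (subst (p * p ^ k ∣_) (sym (*-identityˡ (p ^ k))) (∣-trans (^-∣ p (≰⇒> h)) d))))

  ∤-of-inverse : ∀ {M x w} → p ∣ M → Cong M (x * w) 1 → ¬ p ∣ w
  ∤-of-inverse {x = x} d c h = p∤1 (c-∣ (c-sym (c-weaken d c)) (∣n⇒∣m*n x h))

  record Normalised (G : Group 0ℓ 0ℓ) (c g : Group.Carrier G) (h : ℕ) : Set where
    open Powers G
    field
      f k  : ℕ
      f<h  : f < h
      p∤k  : ¬ p ∣ k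
      rel  : c ∙ g ↑ k ≈ g ↑ k ∙ c ↑ (1 + p ^ suc f)

  module _ (G : Group 0ℓ 0ℓ) where
    open Powers G

    abstract
      normalise : ∀ c g h w → 1 ≤ h → c ↑ (p ^ h) ≈ ε → c ∙ g ≈ g ∙ c ↑ (1 + p * w) → Normalised G c g h
      normalise c g (suc h) w 1≤h ord e = by-val (val (suc h) (p * w))
        where
        by-val : p ^ suc h ∣ p * w ⊎ (∃₂ λ k I → k < suc h × p * w ≡ p ^ k * I × ¬ p ∣ I) → Normalised G c g (suc h)
        -- The action on ⟨c⟩ is trivial and is recorded by the largest exponent allowed, since c is
        -- killed by p^(h+1).
        by-val (inj₁ d) = record { f = h ; k = 1 ; f<h = ≤-refl ; p∤k = p∤1
          ; rel = ≈-trans (∙-congˡ (↑-1 g)) (≈-trans e (∙-cong (≈-sym (↑-1 g))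
              (↑-mod {c} {p ^ suc h} {1 + p * w} {1 + p ^ suc h} ord (c-trans (∣⇒c+ʳ 1 d) (c-sym (∣⇒c+ʳ 1 ∣-refl)))))) }
        by-val (inj₂ (zero , I , _ , eq , p∤I)) = ⊥-elim (p∤I (subst (p ∣_) (trans eq (*-identityˡ I)) (m∣m*n w)))
        by-val (inj₂ (suc f , I , f<h , eq , p∤I)) = record { f = f ; k = proj₁ D ; f<h = <⇒≤ f<h ; p∤k = proj₁ (proj₂ D)
          ; rel = ≈-trans (skew¹ {v = 1 + p * w} (proj₁ D) e) (∙-congˡ
              (↑-mod {c} {p ^ suc h} {(1 + p * w) ^ proj₁ D} {1 + p ^ suc f} ord
                (subst₂ (λ M z → Cong (p ^ M) ((1 + z) ^ proj₁ D) (1 + p ^ suc f)) (m∸n+n≡m (<⇒≤ f<h)) (sym eq) (proj₂ (proj₂ D))))) }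
          where
          D : DLog f I (suc h ∸ suc f)
          D = dlog f I p∤I (suc h ∸ suc f)

      -- The power β^(p^n) acts on ⟨α⟩ as (1 + p^(f+1))^(p^n) and also trivially; the exact
      -- valuation of that power minus 1 gives the bound.
      order-bound : ∀ α β h f n → (∀ i → α ↑ i ≈ ε → p ^ h ∣ i) → β ↑ (p ^ n) ≈ ε →
        α ∙ β ≈ β ∙ α ↑ (1 + p ^ suc f) → h ≤ suc f + n
      order-bound α β h f n exact ord e = lte-bound f 1 n h p∤1
        (c-trans (c-≡ (trans (cong (λ z → (1 + z) ^ (p ^ n)) (*-identityʳ (p ^ suc f))) (proj₂ V)))
          (∣⇒c+ʳ 1 (exact (proj₁ V) (≈-sym (∙-cancelˡ α _ _ (≈-trans (identityʳ α) eq))))))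
        where
        V : ∃ λ k → (1 + p ^ suc f) ^ (p ^ n) ≡ suc k
        V = pos-suc ((1 + p ^ suc f) ^ (p ^ n)) {{m^n≢0 (1 + p ^ suc f) (p ^ n)}}
        eq : α ≈ α ∙ α ↑ proj₁ V
        eq = ≈-trans (≈-trans (≈-sym (identityʳ α)) (≈-trans (∙-congˡ (≈-sym ord)) (skew¹ {v = 1 + p ^ suc f} (p ^ n) e)))
          (≈-trans (∙-congʳ ord) (≈-trans (identityˡ _) (↑-≡ α (proj₂ V))))

      unit-root : ∀ L (g : Carrier) r → g ↑ (p ^ L) ≈ ε → ¬ p ∣ r → ∃ λ u → ¬ p ∣ u × (∀ k → g ↑ k ≈ (g ↑ (k * r)) ↑ u)
      unit-root L g r ord p∤r = proj₁ I , ∤-of-inverse {x = r} (m∣m*n (p ^ L)) (proj₂ I) , λ k →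
        ≈-trans (↑-mod {g} {p ^ suc L} {k} {k * r * proj₁ I} (≈-trans (↑-* g p (p ^ L)) (≈-trans (↑-cong p ord) (ε↑ p)))
          (c-trans (c-≡ (sym (*-identityʳ k))) (c-trans (c-*ˡ k (c-sym (proj₂ I))) (c-≡ (sym (*-assoc k r (proj₁ I)))))))
          (↑-*′ g (k * r) (proj₁ I))
        where
        I : ∃ λ w → Cong (p ^ suc L) (r * w) 1
        -- The modulus p^(L+1) rather than p^L is divisible by p even for L = 0, which makes the
        -- inverse prime to p.
        I = inv-mod (suc L) r p∤r

  M₁-admissible : ∀ n m f → f < suc m → n ≤ m → suc m ≤ suc n + suc f → Admissible (M₁ (suc n) (suc m) (suc f))
  M₁-admissible n m f f<h n≤m bound with n ≤? f
  ... | yes n≤f = inj₁ (s≤s z≤n , s≤s n≤f , f<h , bound)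
  ... | no  n≰f = inj₂ (s≤s z≤n , s≤s (≰⇒> n≰f) , s≤s n≤m , bound)

  module _ (G : Group 0ℓ 0ℓ) where
    open Powers G

    M₁-result : ∀ c b m n → Bicyclic p G c b (suc m) (suc n) → n ≤ m → ∀ v → c ∙ b ≈ b ∙ c ↑ v →
      Result G (suc n) (suc m)
    M₁-result c b m n B n≤m v e = M₁ (suc n) (suc m) (suc f) , adm , refl , refl ,
      Presentation.presents p G c (b ↑ k) (suc m) (suc n) (suc m) (suc f) relG spanned exact (M₁ (suc n) (suc m) (suc f)) refl refl refl refl
      where
      open BicyclicProps p pr 2<p G c b (suc m) (suc n) B
      -- From b^Q = 1 follows v^Q = 1 modulo p, while Fermat gives v^Q = v because Q is a power of
      -- p.
      v≡1 : Cong p v 1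
      v≡1 = c-sym (c-trans (c-weaken (m∣m*n (p ^ m)) (a-exp {1} {v ^ Q} (≈-trans (↑-1 c) (≈-trans (≈-sym (identityʳ c))
        (≈-trans (∙-congˡ (≈-sym ord-b)) (≈-trans (skew¹ {v = v} Q e) (≈-trans (∙-congʳ ord-b) (identityˡ _)))))))) (fermat^ (suc n) v))
      N : Normalised G c b (suc m)
      N = normalise G c b (suc m) (proj₁ (cong-1 v≡1)) (s≤s z≤n) ord-a
            (≈-trans e (∙-congˡ (↑-≡ c (proj₂ (cong-1 v≡1)))))
      open Normalised N
      bk-ord : (b ↑ k) ↑ Q ≈ ε
      bk-ord = ≈-trans (≈-sym (↑-*′ b k Q)) (↑-ε Q k ord-b)
      relG : Rel p G c (b ↑ k) (suc m) (suc n) (suc m) (suc f)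
      relG = record { rel-α = ord-a ; rel-β = ≈-trans bk-ord (≈-sym ord-a) ; rel-c = rel }
      open Span G c (b ↑ k) (1 + p ^ suc f) rel
      spanned : ∀ g → InSpan g
      spanned g = span-≈ (dec g) (span-∙ (span-c (e₁ g)) (span-↑ (e₂ g) (span-≈ b≈ (span-g (proj₁ (inv-mod (suc n) k p∤k))))))
        where
        w = proj₁ (inv-mod (suc n) k p∤k)
        b≈ : b ≈ (b ↑ k) ↑ w
        b≈ = ≈-trans (≈-sym (↑-1 b)) (≈-trans (↑-mod {b} {Q} {1} {k * w} ord-b (c-sym (proj₂ (inv-mod (suc n) k p∤k)))) (↑-*′ b k w))
      exact : ∀ j i → (b ↑ k) ↑ j ∙ c ↑ i ≈ ε → ∃ λ j′ → j ≡ Q * j′ × P ∣ P * j′ + i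
      exact j i e = _∣_.quotient dj , m∣n⇒n≡m*quotient dj , ∣m∣n⇒∣m+n (m∣m*n _) (proj₂ u)
        where
        u : Q ∣ k * j × P ∣ i
        u = Bicyclic.uniq flip (k * j) i (≈-trans (∙-congʳ (↑-*′ b k j)) e)
        dj : Q ∣ j
        dj = cancel-unit (suc n) p∤k (subst (Q ∣_) (*-comm k j) (proj₁ u))
      bound : suc m ≤ suc n + suc f
      bound = subst (suc m ≤_) (+-comm (suc f) (suc n)) (order-bound G c (b ↑ k) (suc m) f (suc n) (λ i → a-exp-∣ {i}) bk-ord rel)
      adm : Admissible (M₁ (suc n) (suc m) (suc f))
      adm = M₁-admissible n m f f<h n≤m bound

  module _ (G : Group 0ℓ 0ℓ) where
    open Powers G

    module Cases (a b : Carrier) (m n : ℕ) (B : Bicyclic p G a b (suc m) (suc n)) (n≤m : n ≤ m)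
        (NC : NormalCyclic G a b) where
      open BicyclicProps p pr 2<p G a b (suc m) (suc n) B
      open NormalCyclic NC
      open NormalGen G a b (suc m) (suc n) B NC

      root : ∀ k → ∃₂ λ u r → ¬ p ∣ u × ¬ p ∣ r × c ↑ (p ^ k * r) ≈ a ↑ (p ^ k * I) ∙ b ↑ (p ^ k * J) ×
        c ↑ (p ^ k) ≈ (a ↑ (p ^ k * I) ∙ b ↑ (p ^ k * J)) ↑ u
      root k = proj₁ U , r , proj₁ (proj₂ U) , p∤r , proj₂ (pc k) ,
        ≈-trans (proj₂ (proj₂ U) (p ^ k)) (↑-cong (proj₁ U) (proj₂ (pc k)))
        where
        r = 1 + p * proj₁ (pc k)
        p∤r : ¬ p ∣ r
        p∤r = c-∤ (∣⇒c+ʳ 1 (m∣m*n (proj₁ (pc k)))) p∤1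
        U = unit-root G L c r (expo c) p∤r

      -- Exponents of equal valuation generate the same subgroup of ⟨c⟩. So if c^(p^k I′) lies in
      -- ⟨a⟩ or ⟨b⟩, the element on the left does too, and there uniqueness of coordinates decides.
      from-multiple : ∀ k I′ → ¬ p ∣ I′ → ∃ λ r → a ↑ (p ^ k * I) ∙ b ↑ (p ^ k * J) ≈ (c ↑ (p ^ k * I′)) ↑ r
      from-multiple k I′ h = via (root k) (unit-root G L c I′ (expo c) h)
        where
        via : _ → _ → ∃ λ r → a ↑ (p ^ k * I) ∙ b ↑ (p ^ k * J) ≈ (c ↑ (p ^ k * I′)) ↑ r
        via (_ , r , _ , _ , e , _) (u , _ , f) = u * r , ≈-trans (≈-sym e) (≈-trans (↑-*′ c (p ^ k) r)
          (≈-trans (↑-cong r (f (p ^ k))) (≈-sym (↑-*′ (c ↑ (p ^ k * I′)) u r))))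

      -- With I prime to p, the a-coordinate shows that c has the order of a and that no non-trivial
      -- power of c lies in ⟨b⟩: G is the semidirect product of ⟨c⟩ by ⟨b⟩.
      case-I : ¬ p ∣ I → Result G (suc n) (suc m)
      case-I h = M₁-result G c b m n (BicyclicProps.flip p pr 2<p G b c (suc n) (suc m) Bc) n≤m (1 + p * proj₁ (norm b)) (proj₂ (norm b))
        where
        c-ord : c ↑ P ≈ ε
        c-ord = via (root (suc m))
          where
          via : _ → c ↑ P ≈ ε
          via (u , _ , _ , _ , _ , e) = ≈-trans e (≈-trans (↑-cong u (≈-trans (∙-cong (↑-∣ {a} {P} {P * I} ord-a (m∣m*n I))
            (↑-∣ {b} {Q} {P * J} ord-b (∣m⇒∣m*n J (^-∣ p (s≤s n≤m))))) (identityˡ ε))) (ε↑ u))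
        uniq-bc : ∀ j i → b ↑ j ∙ c ↑ i ≈ ε → Q ∣ j × P ∣ i
        uniq-bc j i e = by-val (val (suc m) i)
          where
          ci : c ↑ i ≈ b ↑ (j * pred Q)
          ci = ∙-cancelˡ (b ↑ j) _ _ (≈-trans e (≈-sym (↑-inv j ord-b)))
          by-val : P ∣ i ⊎ (∃₂ λ k I′ → k < suc m × i ≡ p ^ k * I′ × ¬ p ∣ I′) → Q ∣ j × P ∣ i
          by-val (inj₁ d) = b-exp-∣ {j} (≈-trans (≈-sym (identityʳ _)) (≈-trans (∙-congˡ (≈-sym (↑-∣ c-ord d))) e)) , d
          by-val (inj₂ (k , I′ , k<m , refl , p∤I′)) = ⊥-elim (<⇒≱ k<m (^-∣⇒≤ (cancel-unit (suc m) h
            (c⇒∣ (proj₁ (uniq² (p ^ k * I) (p ^ k * J) 0 (j * pred Q * r)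
              (≈-trans (proj₂ fm) (≈-trans (↑-cong r ci) (≈-trans (≈-sym (↑-*′ b (j * pred Q) r)) (≈-sym (identityˡ _)))))))))))
            where
            fm = from-multiple k I′ p∤I′
            r = proj₁ fm
        Bc : Bicyclic p G b c (suc n) (suc m)
        Bc = record
          { e₁ = λ g → proj₁ (spanned-b h g) ; e₂ = λ g → proj₁ (proj₂ (spanned-b h g))
          ; dec = λ g → proj₂ (proj₂ (spanned-b h g)) ; ord-a = ord-b ; ord-b = c-ord ; uniq = uniq-bc }

module _ (p : ℕ) (pr : Prime p) (2<p : 2 < p) (G : Group 0ℓ 0ℓ) where
  open Powers G

  module CaseJ (a b : Carrier) (m n : ℕ) (B : Bicyclic p G a b (suc m) (suc n)) (n≤m : n ≤ m)
      (NC : CyclicNormal.NormalCyclic p pr 2<p G a b) (p∣I : p ∣ CyclicNormal.NormalCyclic.I NC)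
      (p∤J : ¬ p ∣ CyclicNormal.NormalCyclic.J NC) where
    open Arith p pr 2<p
    open CyclicNormal p pr 2<p
    open Classify p pr 2<p
    open Cases G a b m n B n≤m NC
    open BicyclicProps p pr 2<p G a b (suc m) (suc n) B
    open NormalCyclic NC
    open NormalGen G a b (suc m) (suc n) B NC

    u : ℕ
    u = proj₁ (root (suc n))

    p∤u : ¬ p ∣ u
    p∤u = proj₁ (proj₂ (proj₂ (root (suc n))))

    -- At the exponent Q the b-coordinate disappears. By `uniq-c` no smaller power of p brings c
    -- into ⟨a⟩, so ⟨a⟩ and ⟨c⟩ meet exactly in ⟨c^Q⟩.
    cQ : c ↑ Q ≈ a ↑ (Q * I * u)
    cQ = ≈-trans (proj₂ (proj₂ (proj₂ (proj₂ (proj₂ (root (suc n)))))))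
      (≈-trans (↑-cong u (≈-trans (∙-congˡ (↑-∣ {b} {Q} {Q * J} ord-b (m∣m*n J))) (identityʳ _))) (≈-sym (↑-*′ a (Q * I) u)))

    uniq-c : ∀ j i → a ↑ j ∙ c ↑ i ≈ ε → Q ∣ i
    uniq-c j i e = by-val (val (suc n) i)
      where
      ci : c ↑ i ≈ a ↑ (j * pred P)
      ci = ∙-cancelˡ (a ↑ j) _ _ (≈-trans e (≈-sym (↑-inv j ord-a)))
      by-val : Q ∣ i ⊎ (∃₂ λ k I′ → k < suc n × i ≡ p ^ k * I′ × ¬ p ∣ I′) → Q ∣ i
      by-val (inj₁ d) = d
      by-val (inj₂ (k , I′ , k<n , refl , p∤I′)) = ⊥-elim (<⇒≱ k<n (^-∣⇒≤ (cancel-unit (suc n) p∤J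
        (c⇒∣ (proj₂ (uniq² (p ^ k * I) (p ^ k * J) (j * pred P * r) 0
          (≈-trans (proj₂ fm) (≈-trans (↑-cong r ci) (≈-trans (≈-sym (↑-*′ a (j * pred P) r)) (≈-sym (identityʳ _)))))))))))
        where
        fm = from-multiple k I′ p∤I′
        r : ℕ
        r = proj₁ fm

    -- If [c, aᵏ] ∈ ⟨c^(p^n)⟩ ⊆ ⟨a⟩, then c, hence G, normalises ⟨a⟩.
    a-normal : ∀ k D → ¬ p ∣ k → Q ∣ D → c ∙ a ↑ k ≈ a ↑ k ∙ c ↑ (1 + D) → ∃ λ v → a ∙ b ≈ b ∙ a ↑ v
    a-normal k D p∤k (divides g refl) e = v ^ w′ , (begin
      a ∙ b                       ≈⟨ ∙-congˡ (b≈ p∤J) ⟩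
      a ∙ (b ↑ J) ↑ w′            ≈⟨ skew¹ {v = v} w′ abJ ⟩
      (b ↑ J) ↑ w′ ∙ a ↑ (v ^ w′) ≈⟨ ∙-congʳ (b≈ p∤J) ⟨
      b ∙ a ↑ (v ^ w′)            ∎)
      where
      open R
      w′ = proj₁ (inv-mod (suc n) J p∤J)
      w : ℕ
      w = proj₁ (inv-mod (suc m) k p∤k)
      s : ℕ
      s = Q * I * u * g
      cD : c ↑ (g * Q) ≈ a ↑ s
      cD = ≈-trans (↑-* c g Q) (≈-trans (↑-cong g cQ) (≈-sym (↑-*′ a (Q * I * u) g)))
      s′ : ℕ
      s′ = s * pred P
      akc : a ↑ k ∙ c ≈ c ∙ a ↑ (k + s′)
      akc = begin
        a ↑ k ∙ c                           ≈⟨ identityʳ _ ⟨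
        (a ↑ k ∙ c) ∙ ε                     ≈⟨ ∙-congˡ (↑-inv s ord-a) ⟨
        (a ↑ k ∙ c) ∙ (a ↑ s ∙ a ↑ s′)      ≈⟨ ≈-trans (≈-sym (assoc _ _ _)) (∙-congʳ (assoc _ _ _)) ⟩
        (a ↑ k ∙ (c ∙ a ↑ s)) ∙ a ↑ s′      ≈⟨ ∙-congʳ (≈-trans e (∙-congˡ (∙-congˡ cD))) ⟨
        (c ∙ a ↑ k) ∙ a ↑ s′                ≈⟨ assoc _ _ _ ⟩
        c ∙ (a ↑ k ∙ a ↑ s′)                ≈⟨ ∙-congˡ (↑-+ a k s′) ⟨
        c ∙ a ↑ (k + s′)                    ∎
      v : ℕ
      v = (k + s′) * w
      a≈ak : a ≈ (a ↑ k) ↑ w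
      a≈ak = ≈-trans (≈-sym (↑-1 a)) (≈-trans (↑-mod {a} {P} {1} {k * w} ord-a (c-sym (proj₂ (inv-mod (suc m) k p∤k)))) (↑-*′ a k w))
      ac : a ∙ c ≈ c ∙ a ↑ v
      ac = ≈-trans (∙-congʳ a≈ak) (≈-trans (conj-↑ w akc) (∙-congˡ (≈-sym (↑-*′ a (k + s′) w))))
      abJ : a ∙ b ↑ J ≈ b ↑ J ∙ a ↑ v
      abJ = begin
        a ∙ b ↑ J                        ≈⟨ ∙-congˡ b^J≈ ⟩
        a ∙ (a ↑ (I * pred P) ∙ c)       ≈⟨ assoc _ _ _ ⟨
        (a ∙ a ↑ (I * pred P)) ∙ c       ≈⟨ ∙-congʳ (comm-↑ (I * pred P) ≈-refl) ⟨
        (a ↑ (I * pred P) ∙ a) ∙ c       ≈⟨ assoc _ _ _ ⟩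
        a ↑ (I * pred P) ∙ (a ∙ c)       ≈⟨ ∙-congˡ ac ⟩
        a ↑ (I * pred P) ∙ (c ∙ a ↑ v)   ≈⟨ assoc _ _ _ ⟨
        (a ↑ (I * pred P) ∙ c) ∙ a ↑ v   ≈⟨ ∙-congʳ b^J≈ ⟨
        b ↑ J ∙ a ↑ v                    ∎

    -- For f + 1 ≥ d the commutator of c and a^k lies in ⟨c^Q⟩ and so in ⟨a⟩. Then ⟨a⟩ is normal
    -- with complement ⟨b⟩, which is the first family, regardless of how ⟨c⟩ and ⟨a⟩ meet.
    large-f : ∀ {h} (N : Normalised G c a h) → n ≤ Normalised.f N → Result G (suc n) (suc m)
    large-f N n≤f = M₁-result G a b m n B n≤m (proj₁ an) (proj₂ an)
      where
      open Normalised N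
      an : ∃ λ v → a ∙ b ≈ b ∙ a ↑ v
      an = a-normal k (p ^ suc f) p∤k (^-∣ p (s≤s n≤f)) rel

    spanned′ : ∀ r k f → ¬ p ∣ r → ¬ p ∣ k → c ↑ r ∙ a ↑ k ≈ a ↑ k ∙ (c ↑ r) ↑ (1 + p ^ suc f) →
      ∀ g → ∃₂ λ j i → g ≈ (a ↑ k) ↑ j ∙ (c ↑ r) ↑ i
    spanned′ r k f p∤r p∤k e g = span-≈ (proj₂ (proj₂ (spanned-a p∤J g)))
      (span-∙ (span-↑ (proj₁ (spanned-a p∤J g)) (span-≈ (is-power a k p∤k) (span-g (proj₁ (unit-root G L a k (expo a) p∤k)))))
              (span-↑ (proj₁ (proj₂ (spanned-a p∤J g))) (span-≈ (is-power c r p∤r) (span-c (proj₁ (unit-root G L c r (expo c) p∤r))))))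
      where
      open Span G (c ↑ r) (a ↑ k) (1 + p ^ suc f) e
      is-power : ∀ g k → (h : ¬ p ∣ k) → g ≈ (g ↑ k) ↑ proj₁ (unit-root G L g k (expo g) h)
      is-power g k h = ≈-trans (≈-sym (↑-1 g)) (≈-trans (proj₂ (proj₂ (unit-root G L g k (expo g) h)) 1)
        (↑-cong (proj₁ (unit-root G L g k (expo g) h)) (↑-≡ g (*-identityˡ k))))

    -- The divisibility makes c^Q trivial, so ⟨c⟩ has order Q and meets ⟨a⟩ trivially.
    module Split (d : P ∣ Q * I) where

      c-ord : c ↑ Q ≈ ε
      c-ord = ≈-trans cQ (↑-∣ ord-a (∣m⇒∣m*n u d))

      N : Normalised G c a (suc n)
      N = normalise G c a (suc n) (proj₁ (norm a)) (s≤s z≤n) c-ord (proj₂ (norm a))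

      open Normalised N

      relG : Rel p G c (a ↑ k) (suc n) (suc m) (suc n) (suc f)
      relG = record { rel-α = c-ord ; rel-β = ≈-trans (≈-trans (≈-sym (↑-*′ a k P)) (↑-ε P k ord-a)) (≈-sym c-ord) ; rel-c = rel }

      exact : ∀ j i → (a ↑ k) ↑ j ∙ c ↑ i ≈ ε → ∃ λ j′ → j ≡ P * j′ × Q ∣ Q * j′ + i
      exact j i e = _∣_.quotient dj , m∣n⇒n≡m*quotient dj , ∣m∣n⇒∣m+n (m∣m*n _) di
        where
        di : Q ∣ i
        di = uniq-c (k * j) i (≈-trans (∙-congʳ (↑-*′ a k j)) e)
        dj : P ∣ j
        dj = cancel-unit (suc m) p∤k (subst (P ∣_) (*-comm k j) (a-exp-∣ {k * j}
          (≈-trans (↑-*′ a k j) (≈-trans (≈-sym (identityʳ _)) (≈-trans (∙-congˡ (≈-sym (↑-∣ c-ord di))) e)))))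

      spanned : ∀ g → ∃₂ λ j i → g ≈ (a ↑ k) ↑ j ∙ c ↑ i
      spanned g = let (j , i , e) = spanned′ 1 k f p∤1 p∤k (≈-trans (∙-congʳ (↑-1 c)) (≈-trans rel (∙-congˡ (↑-cong (1 + p ^ suc f) (≈-sym (↑-1 c)))))) g
                  in j , i , ≈-trans e (∙-congˡ (↑-cong i (↑-1 c)))

      open Presentation p G c (a ↑ k) (suc n) (suc m) (suc n) (suc f) relG spanned exact using (presents)

      result : Result G (suc n) (suc m)
      result = by-f (≤-<-connex n f)
        where
        by-m : f < n → n < m ⊎ n ≡ m → Result G (suc n) (suc m)
        by-m f<n (inj₁ n<m) = M₂ (suc n) (suc m) (suc f) , (s≤s z≤n , s≤s f<n , s≤s n<m) , refl , refl ,
          presents (M₂ (suc n) (suc m) (suc f)) refl refl refl refl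
        -- For d = e the presentations of the first and second family coincide, and only the first
        -- admits equality.
        by-m f<n (inj₂ n≡m) = M₁ (suc n) (suc m) (suc f) ,
          inj₂ (s≤s z≤n , s≤s f<n , s≤s n≤m , ≤-trans (≤-reflexive (cong suc (sym n≡m))) (m≤m+n (suc n) (suc f))) , refl , refl ,
          presents (M₁ (suc n) (suc m) (suc f)) (cong suc (sym n≡m)) (cong suc n≡m) (cong suc (sym n≡m)) refl
        by-f : n ≤ f ⊎ f < n → Result G (suc n) (suc m)
        by-f (inj₁ n≤f) = large-f N n≤f
        by-f (inj₂ f<n) = by-m f<n (m≤n⇒m<n∨m≡n n≤m)

    -- With d = n + 1 and e = m + 1, c^(p^d) is a unit power of a^(p^(d+l)) and has order p^q, where
    -- q = e - d - l > 0. So c has order p^(d+q), which gives h = d + q, and d + l is d + e - h.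
    module NonSplit (l q I′ : ℕ) (0<l : 0 < l) (0<q : 0 < q) (m≡ : suc m ≡ suc n + l + q)
        (I≡ : I ≡ p ^ l * I′) (p∤I′ : ¬ p ∣ I′) where

      s h E S : ℕ
      s = suc n + l
      h = suc n + q
      E = I′ * u
      S = p ^ s

      instance
        S-nz : NonZero S
        S-nz = pow-nz s

      p∤E : ¬ p ∣ E
      p∤E = ∤-* p∤I′ p∤u

      P≡ : P ≡ S * p ^ q
      P≡ = trans (cong (p ^_) m≡) (^-distribˡ-+-* p s q)

      H≡ : p ^ h ≡ Q * p ^ q
      H≡ = ^-distribˡ-+-* p (suc n) q

      cQ′ : c ↑ Q ≈ a ↑ (S * E)
      cQ′ = ≈-trans cQ (↑-≡ a (trans (cong (λ z → Q * z * u) I≡) (trans (ring Q (p ^ l) I′ u)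
        (cong (_* E) (sym (^-distribˡ-+-* p (suc n) l))))))
        where
        ring : ∀ Q l I u → Q * (l * I) * u ≡ Q * l * (I * u)
        ring = solve-∀

      c-Q* : ∀ i → c ↑ (Q * i) ≈ a ↑ (S * E * i)
      c-Q* i = ≈-trans (↑-*′ c Q i) (≈-trans (↑-cong i cQ′) (≈-sym (↑-*′ a (S * E) i)))

      c-ord : c ↑ (p ^ h) ≈ ε
      c-ord = ≈-trans (↑-≡ c H≡) (≈-trans (c-Q* (p ^ q)) (↑-∣ ord-a (divides E (trans (ring S E (p ^ q)) (cong (E *_) (sym P≡))))))
        where
        ring : ∀ S E q → S * E * q ≡ E * (S * q)
        ring = solve-∀

      c-exact : ∀ i → c ↑ i ≈ ε → p ^ h ∣ i
      c-exact i e = via (uniq-c 0 i (≈-trans (identityˡ _) e)) e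
        where
        via : Q ∣ i → c ↑ i ≈ ε → p ^ h ∣ i
        via (divides i′ refl) e = subst₂ _∣_ (sym H≡) (*-comm Q i′) (*-monoʳ-∣ Q (cancel-unit q p∤E (*-cancelˡ-∣ S
          (subst₂ _∣_ P≡ (ring S E i′) (a-exp-∣ {S * E * i′} (≈-trans (≈-sym (c-Q* i′)) (≈-trans (↑-≡ c (*-comm Q i′)) e)))))))
          where
          ring : ∀ S E i → S * E * i ≡ S * (i * E)
          ring = solve-∀

      N : Normalised G c a h
      N = normalise G c a h (proj₁ (norm a)) (s≤s z≤n) c-ord (proj₂ (norm a))

      open Normalised N

      -- As an element of ⟨a⟩, c^Q commutes with a^k; but a^k also raises it to the power 1 +
      -- p^(f+1). Hence c^(Q p^(f+1)) is trivial. This is the condition h - d ≤ f of the third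
      -- family.
      h≤n+f : h ≤ suc n + suc f
      h≤n+f = ^-∣⇒≤ (subst (p ^ h ∣_) (sym (^-distribˡ-+-* p (suc n) (suc f))) (c-exact (Q * p ^ suc f)
        (≈-sym (∙-cancelˡ (c ↑ Q) _ _ (∙-cancelˡ (a ↑ k) _ _ (begin
          a ↑ k ∙ (c ↑ Q ∙ ε)                   ≈⟨ ∙-congˡ (identityʳ _) ⟩
          a ↑ k ∙ c ↑ Q                         ≈⟨ ∙-congˡ cQ′ ⟩
          a ↑ k ∙ a ↑ (S * E)                   ≈⟨ ↑-comm a k (S * E) ⟩
          a ↑ (S * E) ∙ a ↑ k                   ≈⟨ ∙-congʳ cQ′ ⟨
          c ↑ Q ∙ a ↑ k                         ≈⟨ skew {v = 1 + p ^ suc f} Q rel ⟩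
          a ↑ k ∙ c ↑ (Q * (1 + p ^ suc f))     ≈⟨ ∙-congˡ (↑-≡ c (trans (*-distribˡ-+ Q 1 (p ^ suc f)) (cong (_+ Q * p ^ suc f) (*-identityʳ Q)))) ⟩
          a ↑ k ∙ c ↑ (Q + Q * p ^ suc f)       ≈⟨ ∙-congˡ (↑-+ c Q (Q * p ^ suc f)) ⟩
          a ↑ k ∙ (c ↑ Q ∙ c ↑ (Q * p ^ suc f)) ∎))))))
        where open R

      E⁻ : ∃ λ w → Cong P (E * w) 1
      E⁻ = inv-mod (suc m) E p∤E

      -- The generator of ⟨c⟩ is rescaled by the solution of E r = k modulo P, which turns c^Q =
      -- a^(SE) into the required relation between a^k and c^r.
      r : ℕ
      r = proj₁ E⁻ * k

      p∤r : ¬ p ∣ r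
      p∤r = ∤-* (∤-of-inverse {x = E} (m∣m*n (p ^ m)) (proj₂ E⁻)) p∤k

      rel-r : c ↑ r ∙ a ↑ k ≈ a ↑ k ∙ (c ↑ r) ↑ (1 + p ^ suc f)
      rel-r = ≈-trans (skew {v = 1 + p ^ suc f} r rel) (∙-congˡ (↑-*′ c r (1 + p ^ suc f)))

      rel-b : (a ↑ k) ↑ S ≈ (c ↑ r) ↑ Q
      rel-b = begin
        (a ↑ k) ↑ S       ≈⟨ ↑-*′ a k S ⟨
        a ↑ (k * S)       ≈⟨ ↑-mod {a} {P} {k * S} {S * E * r} ord-a (c-sym (c-trans (c-≡ (ring S E (proj₁ E⁻) k))
                               (c-trans (c-*ʳ (k * S) (proj₂ E⁻)) (c-≡ (*-identityˡ (k * S)))))) ⟩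
        a ↑ (S * E * r)   ≈⟨ c-Q* r ⟨
        c ↑ (Q * r)       ≈⟨ ↑-* c Q r ⟩
        (c ↑ r) ↑ Q       ∎
        where
        open R
        ring : ∀ S E w k → S * E * (w * k) ≡ E * w * (k * S)
        ring = solve-∀

      relG : Rel p G (c ↑ r) (a ↑ k) h s (suc n) (suc f)
      relG = record { rel-α = ≈-trans (≈-sym (↑-*′ c r (p ^ h))) (↑-ε (p ^ h) r c-ord) ; rel-β = rel-b ; rel-c = rel-r }

      S∣P : S ∣ P
      S∣P = divides (p ^ q) (trans P≡ (*-comm S (p ^ q)))

      exact : ∀ j i → (a ↑ k) ↑ j ∙ (c ↑ r) ↑ i ≈ ε → ∃ λ j′ → j ≡ S * j′ × p ^ h ∣ Q * j′ + i
      exact j i e = via (cancel-unit (suc n) p∤r (subst (Q ∣_) (*-comm r i)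
        (uniq-c (k * j) (r * i) (≈-trans (∙-cong (↑-*′ a k j) (↑-*′ c r i)) e)))) e
        where
        via₂ : ∀ i′ → P ∣ j + S * i′ → S ∣ j → ∃ λ j′ → j ≡ S * j′ × p ^ h ∣ Q * j′ + i′ * Q
        via₂ i′ d (divides j′ refl) = j′ , *-comm j′ S , subst₂ _∣_ (sym H≡)
          (trans (*-distribˡ-+ Q j′ i′) (cong (Q * j′ +_) (*-comm Q i′)))
          (*-monoʳ-∣ Q (*-cancelˡ-∣ S (subst₂ _∣_ P≡ (trans (cong (_+ S * i′) (*-comm j′ S)) (sym (*-distribˡ-+ S j′ i′))) d)))
        via : Q ∣ i → (a ↑ k) ↑ j ∙ (c ↑ r) ↑ i ≈ ε → ∃ λ j′ → j ≡ S * j′ × p ^ h ∣ Q * j′ + i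
        via (divides i′ refl) e = via₂ i′ dj (∣m+n∣m⇒∣n (subst (S ∣_) (+-comm j (S * i′)) (∣-trans S∣P dj)) (m∣m*n i′))
          where
          open R
          dj : P ∣ j + S * i′
          dj = cancel-unit (suc m) p∤k (subst (P ∣_) (*-comm k (j + S * i′)) (a-exp-∣ {k * (j + S * i′)} (begin
            a ↑ (k * (j + S * i′))                 ≈⟨ ↑-*′ a k (j + S * i′) ⟩
            (a ↑ k) ↑ (j + S * i′)                 ≈⟨ ↑-+ (a ↑ k) j (S * i′) ⟩
            (a ↑ k) ↑ j ∙ (a ↑ k) ↑ (S * i′)       ≈⟨ ∙-congˡ (≈-trans (↑-*′ (a ↑ k) S i′) (↑-cong i′ rel-b)) ⟩
            (a ↑ k) ↑ j ∙ ((c ↑ r) ↑ Q) ↑ i′       ≈⟨ ∙-congˡ (↑-* (c ↑ r) i′ Q) ⟨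
            (a ↑ k) ↑ j ∙ (c ↑ r) ↑ (i′ * Q)       ≈⟨ e ⟩
            ε                                      ∎)))

      open Presentation p G (c ↑ r) (a ↑ k) h s (suc n) (suc f) relG (spanned′ r k f p∤r p∤k rel-r) exact using (presents)

      result : Result G (suc n) (suc m)
      result = by-f (≤-<-connex n f)
        where
        by-f : n ≤ f ⊎ f < n → Result G (suc n) (suc m)
        by-f (inj₁ n≤f) = large-f N n≤f
        by-f (inj₂ f<n) = M₃ (suc n) (suc m) h (suc f) ,
          (subst (_≤ suc f) (sym (m+n∸m≡n (suc n) q)) (+-cancelˡ-≤ (suc n) q (suc f) h≤n+f) , s≤s f<n ,
            m<m+n (suc n) 0<q , subst (h <_) (sym m≡) (+-monoˡ-< q (m<m+n (suc n) 0<l))) , refl , refl ,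
          presents (M₃ (suc n) (suc m) h (suc f)) refl
            (trans ([m+n]∸[m+o]≡n∸o (suc n) (suc m) q) (trans (cong (_∸ q) m≡) (m+n∸n≡m s q))) refl refl

    result : Result G (suc n) (suc m)
    result = by-val (val (suc m) I)
      where
      by-val : P ∣ I ⊎ (∃₂ λ l I′ → l < suc m × I ≡ p ^ l * I′ × ¬ p ∣ I′) → Result G (suc n) (suc m)
      by-val (inj₁ d) = Split.result (∣n⇒∣m*n Q d)
      by-val (inj₂ (zero , I′ , _ , I≡ , p∤I′)) = ⊥-elim (p∤I′ (subst (p ∣_) (trans I≡ (*-identityˡ I′)) p∣I))
      by-val (inj₂ (suc l , I′ , _ , I≡ , p∤I′)) = by-size (≤-<-connex (suc m) (suc n + suc l))
        where
        by-size : suc m ≤ suc n + suc l ⊎ suc n + suc l < suc m → Result G (suc n) (suc m)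
        by-size (inj₁ le) = Split.result (subst (λ z → P ∣ Q * z) (sym I≡) (subst (P ∣_)
          (trans (cong (_* I′) (^-distribˡ-+-* p (suc n) (suc l))) (*-assoc Q (p ^ suc l) I′)) (∣m⇒∣m*n I′ (^-∣ p le))))
        by-size (inj₂ lt) = NonSplit.result (suc l) (suc m ∸ (suc n + suc l)) I′ (s≤s z≤n) (m<n⇒0<n∸m lt)
          (sym (m+[n∸m]≡n (<⇒≤ lt))) I≡ p∤I′

bicyclic-result : ∀ p (pr : Prime p) (2<p : 2 < p) G a b m n → Bicyclic p G a b (suc m) (suc n) → n ≤ m →
  Classify.Result p pr 2<p G (suc n) (suc m)
bicyclic-result p pr 2<p G a b m n B n≤m = by-unit (p ∣? NormalCyclic.I NC) (NormalCyclic.unit NC)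
  where
  open CyclicNormal p pr 2<p
  open Classify p pr 2<p
  NC : NormalCyclic G a b
  NC = Reduction.normalCyclic p pr 2<p G a b m n B
  by-unit : Dec (p ∣ NormalCyclic.I NC) → ¬ p ∣ NormalCyclic.I NC ⊎ ¬ p ∣ NormalCyclic.J NC → Result G (suc n) (suc m)
  by-unit (no h)  _        = Cases.case-I G a b m n B n≤m NC h
  by-unit (yes d) (inj₁ h) = ⊥-elim (h d)
  by-unit (yes d) (inj₂ h) = CaseJ.result p pr 2<p G a b m n B n≤m NC d h

-- Regular dessins on complete bipartite graphs

module _ (G : Group 0ℓ 0ℓ) where
  open Powers G

  -- The labels f distinguish the powers of α exactly. The pigeonhole principle gives a period of at
  -- most n, and surjectivity of f forbids a shorter one.
  cyclic-order : ∀ (α : Carrier) n .{{_ : NonZero n}} (f : ℕ → Fin n) →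
    (∀ k l → f k ≡ f l → α ↑ k ≈ α ↑ l) → (∀ k l → α ↑ k ≈ α ↑ l → f k ≡ f l) → (∀ v → ∃ λ k → f k ≡ v) →
    α ↑ n ≈ ε × (∀ k → α ↑ k ≈ ε → n ∣ k)
  cyclic-order α n f f⇒ ⇒f surj = ord , exact
    where
    reduce : ∀ r .{{_ : NonZero r}} → α ↑ r ≈ ε → ∀ k → α ↑ k ≈ α ↑ (k % r)
    reduce r e k = ↑-mod {α} {r} {k} {k % r} e (mkC 0 (k / r) (trans (+-identityʳ k) (m≡m%n+[m/n]*n k r)))
    minimal : ∀ r .{{_ : NonZero r}} → α ↑ r ≈ ε → n ≤ r
    minimal r e = Fin.injective⇒≤ {f = λ v → fromℕ< (m%n<n (proj₁ (surj v)) r)} λ {v} {w} eq →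
      trans (sym (proj₂ (surj v))) (trans (⇒f _ _ (≈-trans (reduce r e (proj₁ (surj v))) (≈-trans (↑-≡ α
        (trans (sym (Fin.toℕ-fromℕ< (m%n<n (proj₁ (surj v)) r))) (trans (cong toℕ eq) (Fin.toℕ-fromℕ< (m%n<n (proj₁ (surj w)) r)))))
        (≈-sym (reduce r e (proj₁ (surj w))))))) (proj₂ (surj w)))
    period : ∃ λ r → NonZero r × r ≤ n × α ↑ r ≈ ε
    period with Fin.pigeonhole (n<1+n n) (λ i → f (toℕ i))
    ... | i , j , i<j , e = toℕ j ∸ toℕ i , >-nonZero (m<n⇒0<n∸m i<j) ,
      ≤-trans (m∸n≤m (toℕ j) (toℕ i)) (≤-pred (Fin.toℕ<n j)) ,
      ∙-cancelˡ (α ↑ toℕ i) _ _ (≈-trans (≈-sym (↑-+ α (toℕ i) (toℕ j ∸ toℕ i))) (≈-trans (↑-≡ α (m+[n∸m]≡n (<⇒≤ i<j)))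
        (≈-trans (≈-sym (f⇒ (toℕ i) (toℕ j) e)) (≈-sym (identityʳ _)))))
    ord : α ↑ n ≈ ε
    ord = let (r , nz , r≤n , e) = period in ≈-trans (↑-≡ α (≤-antisym (minimal r {{nz}} e) r≤n)) e
    exact : ∀ k → α ↑ k ≈ ε → n ∣ k
    exact k e = by-rem (k % n) refl
      where
      by-rem : ∀ r → r ≡ k % n → n ∣ k
      by-rem zero    eq = m%n≡0⇒n∣m k n (sym eq)
      by-rem (suc r) eq = ⊥-elim (<⇒≱ (m%n<n k n) (subst (n ≤_) eq (minimal (suc r)
        (≈-trans (↑-≡ α eq) (≈-trans (≈-sym (reduce n ord k)) e)))))

module FromDessin {N : ℕ} (D : Dessin N) (regular : Regular D) where
  open Powers (AutGroup D)

  act : Aut D → Fin N → Fin N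
  act g = Perm.to (Aut.σ g)

  cancel-perm : (π : Perm N) → ∀ {i j} → Perm.to π i ≡ Perm.to π j → i ≡ j
  cancel-perm π {i} {j} e = trans (sym (Perm.from-to π i)) (trans (cong (Perm.from π) e) (Perm.from-to π j))

  -- Automorphisms commute with both rotations, so agreement at one edge spreads along any path, and
  -- the dessin is connected.
  semiregular : ∀ g h {i} → act g i ≡ act h i → g ≈ h
  semiregular g h {i} e j = along (Dessin.connected D i j)
    where
    back : (π : Perm N) (γ : Perm N) → (∀ i → Perm.to γ (Perm.to π i) ≡ Perm.to π (Perm.to γ i)) →
      ∀ j → Perm.to π (Perm.to γ (Perm.from π j)) ≡ Perm.to γ j
    back π γ cm j = trans (sym (cm (Perm.from π j))) (cong (Perm.to γ) (Perm.to-from π j))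
    along : ∀ {j} → Reach (Dessin.x D) (Dessin.y D) i j → act g j ≡ act h j
    along here = e
    along (step-x {j = j} r) = trans (Aut.comm-x g j) (trans (cong (Perm.to (Dessin.x D)) (along r)) (sym (Aut.comm-x h j)))
    along (step-y {j = j} r) = trans (Aut.comm-y g j) (trans (cong (Perm.to (Dessin.y D)) (along r)) (sym (Aut.comm-y h j)))
    along (step-x⁻ {j = j} r) = cancel-perm (Dessin.x D) (trans (back (Dessin.x D) (Aut.σ g) (Aut.comm-x g) j)
      (trans (along r) (sym (back (Dessin.x D) (Aut.σ h) (Aut.comm-x h) j))))
    along (step-y⁻ {j = j} r) = cancel-perm (Dessin.y D) (trans (back (Dessin.y D) (Aut.σ g) (Aut.comm-y g) j)
      (trans (along r) (sym (back (Dessin.y D) (Aut.σ h) (Aut.comm-y h) j))))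

  module Generator (π : Perm N) (comm : ∀ g i → act g (Perm.to π i) ≡ Perm.to π (act g i)) (i₀ : Fin N) where

    turn : ℕ → Fin N → Fin N
    turn = iter (Perm.to π)

    act-turn : ∀ g k i → act g (turn k i) ≡ turn k (act g i)
    act-turn g zero    i = refl
    act-turn g (suc k) i = trans (comm g (turn k i)) (cong (Perm.to π) (act-turn g k i))

    turn-suc : ∀ k i → turn k (Perm.to π i) ≡ turn (suc k) i
    turn-suc zero    i = refl
    turn-suc (suc k) i = cong (Perm.to π) (turn-suc k i)

    γ : Aut D
    γ = proj₁ (regular i₀ (Perm.to π i₀))

    -- The rotation π itself need not be an automorphism; γ merely agrees with it at i₀. Since γ
    -- commutes with π, their iterates agree at i₀ as well.
    γ^ : ∀ k → act (γ ↑ k) i₀ ≡ turn k i₀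
    γ^ zero    = refl
    γ^ (suc k) = trans (cong (act γ) (γ^ k)) (trans (act-turn γ k i₀)
      (trans (cong (turn k) (proj₂ (regular i₀ (Perm.to π i₀)))) (turn-suc k i₀)))

    turn⇒ : ∀ k l → turn k i₀ ≡ turn l i₀ → γ ↑ k ≈ γ ↑ l
    turn⇒ k l e = semiregular (γ ↑ k) (γ ↑ l) (trans (γ^ k) (trans e (sym (γ^ l))))

    ⇒turn : ∀ k l → γ ↑ k ≈ γ ↑ l → turn k i₀ ≡ turn l i₀
    ⇒turn k l e = trans (sym (γ^ k)) (trans (e i₀) (γ^ l))

  module _ (m n : ℕ) {{_ : NonZero m}} {{_ : NonZero n}} (K : UnderlyingK D m n) where
    φ = proj₁ K
    φ-inj = proj₁ (proj₁ (proj₂ K))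
    φ-surj = proj₂ (proj₁ (proj₂ K))

    preimage : ∀ v → ∃ λ i → φ i ≡ v
    preimage v = proj₁ (φ-surj v) , proj₂ (φ-surj v) refl

    black : ∀ i j → SameOrbit (Dessin.x D) i j → proj₁ (φ i) ≡ proj₁ (φ j)
    black i j = Equivalence.from (proj₁ (proj₂ (proj₂ K)) i j)
    black⁻ : ∀ i j → proj₁ (φ i) ≡ proj₁ (φ j) → SameOrbit (Dessin.x D) i j
    black⁻ i j = Equivalence.to (proj₁ (proj₂ (proj₂ K)) i j)
    white : ∀ i j → SameOrbit (Dessin.y D) i j → proj₂ (φ i) ≡ proj₂ (φ j)
    white i j = Equivalence.from (proj₂ (proj₂ (proj₂ K)) i j)
    white⁻ : ∀ i j → proj₂ (φ i) ≡ proj₂ (φ j) → SameOrbit (Dessin.y D) i j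
    white⁻ i j = Equivalence.to (proj₂ (proj₂ (proj₂ K)) i j)

    i₀ : Fin N
    i₀ = proj₁ (preimage (fromℕ< (>-nonZero⁻¹ m) , fromℕ< (>-nonZero⁻¹ n)))

    open Generator (Dessin.x D) Aut.comm-x i₀ renaming (turn to turnˣ; γ to α; γ^ to α^; turn⇒ to turnˣ⇒; ⇒turn to ⇒turnˣ; act-turn to act-turnˣ)
    open Generator (Dessin.y D) Aut.comm-y i₀ renaming (turn to turnʸ; γ to β; γ^ to β^; turn⇒ to turnʸ⇒; ⇒turn to ⇒turnʸ; act-turn to act-turnʸ)

    φ-eq : ∀ {i j} → proj₁ (φ i) ≡ proj₁ (φ j) → proj₂ (φ i) ≡ proj₂ (φ j) → i ≡ j
    φ-eq e f = φ-inj (cong₂ _,_ e f)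

    -- The edges at the black vertex of i₀ have the n white vertices as their other ends, each once;
    -- these ends label the powers of α.
    α-order : α ↑ n ≈ ε × (∀ k → α ↑ k ≈ ε → n ∣ k)
    α-order = cyclic-order (AutGroup D) α n (λ k → proj₂ (φ (turnˣ k i₀)))
      (λ k l e → turnˣ⇒ k l (φ-eq (trans (sym (black i₀ (turnˣ k i₀) (k , refl))) (black i₀ (turnˣ l i₀) (l , refl))) e))
      (λ k l e → cong (λ i → proj₂ (φ i)) (⇒turnˣ k l e))
      (λ v → let (j , e) = preimage (proj₁ (φ i₀) , v); (k , f) = black⁻ i₀ j (cong proj₁ (sym e))
             in k , trans (cong (λ i → proj₂ (φ i)) f) (cong proj₂ e))

    β-order : β ↑ m ≈ ε × (∀ k → β ↑ k ≈ ε → m ∣ k)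
    β-order = cyclic-order (AutGroup D) β m (λ k → proj₁ (φ (turnʸ k i₀)))
      (λ k l e → turnʸ⇒ k l (φ-eq e (trans (sym (white i₀ (turnʸ k i₀) (k , refl))) (white i₀ (turnʸ l i₀) (l , refl)))))
      (λ k l e → cong (λ i → proj₁ (φ i)) (⇒turnʸ k l e))
      (λ v → let (j , e) = preimage (v , proj₂ (φ i₀)); (k , f) = white⁻ i₀ j (cong proj₂ (sym e))
             in k , trans (cong (λ i → proj₁ (φ i)) f) (cong proj₁ e))

    act-αβ : ∀ k l → act (α ↑ k ∙ β ↑ l) i₀ ≡ turnʸ l (turnˣ k i₀)
    act-αβ k l = trans (cong (act (α ↑ k)) (β^ l)) (trans (act-turnʸ (α ↑ k) l i₀) (cong (turnʸ l) (α^ k)))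

    -- In a complete bipartite graph some edge joins the black vertex of i₀ to the white vertex of g
    -- i₀. Turning around the first vertex reaches it from i₀, and turning around the second leads
    -- on to g i₀.
    factor : ∀ g → ∃₂ λ k l → g ≈ α ↑ k ∙ β ↑ l
    factor g = let (j , e) = preimage (proj₁ (φ i₀) , proj₂ (φ (act g i₀)))
                   (k , f) = black⁻ i₀ j (cong proj₁ (sym e))
                   (l , f′) = white⁻ j (act g i₀) (cong proj₂ e)
               in k , l , semiregular g (α ↑ k ∙ β ↑ l) (trans (sym f′) (trans (cong (turnʸ l) (sym f)) (sym (act-αβ k l))))

    factor-uniq : ∀ i j → α ↑ i ∙ β ↑ j ≈ ε → n ∣ i × m ∣ j
    factor-uniq i j e = proj₂ α-order i αi , proj₂ β-order j
        (λ e′ → trans (sym (αi (act (β ↑ j) e′))) (e e′))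
      where
      back : turnʸ j (turnˣ i i₀) ≡ i₀
      back = trans (sym (act-αβ i j)) (e i₀)
      αi : α ↑ i ≈ ε
      αi = turnˣ⇒ i 0 (φ-eq (sym (black i₀ (turnˣ i i₀) (i , refl))) (white (turnˣ i i₀) i₀ (j , back)))

bicyclic-from-dessin : ∀ p .{{_ : NonZero p}} d e {N} (D : Dessin N) → Regular D → UnderlyingK D (p ^ d) (p ^ e) →
  ∃₂ λ a b → Bicyclic p (AutGroup D) a b e d
bicyclic-from-dessin p d e D reg K = _ , _ , record
  { e₁ = λ g → proj₁ (factor (p ^ d) (p ^ e) K g) ; e₂ = λ g → proj₁ (proj₂ (factor (p ^ d) (p ^ e) K g))
  ; dec = λ g → proj₂ (proj₂ (factor (p ^ d) (p ^ e) K g))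
  ; ord-a = proj₁ (α-order (p ^ d) (p ^ e) K) ; ord-b = proj₁ (β-order (p ^ d) (p ^ e) K)
  ; uniq = factor-uniq (p ^ d) (p ^ e) K }
  where
  open FromDessin D reg
  instance
    d-nz : NonZero (p ^ d)
    d-nz = m^n≢0 p d
    e-nz : NonZero (p ^ e)
    e-nz = m^n≢0 p e

classification : ∀ p (pr : Prime p) (2<p : 2 < p) d e → 1 ≤ d → d ≤ e → ∀ N (D : Dessin N) → Regular D →
  UnderlyingK D (p ^ d) (p ^ e) ⊎ UnderlyingK D (p ^ e) (p ^ d) → Classify.Result p pr 2<p (AutGroup D) d e
classification p pr 2<p (suc d) (suc e) 1≤d (s≤s d≤e) N D reg (inj₁ K) =
  bicyclic-result p pr 2<p (AutGroup D) _ _ e d (proj₂ (proj₂ (bicyclic-from-dessin p {{prime⇒nonZero pr}} (suc d) (suc e) D reg K))) d≤e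
classification p pr 2<p (suc d) (suc e) 1≤d (s≤s d≤e) N D reg (inj₂ K) =
  bicyclic-result p pr 2<p (AutGroup D) _ _ e d
    (BicyclicProps.flip p pr 2<p (AutGroup D) _ _ (suc d) (suc e) (proj₂ (proj₂ (bicyclic-from-dessin p {{prime⇒nonZero pr}} (suc e) (suc d) D reg K)))) d≤e

-- Invariants of the presented groups

module Uniqueness (p : ℕ) (pr : Prime p) (2<p : 2 < p) where
  open Arith p pr 2<p
  open CyclicNormal p pr 2<p
  open Classify p pr 2<p using (^-∣⇒≤; ∤-of-inverse)

  -- The numerical consequences of admissibility on which the invariants depend.
  record Parameters (h s t f e : ℕ) : Set where
    field
      f≤h   : suc f ≤ h
      f≤t   : suc f ≤ t
      h≤e   : h ≤ e
      s≤e   : s ≤ e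
      h≤f+s : h + (s ∸ t) ≤ suc f + s
      h≤t+  : h ≤ t + (e ∸ s)
      e≤    : e ≤ h ⊎ (t ≤ s × e ≤ h + (s ∸ t))

  ℤ/ : (M : ℕ) .{{_ : NonZero M}} → Group 0ℓ 0ℓ
  ℤ/ M = record
    { Carrier = ℕ ; _≈_ = Cong M ; _∙_ = _+_ ; ε = 0 ; _⁻¹ = λ k → k * pred M
    ; isGroup = record
      { isMonoid = record
        { isSemigroup = record
          { isMagma = record
            { isEquivalence = record { refl = c-refl ; sym = c-sym ; trans = c-trans }
            ; ∙-cong = c-+ }
          ; assoc = λ i j k → c-≡ (+-assoc i j k) }
        ; identity = (λ _ → c-refl) , (λ k → c-≡ (+-identityʳ k)) }
      ; inverse = neg , (λ k → c-trans (c-≡ (+-comm k (k * pred M))) (neg k))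
      ; ⁻¹-cong = c-*ʳ (pred M) } }
    where
    neg : ∀ k → Cong M (k * pred M + k) 0
    neg k = ∣⇒c (divides k (trans (+-comm (k * pred M) k) (trans (sym (*-suc k (pred M))) (cong (k *_) (suc-pred M)))))

  iterate-+ : ∀ x k → iterate _+_ 0 x k ≡ k * x
  iterate-+ x zero    = refl
  iterate-+ x (suc k) = cong (x +_) (iterate-+ x k)

  -- The affine maps x ↦ uʲ x + r of ℤ/p^(h + (s ∸ t)), composed from left to right, contain a faithful image of ⟨α⟩
  -- with α a translation by p^(s ∸ t) and β the map x ↦ u x + v.
  module Affine (h s t f : ℕ) (u^ : h + (s ∸ t) ≤ suc f + s) where

    Λ L u q T : ℕ
    Λ = h + (s ∸ t)
    L = p ^ Λ
    u = 1 + p ^ suc f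
    q = p ^ (s ∸ t)
    T = p ^ s

    instance
      L-nz : NonZero L
      L-nz = pow-nz Λ
      T-nz : NonZero T
      T-nz = pow-nz s

    -- The geometric sum (u^k - 1)/(u - 1), which is the translation part of the k-th iterate of x ↦
    -- u x + 1.
    geom : ℕ → ℕ
    geom zero    = 0
    geom (suc k) = u ^ k + geom k

    geom-eq : ∀ k → p ^ suc f * geom k + 1 ≡ u ^ k
    geom-eq zero    = cong (_+ 1) (*-zeroʳ (p ^ suc f))
    geom-eq (suc k) = trans (ring (p ^ suc f) (u ^ k) (geom k)) (trans (cong (p ^ suc f * u ^ k +_) (geom-eq k))
      (+-comm (p ^ suc f * u ^ k) (u ^ k)))
      where
      ring : ∀ P U g → P * (U + g) + 1 ≡ P * U + (P * g + 1)
      ring = solve-∀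

    abstract
      geom-p^ : ∀ k → ∃ λ w → ¬ p ∣ w × geom (p ^ k) ≡ p ^ k * w
      geom-p^ k = proj₁ W , c-∤ (proj₁ (proj₂ W)) p∤1 , *-cancelˡ-≡ _ _ (p ^ suc f) {{pow-nz (suc f)}}
        (+-cancelʳ-≡ 1 _ _ (trans (geom-eq (p ^ k)) (trans (cong (λ z → (1 + z) ^ (p ^ k)) (sym (*-identityʳ (p ^ suc f))))
          (trans (proj₂ (proj₂ W)) (trans (+-comm 1 _) (cong (_+ 1) (trans (cong (_* proj₁ W) (^-distribˡ-+-* p (suc f) k)) (*-assoc (p ^ suc f) (p ^ k) (proj₁ W)))))))))
        where
        W : ∃ λ v → Cong p v 1 × (1 + p ^ suc f * 1) ^ (p ^ k) ≡ 1 + p ^ suc (f + k) * v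
        W = lte^ f 1 k

    -- As α is a pure translation, β^(p^s) = α^(p^t) needs the linear part of β to die at p^s; the
    -- bound `u^` provides this.
    u^T : Cong L (u ^ T) 1
    u^T = c-trans (c-≡ (sym (geom-eq T))) (∣⇒c+ 1 (subst (λ z → L ∣ p ^ suc f * z) (sym (proj₂ (proj₂ (geom-p^ s))))
      (subst (L ∣_) (*-assoc (p ^ suc f) (p ^ s) _) (∣m⇒∣m*n _ (subst (L ∣_) (^-distribˡ-+-* p (suc f) s) (^-∣ p u^))))))

    u^T* : ∀ j → Cong L (u ^ (j + j * pred T)) 1
    u^T* j = c-trans (c-≡ (trans (cong (u ^_) (trans (sym (*-suc j (pred T))) (trans (cong (j *_) (suc-pred T)) (*-comm j T))))
      (sym (^-*-assoc u T j)))) (c-trans (c-^ j u^T) (c-≡ (^-zeroˡ j)))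

    -- Pairs are compared as affine maps: j counts only through u^j.
    _∼_ : ℕ × ℕ → ℕ × ℕ → Set
    (j , r) ∼ (j′ , r′) = Cong L (u ^ j) (u ^ j′) × Cong L r r′

    _·_ : ℕ × ℕ → ℕ × ℕ → ℕ × ℕ
    (j , r) · (j′ , r′) = j + j′ , u ^ j′ * r + r′

    inverse : ℕ × ℕ → ℕ × ℕ
    inverse (j , r) = j * pred T , u ^ (j * pred T) * (r * pred L)

    ·-cong : ∀ {g g′ k k′} → g ∼ g′ → k ∼ k′ → (g · k) ∼ (g′ · k′)
    ·-cong {j , r} {j′ , r′} {l , w} {l′ , w′} (e , f) (e′ , f′) =
      c-trans (c-≡ (^-distribˡ-+-* u j l)) (c-trans (c-* e e′) (c-≡ (sym (^-distribˡ-+-* u j′ l′)))) ,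
      c-+ (c-* e′ f) f′

    r-inv : ∀ r → Cong L (r * pred L + r) 0
    r-inv r = ∣⇒c (divides r (trans (+-comm (r * pred L) r) (trans (sym (*-suc r (pred L))) (cong (r *_) (suc-pred L)))))

    invˡ : ∀ g → (inverse g · g) ∼ (0 , 0)
    invˡ (j , r) = c-trans (c-≡ (cong (u ^_) (+-comm (j * pred T) j))) (u^T* j) ,
      c-trans (c-+ (c-trans (c-≡ (trans (sym (*-assoc (u ^ j) (u ^ (j * pred T)) _)) (cong (_* (r * pred L)) (sym (^-distribˡ-+-* u j (j * pred T))))))
        (c-trans (c-*ʳ (r * pred L) (u^T* j)) (c-≡ (*-identityˡ (r * pred L))))) (c-refl {x = r})) (r-inv r)

    invʳ : ∀ g → (g · inverse g) ∼ (0 , 0)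
    invʳ (j , r) = u^T* j , c-trans (c-≡ (trans (sym (*-distribˡ-+ (u ^ (j * pred T)) r (r * pred L))) (cong (u ^ (j * pred T) *_) (+-comm r (r * pred L)))))
      (c-trans (c-*ˡ (u ^ (j * pred T)) (r-inv r)) (c-≡ (*-zeroʳ (u ^ (j * pred T)))))

    inv-cong : ∀ {g g′} → g ∼ g′ → inverse g ∼ inverse g′
    inv-cong {j , r} {j′ , r′} (e , f) = pw , c-* pw (c-*ʳ (pred L) f)
      where
      pw : Cong L (u ^ (j * pred T)) (u ^ (j′ * pred T))
      pw = c-trans (c-≡ (sym (^-*-assoc u j (pred T)))) (c-trans (c-^ (pred T) e) (c-≡ (^-*-assoc u j′ (pred T))))

    affine : Group 0ℓ 0ℓ
    affine = record
      { Carrier = ℕ × ℕ ; _≈_ = _∼_ ; _∙_ = _·_ ; ε = 0 , 0 ; _⁻¹ = inverse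
      ; isGroup = record
        { isMonoid = record
          { isSemigroup = record
            { isMagma = record
              { isEquivalence = record { refl = c-refl , c-refl ; sym = λ (e , f) → c-sym e , c-sym f
                ; trans = λ (e , f) (e′ , f′) → c-trans e e′ , c-trans f f′ }
              ; ∙-cong = λ {g} {g′} {k} {k′} → ·-cong {g} {g′} {k} {k′} }
            ; assoc = λ (i , r) (j , w) (k , y) → c-≡ (cong (u ^_) (+-assoc i j k)) ,
                c-≡ (trans (ring (u ^ k) (u ^ j) r w y) (cong (λ z → z * r + (u ^ k * w + y)) (sym (^-distribˡ-+-* u j k)))) }
          ; identity = (λ (j , r) → c-refl , c-≡ (cong (_+ r) (*-zeroʳ (u ^ j)))) ,
              (λ (j , r) → c-≡ (cong (u ^_) (+-identityʳ j)) , c-≡ (trans (+-identityʳ (1 * r)) (*-identityˡ r))) }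
        ; inverse = invˡ , invʳ
        ; ⁻¹-cong = λ {g} {g′} → inv-cong {g} {g′} } }
      where
      ring : ∀ U V r w y → U * (V * r + w) + y ≡ V * U * r + (U * w + y)
      ring = solve-∀

    W : ∃ λ w → ¬ p ∣ w × geom T ≡ T * w
    W = geom-p^ s

    V : ∃ λ v → Cong (p ^ suc Λ) (proj₁ W * v) 1
    V = inv-mod (suc Λ) (proj₁ W) (proj₁ (proj₂ W))

    -- The T-th power of β translates by v times `geom T`, that is by vTw with w a unit, and α^(p^t)
    -- translates by p^t q = p^(t ∸ s) T. Equating the two fixes v.
    v : ℕ
    v = p ^ (t ∸ s) * proj₁ V

    α β : ℕ × ℕ
    α = 0 , q
    β = 1 , v

    α^ : ∀ k → iterate _·_ (0 , 0) α k ≡ (0 , k * q)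
    α^ zero    = refl
    α^ (suc k) = trans (cong (α ·_) (α^ k)) (cong (λ z → 0 , z + k * q) (*-identityˡ q))

    β^ : ∀ k → iterate _·_ (0 , 0) β k ≡ (k , v * geom k)
    β^ zero    = cong (0 ,_) (sym (*-zeroʳ v))
    β^ (suc k) = trans (cong (β ·_) (β^ k)) (cong (suc k ,_) (trans (cong (_+ v * geom k) (*-comm (u ^ k) v)) (sym (*-distribˡ-+ v (u ^ k) (geom k)))))

    ∸-sym : t ∸ s + s ≡ s ∸ t + t
    ∸-sym with ≤-total s t
    ... | inj₁ s≤t = trans (m∸n+n≡m s≤t) (cong (_+ t) (sym (m≤n⇒m∸n≡0 s≤t)))
    ... | inj₂ t≤s = trans (cong (_+ s) (m≤n⇒m∸n≡0 t≤s)) (sym (m∸n+n≡m t≤s))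

    affine-rel : Rel p affine α β h s t (suc f)
    affine-rel = record
      { rel-α = subst (_∼ (0 , 0)) (sym (α^ (p ^ h))) (c-refl , ∣⇒c (∣-reflexive (^-distribˡ-+-* p h (s ∸ t))))
      ; rel-β = subst₂ _∼_ (sym (β^ T)) (sym (α^ (p ^ t))) (u^T , βT)
      ; rel-c = subst (λ z → (α · β) ∼ (β · z)) (sym (α^ u))
          (c-refl , c-≡ (trans (cong (λ z → z * q + v) (*-identityʳ u)) (trans (+-comm (u * q) v) (cong (_+ u * q) (sym (*-identityˡ v)))))) }
      where
      ring : ∀ a V T w → a * V * (T * w) ≡ w * V * (a * T)
      ring = solve-∀
      βT : Cong L (v * geom T) (p ^ t * q)
      βT = c-trans (c-≡ (trans (cong (v *_) (proj₂ (proj₂ W))) (ring (p ^ (t ∸ s)) (proj₁ V) T (proj₁ W))))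
        (c-trans (c-*ʳ (p ^ (t ∸ s) * T) (c-weaken (n∣m*n p) (proj₂ V))) (c-≡ (trans (*-identityˡ _) (trans (sym (^-distribˡ-+-* p (t ∸ s) s))
          (trans (cong (p ^_) ∸-sym) (trans (^-distribˡ-+-* p (s ∸ t) t) (*-comm q (p ^ t))))))))

    α-exact : ∀ k → iterate _·_ (0 , 0) α k ∼ (0 , 0) → p ^ h ∣ k
    α-exact k e = *-cancelʳ-∣ q {{pow-nz (s ∸ t)}} (subst (_∣ k * q) (^-distribˡ-+-* p h (s ∸ t))
      (c⇒∣ (proj₂ (subst (_∼ (0 , 0)) (α^ k) e))))

    -- For t ≤ s the translation v is a unit, so β^(p^k) translates by p^k times a unit.
    β-exact : t ≤ s → ∀ k → iterate _·_ (0 , 0) β (p ^ k) ∼ (0 , 0) → Λ ≤ k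
    β-exact t≤s k e = ^-∣⇒≤ (cancel-unit Λ (∤-* (proj₁ (proj₂ (geom-p^ k))) p∤v)
        (subst (L ∣_) (ring v (p ^ k) (proj₁ (geom-p^ k))) (subst (λ z → L ∣ v * z) (proj₂ (proj₂ (geom-p^ k)))
          (c⇒∣ (proj₂ (subst (_∼ (0 , 0)) (β^ (p ^ k)) e))))))
      where
      ring : ∀ v P w → v * (P * w) ≡ P * (w * v)
      ring = solve-∀
      p∤v : ¬ p ∣ v
      p∤v d = ∤-of-inverse {x = proj₁ W} (m∣m*n L) (proj₂ V) (subst (p ∣_)
        (trans (cong (λ z → p ^ z * proj₁ V) (m≤n⇒m∸n≡0 t≤s)) (*-identityˡ (proj₁ V))) d)

module Invariants (p : ℕ) (pr : Prime p) (2<p : 2 < p) where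
  open Arith p pr 2<p
  open CyclicNormal p pr 2<p
  open Classify p pr 2<p using (^-∣⇒≤)
  open Uniqueness p pr 2<p

  record HomMod (G : Group 0ℓ 0ℓ) (M : ℕ) (ψ : Group.Carrier G → ℕ) : Set where
    open Powers G
    field
      resp : ∀ {g k} → g ≈ k → Cong (p ^ M) (ψ g) (ψ k)
      ψ-∙  : ∀ g k → Cong (p ^ M) (ψ (g ∙ k)) (ψ g + ψ k)

    ψ-ε : Cong (p ^ M) (ψ ε) 0
    ψ-ε = c-+-cancelʳ (ψ ε) (c-trans (c-sym (ψ-∙ ε ε)) (resp (identityˡ ε)))

    ψ-↑ : ∀ g k → Cong (p ^ M) (ψ (g ↑ k)) (k * ψ g)
    ψ-↑ g zero    = ψ-ε
    ψ-↑ g (suc k) = c-trans (ψ-∙ g (g ↑ k)) (c-+ (c-refl {x = ψ g}) (ψ-↑ g k))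

  weakenHom : ∀ {G M M′ ψ} → M′ ≤ M → HomMod G M ψ → HomMod G M′ ψ
  weakenHom le H = record { resp = λ e → c-weaken (^-∣ p le) (HomMod.resp H e) ; ψ-∙ = λ g k → c-weaken (^-∣ p le) (HomMod.ψ-∙ H g k) }

  record Metacyclic (G : Group 0ℓ 0ℓ) (h s t f : ℕ) : Set₁ where
    open Powers G
    field
      α β       : Carrier
      relations : Rel p G α β h s t (suc f)
      generate  : ∀ g → Σ (Word G) λ w → eval G α β w ≈ g
      universal : ∀ H (α′ β′ : Group.Carrier H) → Rel p H α′ β′ h s t (suc f) →
        Σ (Carrier → Group.Carrier H) λ φ → GroupMorphisms.IsGroupHomomorphism (Group.rawGroup G) (Group.rawGroup H) φ
          × Group._≈_ H (φ α) α′ × Group._≈_ H (φ β) β′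

  module _ (G : Group 0ℓ 0ℓ) where
    open Powers G

    module Facts (h s t f e : ℕ) (par : Parameters h s t f e) (D : Metacyclic G h s t f) where
      open Parameters par
      open Metacyclic D
      open Rel relations
      open Commutators p pr 2<p G

      instance
        h-nz : NonZero (p ^ h)
        h-nz = pow-nz h

      α^∣ : ∀ {k} → p ^ h ∣ k → α ↑ k ≈ ε
      α^∣ = ↑-∣ {α} {p ^ h} rel-α

      β-order : β ↑ (p ^ s * p ^ h) ≈ ε
      β-order = ≈-trans (↑-*′ β (p ^ s) (p ^ h)) (≈-trans (↑-cong (p ^ h) rel-β)
        (≈-trans (≈-sym (↑-*′ α (p ^ t) (p ^ h))) (α^∣ (n∣m*n (p ^ t)))))

      open Span G α β (1 + p ^ suc f) rel-c

      span-inv : ∀ {k} → InSpan k → InSpan (k ⁻¹)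
      span-inv {k} (j , i , e) = span-≈ (≈-sym (inverseˡ-unique k′ k (begin
          (α ↑ i′ ∙ β ↑ j′) ∙ k                     ≈⟨ ∙-congˡ e ⟩
          (α ↑ i′ ∙ β ↑ j′) ∙ (β ↑ j ∙ α ↑ i)       ≈⟨ ≈-trans (assoc _ _ _) (∙-congˡ (≈-sym (assoc _ _ _))) ⟩
          α ↑ i′ ∙ ((β ↑ j′ ∙ β ↑ j) ∙ α ↑ i)       ≈⟨ ∙-congˡ (∙-congʳ (↑-inv′ {β} {p ^ s * p ^ h} j β-order)) ⟩
          α ↑ i′ ∙ (ε ∙ α ↑ i)                      ≈⟨ ∙-congˡ (identityˡ _) ⟩
          α ↑ i′ ∙ α ↑ i                            ≈⟨ ↑-inv′ {α} {p ^ h} i rel-α ⟩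
          ε                                         ∎)))
          (span-∙ (span-c i′) (span-g j′))
        where
        open R
        open GroupProperties G using (inverseˡ-unique)
        instance
          nz : NonZero (p ^ s * p ^ h)
          nz = m*n≢0 (p ^ s) (p ^ h) {{pow-nz s}} {{pow-nz h}}
        i′ j′ : ℕ
        i′ = i * pred (p ^ h)
        j′ = j * pred (p ^ s * p ^ h)
        k′ : Carrier
        k′ = α ↑ i′ ∙ β ↑ j′

      span-eval : ∀ w → InSpan (eval G α β w)
      span-eval gen-a     = span-≈ (≈-sym (↑-1 α)) (span-c 1)
      span-eval gen-b     = span-≈ (≈-sym (↑-1 β)) (span-g 1)
      span-eval one       = span-g 0
      span-eval (inv w)   = span-inv (span-eval w)
      span-eval (mul w v) = span-∙ (span-eval w) (span-eval v)

      spanned : ∀ g → InSpan g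
      spanned g = span-≈ (≈-sym (proj₂ (generate g))) (span-eval (proj₁ (generate g)))

      q : Carrier
      -- The trailing `ε` is the power z^0 in the general shape c^(pw) z^u of `Derived`.
      q = α ↑ (p ^ suc f) ∙ ε

      q≈ : q ≈ α ↑ (p ^ suc f)
      q≈ = identityʳ _

      q-order : ∀ k → p ^ h ∣ p ^ suc f * k → q ↑ k ≈ ε
      q-order k d = ≈-trans (↑-cong k q≈) (≈-trans (≈-sym (↑-*′ α (p ^ suc f) k)) (α^∣ d))

      q-ord : q ↑ (p ^ h) ≈ ε
      q-ord = q-order (p ^ h) (n∣m*n (p ^ suc f))

      derived : CyclicDerived q
      derived = Derived.cyclicDerived G β α ε (p ^ f) 0 (p ^ h) q-ord
        (λ k → ≈-trans (identityˡ k) (≈-sym (identityʳ k)))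
        (≈-trans rel-c (∙-congˡ (∙-congˡ (≈-sym q≈))))
        (λ k → proj₁ (spanned k) , proj₁ (proj₂ (spanned k)) , 0 , ≈-trans (proj₂ (proj₂ (spanned k))) (≈-sym (identityʳ _)))

      -- The element z ranges over all commutators of G, so the bound makes no reference to the
      -- presentation. Together with `commutator-exact` it makes h - f - 1 an invariant.
      commutator-exponent : ∀ g k z → k ∙ g ≈ g ∙ (k ∙ z) → z ↑ (p ^ (h ∸ suc f)) ≈ ε
      commutator-exponent g k z eq = ≈-trans (↑-cong (p ^ (h ∸ suc f)) z≈) (≈-trans (≈-sym (↑-*′ q r (p ^ (h ∸ suc f))))
        (q-order (r * p ^ (h ∸ suc f)) (divides r (trans (ring (p ^ suc f) r (p ^ (h ∸ suc f))) (cong (r *_)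
          (trans (sym (^-distribˡ-+-* p (suc f) (h ∸ suc f))) (cong (p ^_) (m+[n∸m]≡n f≤h))))))))
        where
        r : ℕ
        r = proj₁ (CyclicDerived.comm derived g k)
        z≈ : z ≈ q ↑ r
        z≈ = ∙-cancelˡ k _ _ (∙-cancelˡ g _ _ (≈-trans (≈-sym eq) (proj₂ (CyclicDerived.comm derived g k))))
        ring : ∀ P r K → P * (r * K) ≡ r * (P * K)
        ring = solve-∀

      β^pᵉ : β ↑ (p ^ e) ≈ ε
      β^pᵉ = ≈-trans (↑-≡ β (trans (cong (p ^_) (sym (m+[n∸m]≡n s≤e))) (^-distribˡ-+-* p s (e ∸ s))))
        (≈-trans (↑-*′ β (p ^ s) (p ^ (e ∸ s))) (≈-trans (↑-cong (p ^ (e ∸ s)) rel-β)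
          (≈-trans (≈-sym (↑-*′ α (p ^ t) (p ^ (e ∸ s)))) (α^∣ (subst (p ^ h ∣_) (^-distribˡ-+-* p t (e ∸ s)) (^-∣ p h≤t+))))))

      -- The power formula for products reduces this to β, α and q separately; for β, the power
      -- α^(p^(t + e - s)) has to vanish, which is `h≤t+`.
      exponent : ∀ g → g ↑ (p ^ e) ≈ ε
      exponent g = ≈-trans (↑-cong (p ^ e) (proj₂ (proj₂ (spanned g)))) (≈-trans (proj₂ pp)
        (≈-trans (∙-cong (swap-ε β j β^pᵉ) (≈-trans (∙-cong (swap-ε α i (α^∣ (^-∣ p h≤e)))
          (↑-∣ {q} {p ^ h} q-ord (∣m⇒∣m*n (proj₁ pp) (^-∣ p h≤e)))) (identityˡ ε))) (identityˡ ε)))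
        where
        j i : ℕ
        j = proj₁ (spanned g)
        i = proj₁ (proj₂ (spanned g))
        pp : ∃ λ r → (β ↑ j ∙ α ↑ i) ↑ (p ^ e) ≈ (β ↑ j) ↑ (p ^ e) ∙ ((α ↑ i) ↑ (p ^ e) ∙ q ↑ (p ^ e * r))
        pp = prod-p^ (p ^ h) q-ord (CyclicDerived.loc derived (β ↑ j) (α ↑ i)) e
        swap-ε : ∀ x k → x ↑ (p ^ e) ≈ ε → (x ↑ k) ↑ (p ^ e) ≈ ε
        swap-ε x k eq = ≈-trans (≈-sym (↑-*′ x k (p ^ e))) (↑-ε (p ^ e) k eq)

      hom-↑ : ∀ H (φ : Carrier → Group.Carrier H) → GroupMorphisms.IsGroupHomomorphism (Group.rawGroup G) (Group.rawGroup H) φ →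
        ∀ g g′ → Group._≈_ H (φ g) g′ → ∀ k → g ↑ k ≈ ε → Group._≈_ H (Powers._↑_ H g′ k) (Group.ε H)
      hom-↑ H φ hom g g′ eq k e = H.≈-trans (H.≈-sym (go k)) (H.≈-trans (⟦⟧-cong e) ε-homo)
        where
        module H = Powers H
        open GroupMorphisms.IsGroupHomomorphism hom using (⟦⟧-cong; homo; ε-homo)
        go : ∀ k → φ (g ↑ k) H.≈ g′ H.↑ k
        go zero    = ε-homo
        go (suc k) = H.≈-trans (homo g (g ↑ k)) (H.∙-cong eq (go k))

      private module A = Affine h s t f h≤f+s

      U = universal A.affine A.α A.β A.affine-rel

      α-exact : ∀ k → α ↑ k ≈ ε → p ^ h ∣ k
      α-exact k eq = A.α-exact k (hom-↑ A.affine (proj₁ U) (proj₁ (proj₂ U)) α A.α (proj₁ (proj₂ (proj₂ U))) k eq)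

      -- The exponent is attained by α if e ≤ h, and otherwise by β, whose order is bounded below in
      -- the affine model.
      exponent-exact : ∀ k → (∀ g → g ↑ (p ^ k) ≈ ε) → e ≤ k
      exponent-exact k ex = by-e e≤
        where
        by-e : e ≤ h ⊎ (t ≤ s × e ≤ h + (s ∸ t)) → e ≤ k
        by-e (inj₁ e≤h)         = ≤-trans e≤h (^-∣⇒≤ (α-exact (p ^ k) (ex α)))
        by-e (inj₂ (t≤s , e≤Λ)) = ≤-trans e≤Λ (A.β-exact t≤s k
          (hom-↑ A.affine (proj₁ U) (proj₁ (proj₂ U)) β A.β (proj₂ (proj₂ (proj₂ U))) (p ^ k) (ex β)))

      commutator-exact : ∀ κ → (∀ g k z → k ∙ g ≈ g ∙ (k ∙ z) → z ↑ (p ^ κ) ≈ ε) → h ∸ suc f ≤ κ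
      commutator-exact κ ex = m≤n+o⇒m∸n≤o h (suc f) (^-∣⇒≤ (subst (p ^ h ∣_) (sym (^-distribˡ-+-* p (suc f) κ))
        (α-exact (p ^ suc f * p ^ κ) (≈-trans (↑-*′ α (p ^ suc f) (p ^ κ)) (ex β α (α ↑ (p ^ suc f)) rel-c)))))

      module _ {M ψ} (Ψ : HomMod G M ψ) where
        open HomMod Ψ

        ψ-span : ∀ g → Cong (p ^ M) (ψ g) (proj₁ (spanned g) * ψ β + proj₁ (proj₂ (spanned g)) * ψ α)
        ψ-span g = c-trans (resp (proj₂ (proj₂ (spanned g)))) (c-trans (ψ-∙ _ _) (c-+ (ψ-↑ β (proj₁ (spanned g))) (ψ-↑ α (proj₁ (proj₂ (spanned g))))))

        -- By `rel-c`, α^(p^(f+1)) is a commutator, so it vanishes under every homomorphism to an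
        -- abelian group.
        ψ-α : p ^ M ∣ p ^ suc f * ψ α
        ψ-α = c⇒∣ (c-trans (c-sym (ψ-↑ α (p ^ suc f))) (c-+-cancelˡ (ψ β + ψ α) (c-trans (c-≡ (+-assoc (ψ β) (ψ α) _))
          (c-trans (c-+ (c-refl {x = ψ β}) (c-sym (ψ-∙ α _))) (c-trans (c-sym (ψ-∙ β _)) (c-trans (resp (≈-sym rel-c))
            (c-trans (ψ-∙ α β) (c-≡ (trans (+-comm (ψ α) (ψ β)) (sym (+-identityʳ (ψ β + ψ α))))))))))))

        ψ-β : p ^ M ∣ p ^ s * ψ β
        ψ-β = c⇒∣ (c-trans (c-sym (ψ-↑ β (p ^ s))) (c-trans (resp rel-β) (c-trans (ψ-↑ α (p ^ t)) (∣⇒c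
          (∣-trans ψ-α (*-monoˡ-∣ (ψ α) (^-∣ p f≤t)))))))

        ψ-exponent : ∀ mx → suc f ≤ mx → s ≤ mx → ∀ g → p ^ M ∣ p ^ mx * ψ g
        ψ-exponent mx f≤mx s≤mx g = c-∣ (c-*ˡ (p ^ mx) (ψ-span g)) (subst (p ^ M ∣_) (sym (*-distribˡ-+ (p ^ mx) (j * ψ β) (i * ψ α)))
          (∣m∣n⇒∣m+n (part j (ψ β) (∣-trans ψ-β (*-monoˡ-∣ (ψ β) (^-∣ p s≤mx)))) (part i (ψ α) (∣-trans ψ-α (*-monoˡ-∣ (ψ α) (^-∣ p f≤mx))))))
          where
          j i : ℕ
          j = proj₁ (spanned g)
          i = proj₁ (proj₂ (spanned g))
          part : ∀ j x → p ^ M ∣ p ^ mx * x → p ^ M ∣ p ^ mx * (j * x)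
          part j x d = subst (p ^ M ∣_) (ring j (p ^ mx) x) (∣n⇒∣m*n j d)
            where
            ring : ∀ j P x → j * (P * x) ≡ P * (j * x)
            ring = solve-∀

      -- If k exceeded f + 1 (or s), both functionals would kill α (or β) modulo p, hence be proportional modulo p.
      rank-bound : ∀ k ψ₁ ψ₂ → HomMod G k ψ₁ → HomMod G k ψ₂ → ∀ g₁ g₂ → Cong (p ^ k) (ψ₁ g₁) 1 → Cong (p ^ k) (ψ₂ g₁) 0 →
        Cong (p ^ k) (ψ₁ g₂) 0 → Cong (p ^ k) (ψ₂ g₂) 1 → k ≤ suc f × k ≤ s
      rank-bound k ψ₁ ψ₂ Ψ₁ Ψ₂ g₁ g₂ e₁₁ e₂₁ e₁₂ e₂₂ = bound-f (≤-<-connex k (suc f)) , bound-s (≤-<-connex k s)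
        where
        small : ∀ {l x} → l < k → p ^ k ∣ p ^ l * x → p ∣ x
        small {l} {x} l<k d = *-cancelˡ-∣ (p ^ l) {{pow-nz l}} (subst (_∣ p ^ l * x) (*-comm p (p ^ l)) (∣-trans (^-∣ p l<k) d))
        dependent : ∀ {c₁ c₂ n n′} → Cong p (n * c₁) 1 → Cong p (n * c₂) 0 → Cong p (n′ * c₂) 1 → ⊥
        dependent {c₁} {c₂} {n} {n′} a b c = by (euclidsLemma n c₂ pr (c⇒∣ b))
          where
          by : p ∣ n ⊎ p ∣ c₂ → ⊥
          by (inj₁ d) = p∤1 (c-∣ (c-sym a) (∣m⇒∣m*n c₁ d))
          by (inj₂ d) = p∤1 (c-∣ (c-sym c) (∣n⇒∣m*n n′ d))
        module _ (l : ℕ) (l<k : l < k) where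
          p∣p^k : p ∣ p ^ k
          p∣p^k = subst (_∣ p ^ k) (*-identityʳ p) (^-∣ p (≤-trans (s≤s z≤n) l<k))
          reduceβ : ∀ {ψ x} (Ψ : HomMod G k ψ) → p ∣ ψ α → ∀ g → Cong (p ^ k) (ψ g) x → Cong p (proj₁ (spanned g) * ψ β) x
          reduceβ Ψ d g c = c-trans (c-sym (∣⇒c+ʳ _ (∣n⇒∣m*n (proj₁ (proj₂ (spanned g))) d))) (c-weaken p∣p^k (c-trans (c-sym (ψ-span Ψ g)) c))
          reduceα : ∀ {ψ x} (Ψ : HomMod G k ψ) → p ∣ ψ β → ∀ g → Cong (p ^ k) (ψ g) x → Cong p (proj₁ (proj₂ (spanned g)) * ψ α) x
          reduceα Ψ d g c = c-trans (c-sym (∣⇒c+ _ (∣n⇒∣m*n (proj₁ (spanned g)) d))) (c-weaken p∣p^k (c-trans (c-sym (ψ-span Ψ g)) c))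
        bound-f : k ≤ suc f ⊎ suc f < k → k ≤ suc f
        bound-f (inj₁ le) = le
        bound-f (inj₂ lt) = ⊥-elim (dependent {ψ₁ β} {ψ₂ β} {proj₁ (spanned g₁)} {proj₁ (spanned g₂)}
          (reduceβ (suc f) lt Ψ₁ (small lt (ψ-α Ψ₁)) g₁ e₁₁) (reduceβ (suc f) lt Ψ₂ (small lt (ψ-α Ψ₂)) g₁ e₂₁)
          (reduceβ (suc f) lt Ψ₂ (small lt (ψ-α Ψ₂)) g₂ e₂₂))
        bound-s : k ≤ s ⊎ s < k → k ≤ s
        bound-s (inj₁ le) = le
        bound-s (inj₂ lt) = ⊥-elim (dependent {ψ₁ α} {ψ₂ α} {proj₁ (proj₂ (spanned g₁))} {proj₁ (proj₂ (spanned g₂))}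
          (reduceα s lt Ψ₁ (small lt (ψ-β Ψ₁)) g₁ e₁₁) (reduceα s lt Ψ₂ (small lt (ψ-β Ψ₂)) g₁ e₂₁)
          (reduceα s lt Ψ₂ (small lt (ψ-β Ψ₂)) g₂ e₂₂))

      -- The universal property turns three congruences into a homomorphism to ℤ/p^M; the cyclic
      -- factors ℤ/p^(f+1) and ℤ/p^s of G / G′ arise in this way.
      module Coordinates (M : ℕ) (α₀ β₀ : ℕ) (rα : Cong (p ^ M) (p ^ h * α₀) 0)
          (rβ : Cong (p ^ M) (p ^ s * β₀) (p ^ t * α₀))
        (rc : Cong (p ^ M) (p ^ suc f * α₀) 0) where
        instance
          M-nz : NonZero (p ^ M)
          M-nz = pow-nz M

        rel₀ : Rel p (ℤ/ (p ^ M)) α₀ β₀ h s t (suc f)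
        rel₀ = record
          { rel-α = subst (λ z → Cong (p ^ M) z 0) (sym (iterate-+ α₀ (p ^ h))) rα
          ; rel-β = subst₂ (Cong (p ^ M)) (sym (iterate-+ β₀ (p ^ s))) (sym (iterate-+ α₀ (p ^ t))) rβ
          ; rel-c = c-trans (c-≡ (+-comm α₀ β₀)) (c-+ (c-refl {x = β₀}) (c-sym (c-trans (c-+ (c-refl {x = α₀})
              (c-trans (c-≡ (iterate-+ α₀ (p ^ suc f))) rc)) (c-≡ (+-identityʳ α₀))))) }

        V = universal (ℤ/ (p ^ M)) α₀ β₀ rel₀

        hom : HomMod G M (proj₁ V)
        hom = record { resp = ⟦⟧-cong ; ψ-∙ = homo }
          where open GroupMorphisms.IsGroupHomomorphism (proj₁ (proj₂ V)) using (⟦⟧-cong; homo)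

      coordinates : ∃₂ λ ψ₁ ψ₂ → HomMod G (suc f) ψ₁ × HomMod G s ψ₂ × Cong (p ^ suc f) (ψ₁ α) 1 × Cong (p ^ suc f) (ψ₁ β) 0 ×
        Cong (p ^ s) (ψ₂ α) 0 × Cong (p ^ s) (ψ₂ β) 1
      coordinates = proj₁ C₁.V , proj₁ C₂.V , C₁.hom , C₂.hom ,
        proj₁ (proj₂ (proj₂ C₁.V)) , proj₂ (proj₂ (proj₂ C₁.V)) , proj₁ (proj₂ (proj₂ C₂.V)) , proj₂ (proj₂ (proj₂ C₂.V))
        where
        module C₁ = Coordinates (suc f) 1 0 (∣⇒c (∣m⇒∣m*n 1 (^-∣ p f≤h)))
          (c-trans (c-≡ (*-zeroʳ (p ^ s))) (c-sym (∣⇒c (∣m⇒∣m*n 1 (^-∣ p f≤t))))) (∣⇒c (m∣m*n 1))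
        module C₂ = Coordinates s 0 1 (c-≡ (*-zeroʳ (p ^ h)))
          (c-trans (∣⇒c (m∣m*n 1)) (c-≡ (sym (*-zeroʳ (p ^ t))))) (c-≡ (*-zeroʳ (p ^ suc f)))

-- Recovering the family and its parameters from the invariants

module Recovery (p : ℕ) (pr : Prime p) (2<p : 2 < p) where
  open Arith p pr 2<p
  open Classify p pr 2<p using (^-∣⇒≤)
  open Uniqueness p pr 2<p
  open Invariants p pr 2<p

  -- Written with h = d + g and e = d + g + k, so that truncated subtractions cancel; here s = d + e
  -- - h becomes d + k.
  M₃-parameters : ∀ d g k f → g ≤ suc f → suc f < d → Parameters (d + g) (d + k) d f (d + g + k)
  M₃-parameters d g k f g≤f f<d = record
    { f≤h = ≤-trans (<⇒≤ f<d) (m≤m+n d g)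
    ; f≤t = <⇒≤ f<d
    ; h≤e = m≤m+n (d + g) k
    ; s≤e = +-monoˡ-≤ k (m≤m+n d g)
    ; h≤f+s = subst₂ _≤_ (cong (d + g +_) (sym (m+n∸m≡n d k))) (+-assoc (suc f) d k)
        (+-monoˡ-≤ k (subst (d + g ≤_) (+-comm d (suc f)) (+-monoʳ-≤ d g≤f)))
    ; h≤t+ = ≤-reflexive (cong (d +_) (sym (trans (cong (_∸ (d + k)) (ring d g k)) (m+n∸m≡n (d + k) g))))
    ; e≤ = inj₂ (m≤m+n d k , ≤-reflexive (cong (d + g +_) (sym (m+n∸m≡n d k)))) }
    where
    ring : ∀ d g k → d + g + k ≡ d + k + g
    ring = solve-∀

  M₁-parameters : ∀ d e f → suc f ≤ e → d ≤ e → e ≤ d + suc f → Parameters e d e f e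
  M₁-parameters d e f f≤e d≤e e≤d+f = record
    { f≤h = f≤e ; f≤t = f≤e ; h≤e = ≤-refl ; s≤e = d≤e
    ; h≤f+s = subst₂ _≤_ (sym (trans (cong (e +_) (m≤n⇒m∸n≡0 d≤e)) (+-identityʳ e))) (+-comm d (suc f)) e≤d+f
    ; h≤t+ = m≤m+n e (e ∸ d) ; e≤ = inj₁ ≤-refl }

  parameters : ∀ F → Admissible F → ∃ λ f → fOf F ≡ suc f × Parameters (hOf F) (sOf F) (tOf F) f (eOf F)
  parameters (M₁ d e zero) (inj₁ (1≤d , d≤f , _)) = ⊥-elim (<⇒≱ 1≤d d≤f)
  parameters (M₁ d e (suc f)) (inj₁ (1≤d , d≤f , f≤e , le)) = f , refl , M₁-parameters d e f f≤e (≤-trans d≤f f≤e) le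
  parameters (M₁ d e (suc f)) (inj₂ (_ , f<d , d≤e , le)) = f , refl , M₁-parameters d e f (≤-trans (<⇒≤ f<d) d≤e) d≤e le
  parameters (M₂ d e (suc f)) (_ , f<d , d<e) = f , refl , record
    { f≤h = <⇒≤ f<d ; f≤t = <⇒≤ f<d ; h≤e = <⇒≤ d<e ; s≤e = ≤-refl
    ; h≤f+s = ≤-trans (≤-reflexive (m+[n∸m]≡n (<⇒≤ d<e))) (m≤n+m e (suc f))
    ; h≤t+ = m≤m+n d (e ∸ e)
    ; e≤ = inj₂ (<⇒≤ d<e , ≤-reflexive (sym (m+[n∸m]≡n (<⇒≤ d<e)))) }
  parameters (M₃ d e h zero) (h∸d≤f , _ , d<h , _) = ⊥-elim (<⇒≱ (m<n⇒0<n∸m d<h) h∸d≤f)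
  parameters (M₃ d e h (suc f)) (h∸d≤f , f<d , d<h , h<e) = f , refl ,
    subst₂ (λ h′ e′ → Parameters h′ (d + e ∸ h) d f e′) h≡ (trans (cong (_+ (e ∸ h)) h≡) (m+[n∸m]≡n (<⇒≤ h<e)))
      (subst (λ s → Parameters (d + (h ∸ d)) s d f (d + (h ∸ d) + (e ∸ h))) (sym (+-∸-assoc d (<⇒≤ h<e)))
        (M₃-parameters d (h ∸ d) (e ∸ h) f h∸d≤f f<d))
    where
    h≡ : d + (h ∸ d) ≡ h
    h≡ = m+[n∸m]≡n (<⇒≤ d<h)

  metacyclic : ∀ {G} F {f} → fOf F ≡ suc f → Presents G (rels p F) → Metacyclic G (hOf F) (sOf F) (tOf F) f
  metacyclic {G} F eq (α , β , r , generate , universal) = record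
    { α = α ; β = β
    ; relations = subst (Rel p G α β (hOf F) (sOf F) (tOf F)) eq (rels⇒Rel p G α β F r)
    ; generate = generate
    ; universal = λ H α′ β′ r′ → universal H α′ β′ (Rel⇒rels p H α′ β′ F (subst (Rel p H α′ β′ (hOf F) (sOf F) (tOf F)) (sym eq) r′)) }

  module _ {G : Group 0ℓ 0ℓ} where

    -- Only inequalities are proved: one presentation supplies what annihilates, the other elements
    -- and homomorphisms that attain its parameters. Exchanging the two gives equality.
    compare : ∀ {h s t f e h′ s′ t′ f′ e′} → Parameters h s t f e → Metacyclic G h s t f →
      Parameters h′ s′ t′ f′ e′ → Metacyclic G h′ s′ t′ f′ →
      e′ ≤ e × h′ ∸ suc f′ ≤ h ∸ suc f × suc f′ ⊔ s′ ≤ suc f ⊔ s × suc f′ ⊓ s′ ≤ suc f ⊓ s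
    compare {h} {s} {t} {f} {e} {h′} {s′} {t′} {f′} {e′} par D par′ D′ =
      X′.exponent-exact e X.exponent ,
      X′.commutator-exact (h ∸ suc f) X.commutator-exponent ,
      invariants X′.coordinates
      where
      module X = Facts G h s t f e par D
      module X′ = Facts G h′ s′ t′ f′ e′ par′ D′
      open Metacyclic D′ using (α; β)
      mx k : ℕ
      mx = suc f ⊔ s
      k = suc f′ ⊓ s′
      unit-bound : ∀ {M ψ} → HomMod G M ψ → ∀ g → Cong (p ^ M) (ψ g) 1 → M ≤ mx
      unit-bound Ψ g c = ^-∣⇒≤ (c-∣ (c-trans (c-≡ (sym (*-identityʳ (p ^ mx)))) (c-*ˡ (p ^ mx) (c-sym c)))
        (X.ψ-exponent Ψ mx (m≤m⊔n (suc f) s) (m≤n⊔m (suc f) s) g))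
      invariants : (∃₂ λ ψ₁ ψ₂ → HomMod G (suc f′) ψ₁ × HomMod G s′ ψ₂ × Cong (p ^ suc f′) (ψ₁ α) 1 × Cong (p ^ suc f′) (ψ₁ β) 0 ×
        Cong (p ^ s′) (ψ₂ α) 0 × Cong (p ^ s′) (ψ₂ β) 1) → suc f′ ⊔ s′ ≤ suc f ⊔ s × suc f′ ⊓ s′ ≤ suc f ⊓ s
      invariants (ψ₁ , ψ₂ , Ψ₁ , Ψ₂ , a₁ , b₁ , a₂ , b₂) =
        ⊔-lub (unit-bound Ψ₁ α a₁) (unit-bound Ψ₂ β b₂) , ⊓-glb (proj₁ rb) (proj₂ rb)
        where
        k≤f : k ≤ suc f′
        k≤f = m⊓n≤m (suc f′) s′
        k≤s : k ≤ s′
        k≤s = m⊓n≤n (suc f′) s′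
        rb : k ≤ suc f × k ≤ s
        rb = X.rank-bound k ψ₁ ψ₂ (weakenHom k≤f Ψ₁) (weakenHom k≤s Ψ₂) α β
          (c-weaken (^-∣ p k≤f) a₁) (c-weaken (^-∣ p k≤s) a₂) (c-weaken (^-∣ p k≤f) b₁) (c-weaken (^-∣ p k≤s) b₂)

    compareF : ∀ F F′ → Admissible F → Admissible F′ → Presents G (rels p F) → Presents G (rels p F′) →
      eOf F′ ≤ eOf F × hOf F′ ∸ fOf F′ ≤ hOf F ∸ fOf F × fOf F′ ⊔ sOf F′ ≤ fOf F ⊔ sOf F × fOf F′ ⊓ sOf F′ ≤ fOf F ⊓ sOf F
    compareF F F′ A A′ P P′ = go (parameters F A) (parameters F′ A′)
      where
      Goal : ℕ → ℕ → Set
      Goal f f′ = eOf F′ ≤ eOf F × hOf F′ ∸ f′ ≤ hOf F ∸ f × f′ ⊔ sOf F′ ≤ f ⊔ sOf F × f′ ⊓ sOf F′ ≤ f ⊓ sOf F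
      go : (∃ λ f → fOf F ≡ suc f × Parameters (hOf F) (sOf F) (tOf F) f (eOf F)) →
        (∃ λ f → fOf F′ ≡ suc f × Parameters (hOf F′) (sOf F′) (tOf F′) f (eOf F′)) → Goal (fOf F) (fOf F′)
      go (f , eq , par) (f′ , eq′ , par′) = subst₂ Goal (sym eq) (sym eq′)
        (compare par (metacyclic F eq P) par′ (metacyclic F′ eq′ P′))

-- The arguments `mn` and `mx` are the minimum and maximum of f and s. If d ≤ `mn`, then f ≥ d = s,
-- which happens only in the first family. Otherwise f < d ≤ s, so `mn` is f and `mx` is s; and s is
-- d, e or strictly between them in the three families respectively.
recover : (d e mn mx : ℕ) → Family
recover d e mn mx with d ≤? mn | mx ≟ d | mx ≟ e
... | yes _ | _     | _     = M₁ d e mx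
... | no _  | yes _ | _     = M₁ d e mn
... | no _  | no _  | yes _ = M₂ d e mn
... | no _  | no _  | no _  = M₃ d e (d + e ∸ mx) mn

recover-small : ∀ d e mn mx → d ≤ mn → recover d e mn mx ≡ M₁ d e mx
recover-small d e mn mx le with d ≤? mn | mx ≟ d | mx ≟ e
... | yes _ | _     | _     = refl
... | no h  | _     | _     = ⊥-elim (h le)

recover-M₁ : ∀ d e mn → mn < d → recover d e mn d ≡ M₁ d e mn
recover-M₁ d e mn lt with d ≤? mn | d ≟ d | d ≟ e
... | yes h | _     | _     = ⊥-elim (<⇒≱ lt h)
... | no _  | yes _ | _     = refl
... | no _  | no h  | _     = ⊥-elim (h refl)

recover-M₂ : ∀ d e mn → mn < d → d < e → recover d e mn e ≡ M₂ d e mn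
recover-M₂ d e mn lt d<e with d ≤? mn | e ≟ d | e ≟ e
... | yes h | _     | _     = ⊥-elim (<⇒≱ lt h)
... | no _  | yes h | _     = ⊥-elim (<⇒≢ d<e (sym h))
... | no _  | no _  | yes _ = refl
... | no _  | no _  | no h  = ⊥-elim (h refl)

recover-M₃ : ∀ d e h mn → mn < d → d < h → h < e → recover d e mn (d + e ∸ h) ≡ M₃ d e h mn
recover-M₃ d e h mn lt d<h h<e with d ≤? mn | d + e ∸ h ≟ d | d + e ∸ h ≟ e
... | yes k | _     | _     = ⊥-elim (<⇒≱ lt k)
... | no _  | yes k | _     = ⊥-elim (<⇒≢ h<e (sym (+-cancelˡ-≡ d e h (trans (sym (m∸n+n≡m (≤-trans (<⇒≤ h<e) (m≤n+m e d)))) (cong (_+ h) k)))))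
... | no _  | no _  | yes k = ⊥-elim (<⇒≢ d<h (+-cancelʳ-≡ e d h (trans (sym (m∸n+n≡m (≤-trans (<⇒≤ h<e) (m≤n+m e d)))) (trans (cong (_+ h) k) (+-comm e h)))))
... | no _  | no _  | no _  = cong (λ h → M₃ d e h mn) (m∸[m∸n]≡n (≤-trans (<⇒≤ h<e) (m≤n+m e d)))

recover-correct : ∀ F → Admissible F → recover (dOf F) (eOf F) (fOf F ⊓ sOf F) (fOf F ⊔ sOf F) ≡ F
recover-correct (M₁ d e f) (inj₁ (_ , d≤f , _)) = trans (cong₂ (recover d e) (m≥n⇒m⊓n≡n d≤f) (m≥n⇒m⊔n≡m d≤f))
  (recover-small d e d f ≤-refl)
recover-correct (M₁ d e f) (inj₂ (_ , f<d , _)) = trans (cong₂ (recover d e) (m≤n⇒m⊓n≡m (<⇒≤ f<d)) (m≤n⇒m⊔n≡n (<⇒≤ f<d)))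
  (recover-M₁ d e f f<d)
recover-correct (M₂ d e f) (_ , f<d , d<e) = trans (cong₂ (recover d e) (m≤n⇒m⊓n≡m f≤e) (m≤n⇒m⊔n≡n f≤e))
  (recover-M₂ d e f f<d d<e)
  where
  f≤e : f ≤ e
  f≤e = ≤-trans (<⇒≤ f<d) (<⇒≤ d<e)
recover-correct (M₃ d e h f) (_ , f<d , d<h , h<e) = trans (cong₂ (recover d e) (m≤n⇒m⊓n≡m f≤s) (m≤n⇒m⊔n≡n f≤s))
  (recover-M₃ d e h f f<d d<h h<e)
  where
  f≤s : f ≤ d + e ∸ h
  f≤s = ≤-trans (<⇒≤ f<d) (≤-trans (m≤m+n d (e ∸ h)) (≤-reflexive (sym (+-∸-assoc d (<⇒≤ h<e)))))

d+e≡h+s : ∀ F → Admissible F → dOf F + eOf F ≡ hOf F + sOf F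
d+e≡h+s (M₁ d e f)   _ = +-comm d e
d+e≡h+s (M₂ d e f)   _ = refl
d+e≡h+s (M₃ d e h f) (_ , _ , _ , h<e) = sym (m+[n∸m]≡n (≤-trans (<⇒≤ h<e) (m≤n+m e d)))

f≤hOf : ∀ F → Admissible F → fOf F ≤ hOf F
f≤hOf (M₁ d e f)   (inj₁ (_ , _ , f≤e , _))   = f≤e
f≤hOf (M₁ d e f)   (inj₂ (_ , f<d , d≤e , _)) = ≤-trans (<⇒≤ f<d) d≤e
f≤hOf (M₂ d e f)   (_ , f<d , _)              = <⇒≤ f<d
f≤hOf (M₃ d e h f) (_ , f<d , d<h , _)        = ≤-trans (<⇒≤ f<d) (<⇒≤ d<h)

⊓+⊔ : ∀ m n → (m ⊓ n) + (m ⊔ n) ≡ m + n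
⊓+⊔ m n with ≤-total m n
... | inj₁ m≤n = cong₂ _+_ (m≤n⇒m⊓n≡m m≤n) (m≤n⇒m⊔n≡n m≤n)
... | inj₂ n≤m = trans (cong₂ _+_ (m≥n⇒m⊓n≡n n≤m) (m≥n⇒m⊔n≡m n≤m)) (+-comm n m)

-- The order of G is that of G′ times that of G / G′, written in exponents. It determines d once e
-- is known.
d+e-invariant : ∀ F → Admissible F → dOf F + eOf F ≡ (hOf F ∸ fOf F) + ((fOf F ⊓ sOf F) + (fOf F ⊔ sOf F))
d+e-invariant F A = trans (d+e≡h+s F A) (trans (cong (_+ sOf F) (sym (m∸n+n≡m (f≤hOf F A))))
  (trans (+-assoc (hOf F ∸ fOf F) (fOf F) (sOf F)) (cong (hOf F ∸ fOf F +_) (sym (⊓+⊔ (fOf F) (sOf F))))))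

uniqueness : ∀ p (pr : Prime p) (2<p : 2 < p) F F′ → Admissible F → Admissible F′ →
  ∀ G → Presents G (rels p F) → Presents G (rels p F′) → F ≡ F′
uniqueness p pr 2<p F F′ A A′ G P P′ = trans (sym (recover-correct F A))
  (trans (cong₂ (λ f g → f g) (cong₂ (λ d e → λ (x : ℕ × ℕ) → recover d e (proj₁ x) (proj₂ x)) d≡ e≡) (cong₂ _,_ mn≡ mx≡)) (recover-correct F′ A′))
  where
  open Recovery p pr 2<p using (compareF)
  c₁ = compareF F F′ A A′ P P′
  c₂ = compareF F′ F A′ A P′ P
  e≡ : eOf F ≡ eOf F′
  e≡ = ≤-antisym (proj₁ c₂) (proj₁ c₁)
  κ≡ : hOf F ∸ fOf F ≡ hOf F′ ∸ fOf F′
  κ≡ = ≤-antisym (proj₁ (proj₂ c₂)) (proj₁ (proj₂ c₁))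
  mx≡ : fOf F ⊔ sOf F ≡ fOf F′ ⊔ sOf F′
  mx≡ = ≤-antisym (proj₁ (proj₂ (proj₂ c₂))) (proj₁ (proj₂ (proj₂ c₁)))
  mn≡ : fOf F ⊓ sOf F ≡ fOf F′ ⊓ sOf F′
  mn≡ = ≤-antisym (proj₂ (proj₂ (proj₂ c₂))) (proj₂ (proj₂ (proj₂ c₁)))
  d≡ : dOf F ≡ dOf F′
  d≡ = +-cancelʳ-≡ (eOf F) (dOf F) (dOf F′) (trans (d+e-invariant F A) (trans (cong₂ _+_ κ≡ (cong₂ _+_ mn≡ mx≡))
    (trans (sym (d+e-invariant F′ A′)) (cong (dOf F′ +_) (sym e≡)))))

theorem3p7 : (p : ℕ) → Prime p → 2 < p →
    ((d e : ℕ) → 1 ≤ d → d ≤ e →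
    (N : ℕ) (D : Dessin N) → Regular D →
    (UnderlyingK D (p ^ d) (p ^ e) ⊎ UnderlyingK D (p ^ e) (p ^ d)) →
    Σ Family (λ F → Admissible F × dOf F ≡ d × eOf F ≡ e
    × Presents (AutGroup D) (rels p F)))
    × ((F F′ : Family) → Admissible F → Admissible F′ →
    (G : Group 0ℓ 0ℓ) → Presents G (rels p F) → Presents G (rels p F′) →
    F ≡ F′)
theorem3p7 p pr 2<p = classification p pr 2<p , uniqueness p pr 2<p
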